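{- Let $G$ be a $Z$-group and let $X\subset G^{m+n}$ be a $\emptyset$-definable Presburger set. Then there exists a finite partition $\mathcal{P}$ of $X$ into $\emptyset$-definable Presburger sets such that for each $A\in\mathcal{P}$ there is a set $B\subset G^{m+n}$ with $\pi_m(A)=\pi_m(B)$, an integer $l\ge0$ depending only on $A$, and a $\emptyset$-definable family $\{f_\lambda\}_{\lambda\in\pi_m(A)}$ of linear bijections $f_\lambda:A_\lambda\to B_\lambda$ (with $A_\lambda,B_\lambda\subset G^n$), where for each $\lambda$ the set $B_\lambda$ is of the form $H^l\times\Lambda_\lambda$ with $\Lambda_\lambda$ a bounded $\lambda$-definable set.
   Context: A $Z$-group is a structure elementarily equivalent to $\mathbb{Z}$ in the Presburger language $\mathcal{L}_{Pres}=\langle +,\leq,\{\equiv\pmod n\}_{n>0},0,1\rangle$; Presburger sets are $\mathcal{L}_{Pres}$-definable sets, $\emptyset$-definable means definable without parameters, $\lambda$-definable means definable with the parameters $\lambda$. $H=\{x\in G\mid x\ge0\}$, $H^0=\{0\}$. $\pi_m:G^{m+n}\to G^m$ is the projection onto the first $m$ coordinates, and for $Y\subset G^{m+n}$ and $\lambda\in\pi_m(Y)$, $Y_\lambda=\{y\in G^n\mid (\lambda,y)\in Y\}$. A set $Y\subset G^k$ is bounded if there is $z\in H^k$ with $-z_i\le y_i\le z_i$ for all $y\in Y$ and all $i$. For $y\equiv0\pmod n$, $y/n$ is the unique $z$ with $nz=y$. A function $f:X\subset G^k\to G$ is linear if there are $\gamma\in G$ and integers $a_i$, $0\le c_i<n_i$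 with $x_i\equiv c_i\pmod{n_i}$ and $f(x)=\sum_i a_i\frac{x_i-c_i}{n_i}+\gamma$ for all $x\in X$; a map into $G^n$ is linear if each coordinate is linear. -}

module Defs where

open import Level using (0ℓ)
open import Data.Nat as ℕ using (ℕ; zero; suc; _<_)
open import Data.Integer as ℤ using (ℤ; +_; -[1+_])
open import Data.Integer.Divisibility as ℤD using ()
open import Data.Fin using (Fin; cast)
open import Data.Vec.Functional using (Vector; []; _∷_; _++_; take; drop)
open import Data.Product using (Σ; ∃; ∃-syntax; _×_; _,_)
open import Data.Sum using (_⊎_)
open import Data.Empty using (⊥)
open import Relation.Binary.PropositionalEquality using (_≡_)
open import Function.Bundles using (_⇔_)

data Term (k : ℕ) : Set where
  var  : Fin k → Term k
  `0   : Term k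
  `1   : Term k
  _`+_ : Term k → Term k → Term k

-- Formulas with k free variables.  The congruence atom  cong n t s
-- stands for  t ≡ s (mod (suc n)), so that every modulus is > 0.
data Formula (k : ℕ) : Set where
  _`≈_   : Term k → Term k → Formula k
  _`≤_   : Term k → Term k → Formula k
  cong   : ℕ → Term k → Term k → Formula k
  `⊥     : Formula k
  _`∧_   : Formula k → Formula k → Formula k
  _`∨_   : Formula k → Formula k → Formula k
  _`⇒_   : Formula k → Formula k → Formula k
  `∀     : Formula (suc k) → Formula k
  `∃     : Formula (suc k) → Formula k

record Structure : Set₁ where
  field
    Carrier : Set
    _⊕_     : Carrier → Carrier → Carrier
    _≼_     : Carrier → Carrier → Set
    Cong    : ℕ → Carrier → Carrier → Set   -- Cong n x y : x ≡ y mod (suc n)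
    zeroC   : Carrier
    oneC    : Carrier

module _ (M : Structure) where
  open Structure M

  evalT : ∀ {k} → Term k → Vector Carrier k → Carrier
  evalT (var i)  ρ = ρ i
  evalT `0       ρ = zeroC
  evalT `1       ρ = oneC
  evalT (t `+ s) ρ = evalT t ρ ⊕ evalT s ρ

  Sat : ∀ {k} → Formula k → Vector Carrier k → Set
  Sat (t `≈ s)     ρ = evalT t ρ ≡ evalT s ρ
  Sat (t `≤ s)     ρ = evalT t ρ ≼ evalT s ρ
  Sat (cong n t s) ρ = Cong n (evalT t ρ) (evalT s ρ)
  Sat `⊥           ρ = ⊥
  Sat (φ `∧ ψ)     ρ = Sat φ ρ × Sat ψ ρ
  Sat (φ `∨ ψ)     ρ = Sat φ ρ ⊎ Sat ψ ρ
  Sat (φ `⇒ ψ)     ρ = Sat φ ρ → Sat ψ ρ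
  Sat (`∀ φ)       ρ = (a : Carrier) → Sat φ (a ∷ ρ)
  Sat (`∃ φ)       ρ = Σ Carrier λ a → Sat φ (a ∷ ρ)

ℤ-Structure : Structure
ℤ-Structure = record
  { Carrier = ℤ
  ; _⊕_     = ℤ._+_
  ; _≼_     = ℤ._≤_
  ; Cong    = λ n x y → (+ suc n) ℤD.∣ (x ℤ.- y)
  ; zeroC   = + 0
  ; oneC    = + 1
  }

record ZGroup : Set₁ where
  field
    structure : Structure
    elemEquiv : (φ : Formula 0) →
                Sat structure φ [] ⇔ Sat ℤ-Structure φ []
  open Structure structure public

module _ (G : ZGroup) where
  open ZGroup G

  _·_ : ℕ → Carrier → Carrier
  zero  · x = zeroC
  suc n · x = x ⊕ (n · x)

  ΣG : ∀ {k} → Vector Carrier k → Carrier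
  ΣG {zero}  v = zeroC
  ΣG {suc k} v = v Fin.zero ⊕ ΣG (λ i → v (Fin.suc i))
    where import Data.Fin as Fin

  posPart : ℤ → ℕ
  posPart (+ n)    = n
  posPart -[1+ n ] = 0

  negPart : ℤ → ℕ
  negPart (+ n)    = 0
  negPart -[1+ n ] = suc n

  _≋_ : ∀ {k} → Vector Carrier k → Vector Carrier k → Set
  x ≋ y = ∀ i → x i ≡ y i

  InProj : ∀ m n → (Vector Carrier (m ℕ.+ n) → Set) → Vector Carrier m → Set
  InProj m n Y λ' = ∃[ y ] Y (λ' ++ y)

  -- A function (given by its graph Γ) on X ⊂ G^k into G is linear:
  -- there are γ ∈ G, integers a_i, moduli N_i > 0 (written suc N_i) and
  -- residues 0 ≤ c_i < suc N_i with x_i ≡ c_i (mod suc N_i) on X and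
  --   f(x) = Σ_i a_i (x_i - c_i)/(suc N_i) + γ .
  -- The integer combination is written with negative coefficients moved
  -- to the left:  f(x) + Σ negPart(a_i)·z_i = Σ posPart(a_i)·z_i + γ,
  -- where z_i = (x_i - c_i)/(suc N_i), i.e. (suc N_i)·z_i + c_i·1 = x_i.
  IsLinearGraph : ∀ k → (Vector Carrier k → Set) →
                  (Vector Carrier k → Carrier → Set) → Set
  IsLinearGraph k X Γ =
    Σ Carrier λ γ → Σ (Vector ℤ k) λ a → Σ (Vector ℕ k) λ N →
    Σ (Vector ℕ k) λ c → (∀ i → c i < suc (N i)) ×
    (∀ x → X x →
       (∀ i → Cong (N i) (x i) (c i · oneC)) ×
       (∀ v → Γ x v →
          Σ (Vector Carrier k) λ z → ((∀ i → (suc (N i) · z i) ⊕ (c i · oneC) ≡ x i) ×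
                  (v ⊕ ΣG (λ i → negPart (a i) · z i)
                     ≡ ΣG (λ i → posPart (a i) · z i) ⊕ γ))))

  -- Λ ⊂ G^r is bounded: some z ∈ H^r with -z_i ≤ w_i ≤ z_i on Λ.
  -- (-z_i ≤ w_i is written as: the additive inverse u of z_i satisfies u ≤ w_i.)
  Bounded : ∀ r → (Vector Carrier r → Set) → Set
  Bounded r Λ = Σ (Vector Carrier r) λ z → ((∀ i → zeroC ≼ z i) ×
    (∀ w → Λ w → ∀ i → (Σ Carrier λ u → ((u ⊕ z i ≡ zeroC) × (u ≼ w i))) × (w i ≼ z i)))

  GoodPiece : ∀ m n → Formula (m ℕ.+ n) → Set₁
  GoodPiece m n A =
    let A' : Vector Carrier (m ℕ.+ n) → Set
        A' = Sat structure A in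
    Σ (Vector Carrier (m ℕ.+ n) → Set) λ B →
    (∀ λ' → InProj m n A' λ' ⇔ InProj m n B λ') ×
    Σ ℕ λ l → Σ ℕ λ r → Σ (l ℕ.+ r ≡ n) λ eq →
    Σ (Formula ((m ℕ.+ n) ℕ.+ n)) λ F →
    ∀ λ' → InProj m n A' λ' →
      let Aλ : Vector Carrier n → Set
          Aλ x = A' (λ' ++ x)
          Bλ : Vector Carrier n → Set
          Bλ y = B (λ' ++ y)
          Fλ : Vector Carrier n → Vector Carrier n → Set
          Fλ x y = Sat structure F ((λ' ++ x) ++ y)
      in
      ((∀ x y → Fλ x y → Aλ x) ×
       (∀ x → Aλ x → ∃[ y ] Fλ x y) ×
       (∀ x y y' → Fλ x y → Fλ x y' → y ≋ y') ×
       (∀ x y → Fλ x y → Bλ y) ×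
       (∀ x x' y → Fλ x y → Fλ x' y → x ≋ x') ×
       (∀ y → Bλ y → ∃[ x ] Fλ x y)) ×
      (∀ j → IsLinearGraph n Aλ (λ x v → ∃[ y ] (Fλ x y × (y j ≡ v)))) ×
      (Σ (Formula (m ℕ.+ r)) λ θ →
         let Λλ : Vector Carrier r → Set
             Λλ w = Sat structure θ (λ' ++ w)
         in Bounded r Λλ ×
            (∀ y → Bλ y ⇔
                   ((∀ i → zeroC ≼ take l (y ∘c cast eq) i) ×
                    Λλ (drop l (y ∘c cast eq)))))
    where
      _∘c_ : ∀ {a b : ℕ} → Vector Carrier b → (Fin a → Fin b) → Vector Carrier a
      (y ∘c f) i = y (f i)

  IsPartition : ∀ {d} k → Formula d → (Fin k → Formula d) → Set
  IsPartition k X P =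
    (∀ j x → Sat structure (P j) x → Sat structure X x) ×
    (∀ x → Sat structure X x → ∃[ j ] Sat structure (P j) x) ×
    (∀ j j' x → Sat structure (P j) x → Sat structure (P j') x → j ≡ j')

-- Quantifiers are eliminated as in Cooper's and Reddy–Loveland's procedures: a quantifier-free φ(t)
-- that holds somewhere holds at a point where one of the linear forms occurring in it takes a small
-- integer value, since moving t towards the nearest breakpoint in steps divisible by all moduli
-- changes no atom. So X may be taken quantifier-free; let N + 1 be a common multiple of its moduli.
--
-- Splitting G^n by signs and by residues modulo N + 1 writes each part as an orthant H^n in
-- coordinates p with x = (N + 1) q + c, q = p or −p − 1, on which the congruences in X do not depend
-- on p. The inequalities are treated one at a time. As long as p enters with coefficients of
-- opposite signs, comparing two coordinates and subtracting the smaller from the larger (Euclid)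
-- splits the part into two orthants; only such integral unimodular substitutions occur, so the
-- maps stay linear in the sense of the theorem. Once all coefficients have the same sign, say
-- Σ aᵢ pᵢ + β ≥ 0 with aᵢ ≥ 0, either β ≥ 0, or some pᵢ with aᵢ > 0 satisfies pᵢ ≥ −β and can be
-- translated by β, or pᵢ < −β and pᵢ becomes a bounded coordinate. In the end the truth of X
-- depends only on the bounded coordinates.
--
-- All first-order facts about G that are needed are transferred from ℤ as sentences.

{-# OPTIONS --safe #-}
module Submission where

open import Defs
open import Data.Nat using (ℕ; _+_)
open import Data.Fin using (Fin)
open import Data.Product using (Σ; _×_)

open import Data.Nat as ℕ using (zero; suc; z≤n; s≤s)
import Data.Nat.Properties as ℕP
open import Data.Integer as ℤ using (ℤ; +_; -[1+_]; _⊖_)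
import Data.Integer.Properties as ℤP
import Data.Integer.DivMod as ℤDM
open import Data.Integer.Divisibility.Signed as Signed using (divides)
open import Data.Integer.Tactic.RingSolver using (solve-∀)
open import Data.Fin as Fin using (zero; suc; _↑ˡ_; _↑ʳ_; splitAt; join)
import Data.Fin.Properties as FinP
open import Data.Bool using (Bool; true; false; not; _∧_; if_then_else_)
import Data.Bool.Properties as BoolP
open import Data.List using (List; []; _∷_; _++_; map; upTo; allFin)
open import Data.List.Relation.Unary.All as All using (All; []; _∷_)
import Data.List.Relation.Unary.All.Properties as AllP
open import Data.List.Relation.Unary.Any using (here; there)
open import Data.List.Membership.Propositional using (_∈_)
import Data.List.Membership.Propositional.Properties as ∈P
open import Data.Vec.Functional as VF using (Vector)
import Data.Vec.Functional.Properties as VFP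
open import Data.Vec as Vec using (Vec; []; _∷_)
import Data.Vec.Properties as VecP
open import Data.Product using (_,_; proj₁; proj₂)
open import Data.Sum as Sum using (_⊎_; inj₁; inj₂)
open import Data.Unit using (⊤; tt)
open import Data.Empty using (⊥; ⊥-elim)
open import Relation.Nullary using (¬_; Dec; yes; no)
open import Relation.Binary.PropositionalEquality
  using (_≡_; _≢_; refl; sym; trans; cong₂; subst; module ≡-Reasoning)
  renaming (cong to ap)
open import Function.Bundles using (Equivalence; mk⇔)

-- `Sat` reads disjunctions and existential quantifiers constructively, so no case distinction on
-- elements of a Z-group is available beforehand. It is gained by transferring sentences that
-- contain disjunctions or existential quantifiers: they make the order and divisibility by standard
-- integers decidable. Quantifier elimination then gives every formula a Boolean value, and this is
-- what allows a set to be cut into a part and its complement. The other constraint is uniformity in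
-- λ. A coordinate change is given by affine forms in λ and p with integer coefficients, fixed for
-- the whole family, and every cut is a formula in λ and x. The inverse of the change is stored
-- multiplied by N + 1; as later substitutions are integral, this one denominator serves throughout.
-- The bounds and the constants γ are elements of G that may depend on λ. Refinements made for one
-- atom must not destroy what was achieved for the earlier ones; this preservation is the order used
-- on the parts.

multT : ∀ {k} → ℕ → Term k → Term k
multT zero    t = `0
multT (suc n) t = t `+ multT n t

evalT-multT-ℤ : ∀ {k} n (t : Term k) ρ →
  evalT ℤ-Structure (multT n t) ρ ≡ + n ℤ.* evalT ℤ-Structure t ρ
evalT-multT-ℤ zero    t ρ = sym (ℤP.*-zeroˡ (evalT ℤ-Structure t ρ))
evalT-multT-ℤ (suc n) t ρ =
  trans (ap (λ e → evalT ℤ-Structure t ρ ℤ.+ e) (evalT-multT-ℤ n t ρ))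
        (sym (ℤP.suc-* (+ n) _))

0≤⊎+1≤0 : ∀ x → + 0 ℤ.≤ x ⊎ x ℤ.+ + 1 ℤ.≤ + 0
0≤⊎+1≤0 (+ n)        = inj₁ (ℤ.+≤+ z≤n)
0≤⊎+1≤0 -[1+ zero ]  = inj₂ (ℤ.+≤+ z≤n)
0≤⊎+1≤0 -[1+ suc n ] = inj₂ ℤ.-≤+

⊖-+-⊖ : ∀ p q r s → (p ⊖ q) ℤ.+ (r ⊖ s) ≡ (p ℕ.+ r) ⊖ (q ℕ.+ s)
⊖-+-⊖ p q r s = begin
  (p ⊖ q) ℤ.+ (r ⊖ s)
    ≡⟨ cong₂ ℤ._+_ (ℤP.m-n≡m⊖n p q) (ℤP.m-n≡m⊖n r s) ⟨
  (+ p ℤ.- + q) ℤ.+ (+ r ℤ.- + s)     ≡⟨ rearrange (+ p) (+ q) (+ r) (+ s) ⟩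
  (+ p ℤ.+ + r) ℤ.- (+ q ℤ.+ + s)     ≡⟨ ℤP.m-n≡m⊖n (p ℕ.+ r) (q ℕ.+ s) ⟩
  (p ℕ.+ r) ⊖ (q ℕ.+ s)               ∎
  where
  open ≡-Reasoning
  rearrange : ∀ a b c d → (a ℤ.- b) ℤ.+ (c ℤ.- d) ≡ (a ℤ.+ c) ℤ.- (b ℤ.+ d)
  rearrange = solve-∀

⊖-*-⊖ : ∀ p q r s →
  (p ⊖ q) ℤ.* (r ⊖ s) ≡ (p ℕ.* r ℕ.+ q ℕ.* s) ⊖ (p ℕ.* s ℕ.+ q ℕ.* r)
⊖-*-⊖ p q r s = begin
  (p ⊖ q) ℤ.* (r ⊖ s)
    ≡⟨ cong₂ ℤ._*_ (ℤP.m-n≡m⊖n p q) (ℤP.m-n≡m⊖n r s) ⟨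
  (+ p ℤ.- + q) ℤ.* (+ r ℤ.- + s)
    ≡⟨ expand (+ p) (+ q) (+ r) (+ s) ⟩
  (+ p ℤ.* + r ℤ.+ + q ℤ.* + s) ℤ.- (+ p ℤ.* + s ℤ.+ + q ℤ.* + r)
    ≡⟨ cong₂ ℤ._-_ (cong₂ ℤ._+_ (ℤP.pos-* p r) (ℤP.pos-* q s))
                   (cong₂ ℤ._+_ (ℤP.pos-* p s) (ℤP.pos-* q r)) ⟨
  (+ (p ℕ.* r ℕ.+ q ℕ.* s)) ℤ.- (+ (p ℕ.* s ℕ.+ q ℕ.* r))
    ≡⟨ ℤP.m-n≡m⊖n (p ℕ.* r ℕ.+ q ℕ.* s) (p ℕ.* s ℕ.+ q ℕ.* r) ⟩
  (p ℕ.* r ℕ.+ q ℕ.* s) ⊖ (p ℕ.* s ℕ.+ q ℕ.* r)  ∎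
  where
  open ≡-Reasoning
  expand : ∀ a b c d → (a ℤ.- b) ℤ.* (c ℤ.- d) ≡ (a ℤ.* c ℤ.+ b ℤ.* d) ℤ.- (a ℤ.* d ℤ.+ b ℤ.* c)
  expand = solve-∀

-- Environments list the innermost bound variable first.
Cong-ℤ⇒ : ∀ n x y → Structure.Cong ℤ-Structure n x y →
  Σ ℤ λ z → x ≡ y ℤ.+ evalT ℤ-Structure (multT (suc n) (var zero)) (z VF.∷ (y VF.∷ (x VF.∷ VF.[])))
Cong-ℤ⇒ n x y n∣ with Signed.∣ᵤ⇒∣ n∣
... | divides q eq = q , (begin
  x                        ≡⟨ split x y ⟩
  y ℤ.+ (x ℤ.- y)          ≡⟨ ap (λ e → y ℤ.+ e) eq ⟩
  y ℤ.+ q ℤ.* + suc n      ≡⟨ ap (λ e → y ℤ.+ e) (ℤP.*-comm q (+ suc n)) ⟩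
  y ℤ.+ + suc n ℤ.* q
    ≡⟨ ap (λ e → y ℤ.+ e) (evalT-multT-ℤ (suc n) (var zero) (q VF.∷ (y VF.∷ (x VF.∷ VF.[])))) ⟨
  y ℤ.+ evalT ℤ-Structure (multT (suc n) (var zero)) (q VF.∷ (y VF.∷ (x VF.∷ VF.[]))) ∎)
  where
  open ≡-Reasoning
  split : ∀ x y → x ≡ y ℤ.+ (x ℤ.- y)
  split = solve-∀

⇒Cong-ℤ : ∀ n x y z →
  x ≡ y ℤ.+ evalT ℤ-Structure (multT (suc n) (var zero)) (z VF.∷ (y VF.∷ (x VF.∷ VF.[]))) →
  Structure.Cong ℤ-Structure n x y
⇒Cong-ℤ n x y z eq = Signed.∣⇒∣ᵤ (divides z (begin
  x ℤ.- y                                ≡⟨ ap (λ e → e ℤ.- y) eq ⟩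
  (y ℤ.+ evalT ℤ-Structure (multT (suc n) (var zero)) ρ) ℤ.- y
    ≡⟨ ap (λ e → (y ℤ.+ e) ℤ.- y) (evalT-multT-ℤ (suc n) (var zero) ρ) ⟩
  (y ℤ.+ + suc n ℤ.* z) ℤ.- y            ≡⟨ cancel y (+ suc n) z ⟩
  z ℤ.* + suc n                          ∎))
  where
  open ≡-Reasoning
  ρ = z VF.∷ (y VF.∷ (x VF.∷ VF.[]))
  cancel : ∀ y n z → (y ℤ.+ n ℤ.* z) ℤ.- y ≡ z ℤ.* n
  cancel = solve-∀

-- Phrased with `evalT` of `multT` terms in explicit environments, so that the type is
-- definitionally that of the sentence transferred in `divide`.
divide-ℤ : ∀ n x → Σ ℤ λ q → Σ ℤ λ r → (+ 0 ℤ.≤ r) ×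
  (r ℤ.≤ evalT ℤ-Structure (multT n `1) (r VF.∷ (q VF.∷ (x VF.∷ VF.[])))) ×
  (x ≡ r ℤ.+ evalT ℤ-Structure (multT (suc n) (var (suc zero))) (r VF.∷ (q VF.∷ (x VF.∷ VF.[]))))
divide-ℤ n x = q , + r , ℤ.+≤+ z≤n ,
  subst (λ e → + r ℤ.≤ e)
    (sym (trans (evalT-multT-ℤ n `1 (+ r VF.∷ (q VF.∷ (x VF.∷ VF.[])))) (ℤP.*-identityʳ (+ n))))
    (ℤ.+≤+ (ℕP.≤-pred (ℤDM.n%ℕd<d x (suc n)))) ,
  (begin
    x                          ≡⟨ ℤDM.a≡a%ℕn+[a/ℕn]*n x (suc n) ⟩
    + r ℤ.+ q ℤ.* + suc n      ≡⟨ ap (λ e → + r ℤ.+ e) (ℤP.*-comm q (+ suc n)) ⟩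
    + r ℤ.+ + suc n ℤ.* q
      ≡⟨ ap (λ e → + r ℤ.+ e) (evalT-multT-ℤ (suc n) (var (suc zero)) (+ r VF.∷ (q VF.∷ (x VF.∷ VF.[])))) ⟨
    + r ℤ.+ evalT ℤ-Structure (multT (suc n) (var (suc zero))) (+ r VF.∷ (q VF.∷ (x VF.∷ VF.[]))) ∎)
  where
  open ≡-Reasoning
  q = x ℤDM./ℕ suc n
  r = x ℤDM.%ℕ suc n

-- A Z-group as an ordered abelian group with integer multiples

module ZGroupAlgebra (G : ZGroup) where
  open ZGroup G public renaming (_⊕_ to infixl 6 _⊕_; _≼_ to infix 4 _≼_)

  infixr 7 _•_
  _•_ : ℕ → Carrier → Carrier
  _•_ = _·_ G

  -- Because of the constructive reading of `Sat`, a transferred sentence yields an actual decision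
  -- or witness in `G`; all case distinctions on elements of `G` go back to this.
  transfer : (φ : Formula 0) → Sat ℤ-Structure φ VF.[] → Sat structure φ VF.[]
  transfer φ = Equivalence.from (elemEquiv φ)

  private
    x₀ : ∀ {k} → Term (suc k)
    x₀ = var zero
    x₁ : ∀ {k} → Term (suc (suc k))
    x₁ = var (suc zero)
    x₂ : ∀ {k} → Term (suc (suc (suc k)))
    x₂ = var (suc (suc zero))

  evalT-multT : ∀ {k} n (t : Term k) ρ →
    evalT structure (multT n t) ρ ≡ n • evalT structure t ρ
  evalT-multT zero    t ρ = refl
  evalT-multT (suc n) t ρ = ap (λ e → evalT structure t ρ ⊕ e) (evalT-multT n t ρ)

  abstract
    ⊕-assoc : ∀ x y z → (x ⊕ y) ⊕ z ≡ x ⊕ (y ⊕ z)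
    ⊕-assoc = transfer (`∀ (`∀ (`∀ (((x₂ `+ x₁) `+ x₀) `≈ (x₂ `+ (x₁ `+ x₀))))))
                ℤP.+-assoc

    ⊕-comm : ∀ x y → x ⊕ y ≡ y ⊕ x
    ⊕-comm = transfer (`∀ (`∀ ((x₁ `+ x₀) `≈ (x₀ `+ x₁)))) ℤP.+-comm

    ⊕-identityˡ : ∀ x → zeroC ⊕ x ≡ x
    ⊕-identityˡ = transfer (`∀ ((`0 `+ x₀) `≈ x₀)) ℤP.+-identityˡ

    opposite : ∀ x → Σ Carrier λ y → y ⊕ x ≡ zeroC
    opposite = transfer (`∀ (`∃ ((x₀ `+ x₁) `≈ `0)))
                 λ x → ℤ.- x , ℤP.+-inverseˡ x

    ≼-⊕ : ∀ x y → x ≼ y → ∀ z → (x ⊕ z) ≼ (y ⊕ z)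
    ≼-⊕ = transfer (`∀ (`∀ ((x₁ `≤ x₀) `⇒ `∀ ((x₂ `+ x₀) `≤ (x₁ `+ x₀)))))
            λ x y x≤y z → ℤP.+-monoˡ-≤ z x≤y

    0≼-⊕ : ∀ x y → zeroC ≼ x → zeroC ≼ y → zeroC ≼ (x ⊕ y)
    0≼-⊕ = transfer (`∀ (`∀ ((`0 `≤ x₁) `⇒ ((`0 `≤ x₀) `⇒ (`0 `≤ (x₁ `+ x₀))))))
             λ x y → ℤP.+-mono-≤ {+ 0} {x} {+ 0} {y}

    0≼0 : zeroC ≼ zeroC
    0≼0 = transfer (`0 `≤ `0) ℤP.≤-refl

    0≼1 : zeroC ≼ oneC
    0≼1 = transfer (`0 `≤ `1) (ℤ.+≤+ z≤n)

    1⋠0 : ¬ (oneC ≼ zeroC)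
    1⋠0 = transfer ((`1 `≤ `0) `⇒ `⊥) λ { (ℤ.+≤+ ()) }

    -- Totality and discreteness in one sentence: the second case is x + 1 ≤ 0 rather than x < 0, so
    -- that both cases are weak inequalities and hence atoms of the same kind.
    ≼-discrete : ∀ x → zeroC ≼ x ⊎ (x ⊕ oneC) ≼ zeroC
    ≼-discrete = transfer (`∀ ((`0 `≤ x₀) `∨ ((x₀ `+ `1) `≤ `0))) 0≤⊎+1≤0

    ≼-antisym : ∀ x → zeroC ≼ x → x ≼ zeroC → x ≡ zeroC
    ≼-antisym = transfer (`∀ ((`0 `≤ x₀) `⇒ ((x₀ `≤ `0) `⇒ (x₀ `≈ `0))))
                  λ x p q → ℤP.≤-antisym q p

    Cong⇒ : ∀ n x y → Cong n x y → Σ Carrier λ z → x ≡ y ⊕ suc n • z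
    Cong⇒ n x y c with transfer
        (`∀ (`∀ (cong n x₁ x₀ `⇒ `∃ (x₂ `≈ (x₁ `+ multT (suc n) x₀))))) (Cong-ℤ⇒ n) x y c
    ... | z , eq = z , trans eq (ap (λ e → y ⊕ e) (evalT-multT (suc n) x₀ _))

    ⇒Cong : ∀ n x y z → x ≡ y ⊕ suc n • z → Cong n x y
    ⇒Cong n x y z eq = transfer
        (`∀ (`∀ (`∀ ((x₂ `≈ (x₁ `+ multT (suc n) x₀)) `⇒ cong n x₂ x₁)))) (⇒Cong-ℤ n) x y z
        (trans eq (sym (ap (λ e → y ⊕ e) (evalT-multT (suc n) x₀ (z VF.∷ (y VF.∷ (x VF.∷ VF.[])))))))

    -- One sentence for each standard `n`, which may therefore occur in the term for the bound. Here
    -- the remainder is merely an element of `G`; `numeral` identifies it as an integer.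
    divide : ∀ n x → Σ Carrier λ q → Σ Carrier λ r →
      (zeroC ≼ r) × (r ≼ n • oneC) × (x ≡ r ⊕ suc n • q)
    divide n x with transfer
        (`∀ (`∃ (`∃ ((`0 `≤ x₀) `∧ ((x₀ `≤ multT n `1) `∧
          (x₂ `≈ (x₀ `+ multT (suc n) x₁))))))) (divide-ℤ n) x
    ... | q , r , 0≼r , r≼n , eq =
      q , r , 0≼r , subst (λ e → r ≼ e) (evalT-multT n `1 (r VF.∷ (q VF.∷ (x VF.∷ VF.[])))) r≼n ,
      trans eq (ap (λ e → r ⊕ e) (evalT-multT (suc n) x₁ (r VF.∷ (q VF.∷ (x VF.∷ VF.[])))))

    ⊝_ : Carrier → Carrier
    ⊝ x = proj₁ (opposite x)

    ⊝-inverseˡ : ∀ x → (⊝ x) ⊕ x ≡ zeroC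
    ⊝-inverseˡ x = proj₂ (opposite x)

  infix 8 ⊝_

  ⊕-identityʳ : ∀ x → x ⊕ zeroC ≡ x
  ⊕-identityʳ x = trans (⊕-comm x zeroC) (⊕-identityˡ x)

  ⊝-inverseʳ : ∀ x → x ⊕ ⊝ x ≡ zeroC
  ⊝-inverseʳ x = trans (⊕-comm x (⊝ x)) (⊝-inverseˡ x)

  ⊕-interchange : ∀ a b c d → (a ⊕ b) ⊕ (c ⊕ d) ≡ (a ⊕ c) ⊕ (b ⊕ d)
  ⊕-interchange a b c d = begin
    (a ⊕ b) ⊕ (c ⊕ d)   ≡⟨ ⊕-assoc a b _ ⟩
    a ⊕ (b ⊕ (c ⊕ d))   ≡⟨ ap (λ e → a ⊕ e) (⊕-assoc b c d) ⟨
    a ⊕ ((b ⊕ c) ⊕ d)   ≡⟨ ap (λ e → a ⊕ (e ⊕ d)) (⊕-comm b c) ⟩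
    a ⊕ ((c ⊕ b) ⊕ d)   ≡⟨ ap (λ e → a ⊕ e) (⊕-assoc c b d) ⟩
    a ⊕ (c ⊕ (b ⊕ d))   ≡⟨ ⊕-assoc a c _ ⟨
    (a ⊕ c) ⊕ (b ⊕ d)   ∎
    where open ≡-Reasoning

  ⊕-cancelʳ : ∀ z {x y} → x ⊕ z ≡ y ⊕ z → x ≡ y
  ⊕-cancelʳ z {x} {y} eq = trans (sym (strip x)) (trans (ap (λ e → e ⊕ ⊝ z) eq) (strip y))
    where
    strip : ∀ x → (x ⊕ z) ⊕ ⊝ z ≡ x
    strip x = trans (⊕-assoc x z _) (trans (ap (λ e → x ⊕ e) (⊝-inverseʳ z)) (⊕-identityʳ x))

  ⊝-unique : ∀ {x y} → x ⊕ y ≡ zeroC → x ≡ ⊝ y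
  ⊝-unique {x} {y} eq = ⊕-cancelʳ y (trans eq (sym (⊝-inverseˡ y)))

  ⊝-⊕ : ∀ x y → ⊝ x ⊕ ⊝ y ≡ ⊝ (x ⊕ y)
  ⊝-⊕ x y = ⊝-unique (trans (⊕-interchange (⊝ x) (⊝ y) x y)
    (trans (cong₂ _⊕_ (⊝-inverseˡ x) (⊝-inverseˡ y)) (⊕-identityˡ zeroC)))

  ⊝-involutive : ∀ x → ⊝ ⊝ x ≡ x
  ⊝-involutive x = sym (⊝-unique (⊝-inverseʳ x))

  ⊝-zero : ⊝ zeroC ≡ zeroC
  ⊝-zero = sym (⊝-unique (⊕-identityˡ zeroC))

  •-homo-+ : ∀ x m n → (m ℕ.+ n) • x ≡ m • x ⊕ n • x
  •-homo-+ x zero    n = sym (⊕-identityˡ _)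
  •-homo-+ x (suc m) n = trans (ap (λ e → x ⊕ e) (•-homo-+ x m n)) (sym (⊕-assoc x _ _))

  •-assocˡ : ∀ x m n → m • n • x ≡ (m ℕ.* n) • x
  •-assocˡ x zero    n = refl
  •-assocˡ x (suc m) n =
    trans (ap (λ e → n • x ⊕ e) (•-assocˡ x m n)) (sym (•-homo-+ x n (m ℕ.* n)))

  •-distrib-⊕ : ∀ x y n → n • (x ⊕ y) ≡ n • x ⊕ n • y
  •-distrib-⊕ x y zero    = sym (⊕-identityˡ zeroC)
  •-distrib-⊕ x y (suc n) =
    trans (ap (λ e → (x ⊕ y) ⊕ e) (•-distrib-⊕ x y n)) (⊕-interchange x y _ _)

  •-⊝ : ∀ n x → n • (⊝ x) ≡ ⊝ (n • x)
  •-⊝ zero    x = sym ⊝-zero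
  •-⊝ (suc n) x = trans (ap (λ e → ⊝ x ⊕ e) (•-⊝ n x)) (⊝-⊕ x (n • x))

  •-zero : ∀ n → n • zeroC ≡ zeroC
  •-zero zero    = refl
  •-zero (suc n) = trans (⊕-identityˡ _) (•-zero n)

  private
    ⁺ ⁻ : ℤ → ℕ
    ⁺ = posPart G
    ⁻ = negPart G

  private
    ⁺⊖⁻ : ∀ a → ⁺ a ⊖ ⁻ a ≡ a
    ⁺⊖⁻ (+ n)    = refl
    ⁺⊖⁻ -[1+ n ] = refl

    parts-⊖ : ∀ p q → ⁺ (p ⊖ q) ℕ.+ q ≡ p ℕ.+ ⁻ (p ⊖ q)
    parts-⊖ zero    zero    = refl
    parts-⊖ zero    (suc q) = refl
    parts-⊖ (suc p) zero    = refl
    parts-⊖ (suc p) (suc q) rewrite ℤP.[1+m]⊖[1+n]≡m⊖n p q =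
      trans (ℕP.+-suc _ q) (ap suc (parts-⊖ p q))

  cross : ∀ {a b c d} → a ⊕ d ≡ c ⊕ b → a ⊕ ⊝ b ≡ c ⊕ ⊝ d
  cross {a} {b} {c} {d} eq = ⊕-cancelʳ (b ⊕ d) (begin
    (a ⊕ ⊝ b) ⊕ (b ⊕ d)   ≡⟨ ⊕-assoc a _ _ ⟩
    a ⊕ (⊝ b ⊕ (b ⊕ d))   ≡⟨ ap (λ e → a ⊕ e) (absorb b d) ⟩
    a ⊕ d                 ≡⟨ eq ⟩
    c ⊕ b                 ≡⟨ ap (λ e → c ⊕ e) (absorb d b) ⟨
    c ⊕ (⊝ d ⊕ (d ⊕ b))   ≡⟨ ⊕-assoc c _ _ ⟨
    (c ⊕ ⊝ d) ⊕ (d ⊕ b)   ≡⟨ ap (λ e → (c ⊕ ⊝ d) ⊕ e) (⊕-comm d b) ⟩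
    (c ⊕ ⊝ d) ⊕ (b ⊕ d)   ∎)
    where
    open ≡-Reasoning
    absorb : ∀ x y → ⊝ x ⊕ (x ⊕ y) ≡ y
    absorb x y = trans (sym (⊕-assoc (⊝ x) x y))
                       (trans (ap (λ e → e ⊕ y) (⊝-inverseˡ x)) (⊕-identityˡ y))

  infixr 7 _⊛_

  abstract
    -- Defined through `posPart` and `negPart` because neither the notion of linearity to be proved
    -- nor the terms of the language know negative coefficients; `⊛-parts` converts between the two
    -- readings.
    _⊛_ : ℤ → Carrier → Carrier
    a ⊛ x = ⁺ a • x ⊕ ⊝ (⁻ a • x)

    ⊛-parts : ∀ a x → a ⊛ x ≡ ⁺ a • x ⊕ ⊝ (⁻ a • x)
    ⊛-parts a x = refl

    -- Independence of the representation of an integer as a difference; with it, the laws for sums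
    -- and products of integers reduce to computations with natural multiples.
    ⊖-⊛ : ∀ p q x → (p ⊖ q) ⊛ x ≡ p • x ⊕ ⊝ (q • x)
    ⊖-⊛ p q x = cross (begin
      ⁺ (p ⊖ q) • x ⊕ q • x   ≡⟨ •-homo-+ x (⁺ (p ⊖ q)) q ⟨
      (⁺ (p ⊖ q) ℕ.+ q) • x   ≡⟨ ap (λ e → e • x) (parts-⊖ p q) ⟩
      (p ℕ.+ ⁻ (p ⊖ q)) • x   ≡⟨ •-homo-+ x p _ ⟩
      p • x ⊕ ⁻ (p ⊖ q) • x   ∎)
      where open ≡-Reasoning

    ⊛-distribʳ : ∀ x a b → (a ℤ.+ b) ⊛ x ≡ a ⊛ x ⊕ b ⊛ x
    ⊛-distribʳ x a b = begin
      (a ℤ.+ b) ⊛ x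
        ≡⟨ ap (λ e → e ⊛ x) (cong₂ ℤ._+_ (⁺⊖⁻ a) (⁺⊖⁻ b)) ⟨
      ((⁺ a ⊖ ⁻ a) ℤ.+ (⁺ b ⊖ ⁻ b)) ⊛ x
        ≡⟨ ap (λ e → e ⊛ x) (⊖-+-⊖ (⁺ a) (⁻ a) (⁺ b) (⁻ b)) ⟩
      ((⁺ a ℕ.+ ⁺ b) ⊖ (⁻ a ℕ.+ ⁻ b)) ⊛ x
        ≡⟨ ⊖-⊛ (⁺ a ℕ.+ ⁺ b) (⁻ a ℕ.+ ⁻ b) x ⟩
      (⁺ a ℕ.+ ⁺ b) • x ⊕ ⊝ ((⁻ a ℕ.+ ⁻ b) • x)
        ≡⟨ cong₂ (λ e f → e ⊕ ⊝ f) (•-homo-+ x (⁺ a) (⁺ b)) (•-homo-+ x (⁻ a) (⁻ b)) ⟩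
      (⁺ a • x ⊕ ⁺ b • x) ⊕ ⊝ (⁻ a • x ⊕ ⁻ b • x)
        ≡⟨ ap (λ e → (⁺ a • x ⊕ ⁺ b • x) ⊕ e) (⊝-⊕ _ _) ⟨
      (⁺ a • x ⊕ ⁺ b • x) ⊕ (⊝ (⁻ a • x) ⊕ ⊝ (⁻ b • x))
        ≡⟨ ⊕-interchange _ _ _ _ ⟩
      a ⊛ x ⊕ b ⊛ x ∎
      where open ≡-Reasoning

    ⊛-distribˡ : ∀ a x y → a ⊛ (x ⊕ y) ≡ a ⊛ x ⊕ a ⊛ y
    ⊛-distribˡ a x y = begin
      ⁺ a • (x ⊕ y) ⊕ ⊝ (⁻ a • (x ⊕ y))
        ≡⟨ cong₂ (λ e f → e ⊕ ⊝ f) (•-distrib-⊕ x y (⁺ a)) (•-distrib-⊕ x y (⁻ a)) ⟩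
      (⁺ a • x ⊕ ⁺ a • y) ⊕ ⊝ (⁻ a • x ⊕ ⁻ a • y)
        ≡⟨ ap (λ e → (⁺ a • x ⊕ ⁺ a • y) ⊕ e) (⊝-⊕ _ _) ⟨
      (⁺ a • x ⊕ ⁺ a • y) ⊕ (⊝ (⁻ a • x) ⊕ ⊝ (⁻ a • y))
        ≡⟨ ⊕-interchange _ _ _ _ ⟩
      a ⊛ x ⊕ a ⊛ y ∎
      where open ≡-Reasoning

    ⊛-assoc : ∀ a b x → (a ℤ.* b) ⊛ x ≡ a ⊛ b ⊛ x
    ⊛-assoc a b x = begin
      (a ℤ.* b) ⊛ x
        ≡⟨ ap (λ e → e ⊛ x) (cong₂ ℤ._*_ (⁺⊖⁻ a) (⁺⊖⁻ b)) ⟨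
      ((p ⊖ q) ℤ.* (r ⊖ s)) ⊛ x
        ≡⟨ ap (λ e → e ⊛ x) (⊖-*-⊖ p q r s) ⟩
      ((p ℕ.* r ℕ.+ q ℕ.* s) ⊖ (p ℕ.* s ℕ.+ q ℕ.* r)) ⊛ x
        ≡⟨ ⊖-⊛ (p ℕ.* r ℕ.+ q ℕ.* s) (p ℕ.* s ℕ.+ q ℕ.* r) x ⟩
      (p ℕ.* r ℕ.+ q ℕ.* s) • x ⊕ ⊝ ((p ℕ.* s ℕ.+ q ℕ.* r) • x)
        ≡⟨ cong₂ (λ e f → e ⊕ ⊝ f) (split p r q s) (split p s q r) ⟩
      (p • r • x ⊕ q • s • x) ⊕ ⊝ (p • s • x ⊕ q • r • x)
        ≡⟨ ap (λ e → (p • r • x ⊕ q • s • x) ⊕ e) (⊝-⊕ _ _) ⟨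
      (p • r • x ⊕ q • s • x) ⊕ (⊝ (p • s • x) ⊕ ⊝ (q • r • x))
        ≡⟨ ⊕-interchange _ _ _ _ ⟩
      (p • r • x ⊕ ⊝ (p • s • x)) ⊕ (q • s • x ⊕ ⊝ (q • r • x))
        ≡⟨ ap (λ e → (p • r • x ⊕ ⊝ (p • s • x)) ⊕ e) (⊕-comm _ _) ⟩
      (p • r • x ⊕ ⊝ (p • s • x)) ⊕ (⊝ (q • r • x) ⊕ q • s • x)
        ≡⟨ cong₂ _⊕_ (distr p) (trans (ap (λ e → ⊝ (q • r • x) ⊕ e) (sym (⊝-involutive _)))
             (trans (⊝-⊕ _ _) (ap ⊝_ (distr q)))) ⟩
      a ⊛ b ⊛ x ∎
      where
      open ≡-Reasoning
      p q r s : ℕ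
      p = ⁺ a
      q = ⁻ a
      r = ⁺ b
      s = ⁻ b
      split : ∀ p r q s → (p ℕ.* r ℕ.+ q ℕ.* s) • x ≡ p • r • x ⊕ q • s • x
      split p r q s = trans (•-homo-+ x (p ℕ.* r) (q ℕ.* s))
                            (sym (cong₂ _⊕_ (•-assocˡ x p r) (•-assocˡ x q s)))
      distr : ∀ p → p • r • x ⊕ ⊝ (p • s • x) ≡ p • (r • x ⊕ ⊝ (s • x))
      distr p = trans (ap (λ e → p • r • x ⊕ e) (sym (•-⊝ p (s • x)))) (sym (•-distrib-⊕ _ _ p))

    +⊛ : ∀ n x → + n ⊛ x ≡ n • x
    +⊛ n x = trans (ap (λ e → n • x ⊕ e) ⊝-zero) (⊕-identityʳ _)

    0⊛ : ∀ x → + 0 ⊛ x ≡ zeroC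
    0⊛ x = +⊛ 0 x

    1⊛ : ∀ x → + 1 ⊛ x ≡ x
    1⊛ x = trans (+⊛ 1 x) (⊕-identityʳ x)

    -1⊛ : ∀ x → -[1+ 0 ] ⊛ x ≡ ⊝ x
    -1⊛ x = trans (⊕-identityˡ _) (ap ⊝_ (⊕-identityʳ x))

    ⊛-zero : ∀ a → a ⊛ zeroC ≡ zeroC
    ⊛-zero a = trans (cong₂ (λ e f → e ⊕ ⊝ f) (•-zero (⁺ a)) (•-zero (⁻ a))) (⊝-inverseʳ zeroC)

-- Affine forms with integer coefficients and their values in G

-- Affine forms Σᵢ coef i · xᵢ + const · 1.
record Lin (k : ℕ) : Set where
  constructor lin
  field
    coef  : Fin k → ℤ
    const : ℤ

open Lin public

infixl 6 _+ᴸ_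
infixr 7 _*ᴸ_

_+ᴸ_ : ∀ {k} → Lin k → Lin k → Lin k
L +ᴸ M = lin (λ i → coef L i ℤ.+ coef M i) (const L ℤ.+ const M)

_*ᴸ_ : ∀ {k} → ℤ → Lin k → Lin k
a *ᴸ L = lin (λ i → a ℤ.* coef L i) (a ℤ.* const L)

constᴸ : ∀ {k} → ℤ → Lin k
constᴸ a = lin (λ _ → + 0) a

-- −L − 1, which is nonnegative exactly when L is not.
complᴸ : ∀ {k} → Lin k → Lin k
complᴸ L = -[1+ 0 ] *ᴸ L +ᴸ constᴸ -[1+ 0 ]

δ : ∀ {k} → Fin k → Fin k → ℤ
δ zero    zero    = + 1
δ zero    (suc j) = + 0
δ (suc i) zero    = + 0
δ (suc i) (suc j) = δ i j

δ-refl : ∀ {k} (i : Fin k) → δ i i ≡ + 1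
δ-refl zero    = refl
δ-refl (suc i) = δ-refl i

δ-≢ : ∀ {k} {i j : Fin k} → i ≢ j → δ i j ≡ + 0
δ-≢ {i = zero}  {zero}  i≢j = ⊥-elim (i≢j refl)
δ-≢ {i = zero}  {suc j} i≢j = refl
δ-≢ {i = suc i} {zero}  i≢j = refl
δ-≢ {i = suc i} {suc j} i≢j = δ-≢ {i = i} {j} λ { refl → i≢j refl }

varᴸ : ∀ {k} → Fin k → Lin k
varᴸ i = lin (δ i) (+ 0)

tailᴸ : ∀ {k} → Lin (suc k) → Lin k
tailᴸ L = lin (λ i → coef L (suc i)) (const L)

Σᴸ : ∀ {j k} → (Fin j → Lin k) → Lin k
Σᴸ {zero}  f = constᴸ (+ 0)
Σᴸ {suc j} f = f zero +ᴸ Σᴸ (λ i → f (suc i))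

-- N · L at the point e / N: substitution of fractions with common denominator N.
subᴸ : ∀ {j k} → ℤ → (Fin j → Lin k) → Lin j → Lin k
subᴸ N e L = constᴸ (N ℤ.* const L) +ᴸ Σᴸ (λ i → coef L i *ᴸ e i)

data Expr (k : ℕ) : Set where
  v    : Fin k → Expr k
  :0   : Expr k
  :1   : Expr k
  _:+_ : Expr k → Expr k → Expr k
  :-_  : Expr k → Expr k
  _:*_ : ℤ → Expr k → Expr k

infixl 6 _:+_
infix  8 :-_
infixr 7 _:*_

norm : ∀ {k} → Expr k → Lin k
norm (v i)    = varᴸ i
norm :0       = constᴸ (+ 0)
norm :1       = constᴸ (+ 1)
norm (d :+ e) = norm d +ᴸ norm e
norm (:- e)   = -[1+ 0 ] *ᴸ norm e
norm (a :* e) = a *ᴸ norm e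

-- Tabulated because pointwise equal coefficient functions need not be definitionally equal, whereas
-- closed vectors of integers compute to the same normal form.
coefs : ∀ {k} → Lin k → Vec ℤ (suc k)
coefs L = const L ∷ Vec.tabulate (coef L)

v₀ : ∀ {k} → Expr (suc k)
v₀ = v zero
v₁ : ∀ {k} → Expr (suc (suc k))
v₁ = v (suc zero)
v₂ : ∀ {k} → Expr (suc (suc (suc k)))
v₂ = v (suc (suc zero))
v₃ : ∀ {k} → Expr (suc (suc (suc (suc k))))
v₃ = v (suc (suc (suc zero)))

module AffineForms (G : ZGroup) where
  open ZGroupAlgebra G public

  ∑ : ∀ {k} → Vector Carrier k → Carrier
  ∑ = ΣG G

  ∑-cong : ∀ {k} {f g : Vector Carrier k} → (∀ i → f i ≡ g i) → ∑ f ≡ ∑ g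
  ∑-cong {zero}  eq = refl
  ∑-cong {suc k} eq = cong₂ _⊕_ (eq zero) (∑-cong λ i → eq (suc i))

  ∑-⊕ : ∀ {k} (f g : Vector Carrier k) → ∑ (λ i → f i ⊕ g i) ≡ ∑ f ⊕ ∑ g
  ∑-⊕ {zero}  f g = sym (⊕-identityˡ zeroC)
  ∑-⊕ {suc k} f g =
    trans (ap (λ e → (f zero ⊕ g zero) ⊕ e) (∑-⊕ (λ i → f (suc i)) (λ i → g (suc i))))
          (⊕-interchange _ _ _ _)

  ∑-⊛ : ∀ {k} a (f : Vector Carrier k) → ∑ (λ i → a ⊛ f i) ≡ a ⊛ ∑ f
  ∑-⊛ {zero}  a f = sym (⊛-zero a)
  ∑-⊛ {suc k} a f =
    trans (ap (λ e → a ⊛ f zero ⊕ e) (∑-⊛ a (λ i → f (suc i)))) (sym (⊛-distribˡ a _ _))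

  ∑-zero : ∀ k → ∑ {k} (λ _ → zeroC) ≡ zeroC
  ∑-zero zero    = refl
  ∑-zero (suc k) = trans (⊕-identityˡ _) (∑-zero k)

  ∑-update : ∀ {k} (f g : Vector Carrier k) i d → g i ≡ f i ⊕ d →
    (∀ j → i ≢ j → g j ≡ f j) → ∑ g ≡ ∑ f ⊕ d
  ∑-update f g zero d gi gj = begin
    g zero ⊕ ∑ (λ i → g (suc i))        ≡⟨ cong₂ _⊕_ gi (∑-cong λ j → gj (suc j) λ ()) ⟩
    (f zero ⊕ d) ⊕ ∑ (λ i → f (suc i))  ≡⟨ ⊕-assoc _ d _ ⟩
    f zero ⊕ (d ⊕ ∑ (λ i → f (suc i)))  ≡⟨ ap (λ e → f zero ⊕ e) (⊕-comm d _) ⟩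
    f zero ⊕ (∑ (λ i → f (suc i)) ⊕ d)  ≡⟨ ⊕-assoc _ _ d ⟨
    ∑ f ⊕ d                             ∎
    where open ≡-Reasoning
  ∑-update f g (suc i) d gi gj =
    trans (cong₂ _⊕_ (gj zero λ ())
            (∑-update (λ i → f (suc i)) (λ i → g (suc i)) i d gi
              λ j i≢j → gj (suc j) λ { refl → i≢j refl }))
          (sym (⊕-assoc _ _ d))

  eval : ∀ {k} → Lin k → Vector Carrier k → Carrier
  eval L ρ = const L ⊛ oneC ⊕ ∑ (λ i → coef L i ⊛ ρ i)

  eval-coefs : ∀ {k} {L M : Lin k} ρ → const L ≡ const M → (∀ i → coef L i ≡ coef M i) →
    eval L ρ ≡ eval M ρ
  eval-coefs ρ c≡ co≡ =
    cong₂ _⊕_ (ap (λ a → a ⊛ oneC) c≡) (∑-cong λ i → ap (λ a → a ⊛ ρ i) (co≡ i))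

  eval-cong : ∀ {k} (L : Lin k) {ρ ρ′} → (∀ i → ρ i ≡ ρ′ i) → eval L ρ ≡ eval L ρ′
  eval-cong L eq = ap (λ e → const L ⊛ oneC ⊕ e) (∑-cong λ i → ap (λ e → coef L i ⊛ e) (eq i))

  eval-+ : ∀ {k} (L M : Lin k) ρ → eval (L +ᴸ M) ρ ≡ eval L ρ ⊕ eval M ρ
  eval-+ L M ρ = trans
    (cong₂ _⊕_ (⊛-distribʳ oneC (const L) (const M))
      (trans (∑-cong λ i → ⊛-distribʳ (ρ i) (coef L i) (coef M i)) (∑-⊕ (λ i → coef L i ⊛ ρ i) (λ i → coef M i ⊛ ρ i))))
    (⊕-interchange _ _ _ _)

  eval-* : ∀ {k} a (L : Lin k) ρ → eval (a *ᴸ L) ρ ≡ a ⊛ eval L ρ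
  eval-* a L ρ = trans
    (cong₂ _⊕_ (⊛-assoc a (const L) oneC)
      (trans (∑-cong λ i → ⊛-assoc a (coef L i) (ρ i)) (∑-⊛ a (λ i → coef L i ⊛ ρ i))))
    (sym (⊛-distribˡ a _ _))

  eval-const : ∀ {k} a (ρ : Vector Carrier k) → eval (constᴸ a) ρ ≡ a ⊛ oneC
  eval-const {k} a ρ = trans
    (ap (λ e → a ⊛ oneC ⊕ e) (trans (∑-cong λ i → 0⊛ (ρ i)) (∑-zero k)))
    (⊕-identityʳ _)

  eval-var : ∀ {k} (i : Fin k) ρ → eval (varᴸ i) ρ ≡ ρ i
  eval-var {k} i ρ = begin
    + 0 ⊛ oneC ⊕ ∑ (λ j → δ i j ⊛ ρ j)  ≡⟨ cong₂ _⊕_ (0⊛ oneC) sum ⟩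
    zeroC ⊕ ρ i                         ≡⟨ ⊕-identityˡ _ ⟩
    ρ i                                 ∎
    where
    open ≡-Reasoning
    sum : ∑ (λ j → δ i j ⊛ ρ j) ≡ ρ i
    sum = trans
      (∑-update (λ _ → zeroC) (λ j → δ i j ⊛ ρ j) i (ρ i)
        (trans (ap (λ a → a ⊛ ρ i) (δ-refl i)) (trans (1⊛ (ρ i)) (sym (⊕-identityˡ _))))
        (λ j i≢j → trans (ap (λ a → a ⊛ ρ j) (δ-≢ i≢j)) (0⊛ (ρ j))))
      (trans (ap (λ e → e ⊕ ρ i) (∑-zero k)) (⊕-identityˡ _))

  eval-Σ : ∀ {j k} (f : Fin j → Lin k) ρ → eval (Σᴸ f) ρ ≡ ∑ (λ i → eval (f i) ρ)
  eval-Σ {zero}  f ρ = trans (eval-const (+ 0) ρ) (0⊛ oneC)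
  eval-Σ {suc j} f ρ = trans (eval-+ (f zero) (Σᴸ (λ i → f (suc i))) ρ)
    (ap (λ e → eval (f zero) ρ ⊕ e) (eval-Σ (λ i → f (suc i)) ρ))

  eval-tail : ∀ {k} (L : Lin (suc k)) ρ →
    eval L ρ ≡ coef L zero ⊛ ρ zero ⊕ eval (tailᴸ L) (λ i → ρ (suc i))
  eval-tail L ρ = trans (sym (⊕-assoc _ _ _))
    (trans (ap (λ e → e ⊕ eval₀) (⊕-comm _ _)) (⊕-assoc _ _ _))
    where eval₀ = ∑ (λ i → coef L (suc i) ⊛ ρ (suc i))

  eval-update : ∀ {k} (L : Lin k) i d {ρ ρ′} → ρ′ i ≡ ρ i ⊕ d →
    (∀ j → i ≢ j → ρ′ j ≡ ρ j) → eval L ρ′ ≡ eval L ρ ⊕ coef L i ⊛ d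
  eval-update L i d {ρ} {ρ′} at-i off-i = trans
    (ap (λ e → const L ⊛ oneC ⊕ e)
      (∑-update (λ j → coef L j ⊛ ρ j) (λ j → coef L j ⊛ ρ′ j) i (coef L i ⊛ d)
        (trans (ap (λ e → coef L i ⊛ e) at-i) (⊛-distribˡ (coef L i) _ _))
        (λ j i≢j → ap (λ e → coef L j ⊛ e) (off-i j i≢j))))
    (sym (⊕-assoc _ _ _))

  eval-sub : ∀ {j k} N (e : Fin j → Lin k) (L : Lin j) {ρ ρ′} →
    (∀ i → eval (e i) ρ′ ≡ N ⊛ ρ i) → eval (subᴸ N e L) ρ′ ≡ N ⊛ eval L ρ
  eval-sub N e L {ρ} {ρ′} eq = begin
    eval (subᴸ N e L) ρ′
      ≡⟨ eval-+ (constᴸ (N ℤ.* const L)) (Σᴸ (λ i → coef L i *ᴸ e i)) ρ′ ⟩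
    eval (constᴸ (N ℤ.* const L)) ρ′ ⊕ eval (Σᴸ (λ i → coef L i *ᴸ e i)) ρ′
      ≡⟨ cong₂ _⊕_ (trans (eval-const _ ρ′) (⊛-assoc N (const L) oneC))
                   (trans (eval-Σ (λ i → coef L i *ᴸ e i) ρ′) (∑-cong term)) ⟩
    N ⊛ const L ⊛ oneC ⊕ ∑ (λ i → N ⊛ coef L i ⊛ ρ i)
      ≡⟨ ap (λ e → N ⊛ const L ⊛ oneC ⊕ e) (∑-⊛ N (λ i → coef L i ⊛ ρ i)) ⟩
    N ⊛ const L ⊛ oneC ⊕ N ⊛ ∑ (λ i → coef L i ⊛ ρ i)
      ≡⟨ ⊛-distribˡ N _ _ ⟨
    N ⊛ eval L ρ ∎
    where
    open ≡-Reasoning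
    term : ∀ i → eval (coef L i *ᴸ e i) ρ′ ≡ N ⊛ coef L i ⊛ ρ i
    term i = trans (eval-* (coef L i) (e i) ρ′)
      (trans (ap (λ x → coef L i ⊛ x) (eq i))
      (trans (sym (⊛-assoc (coef L i) N (ρ i)))
      (trans (ap (λ a → a ⊛ ρ i) (ℤP.*-comm (coef L i) N)) (⊛-assoc N (coef L i) (ρ i)))))

  ⟦_⟧ : ∀ {k} → Expr k → Vector Carrier k → Carrier
  ⟦ v i ⟧    ρ = ρ i
  ⟦ :0 ⟧     ρ = zeroC
  ⟦ :1 ⟧     ρ = oneC
  ⟦ d :+ e ⟧ ρ = ⟦ d ⟧ ρ ⊕ ⟦ e ⟧ ρ
  ⟦ :- e ⟧   ρ = ⊝ ⟦ e ⟧ ρ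
  ⟦ a :* e ⟧ ρ = a ⊛ ⟦ e ⟧ ρ

  norm-correct : ∀ {k} (e : Expr k) ρ → eval (norm e) ρ ≡ ⟦ e ⟧ ρ
  norm-correct (v i)    ρ = eval-var i ρ
  norm-correct :0       ρ = trans (eval-const (+ 0) ρ) (0⊛ oneC)
  norm-correct :1       ρ = trans (eval-const (+ 1) ρ) (1⊛ oneC)
  norm-correct (d :+ e) ρ =
    trans (eval-+ (norm d) (norm e) ρ) (cong₂ _⊕_ (norm-correct d ρ) (norm-correct e ρ))
  norm-correct (:- e)   ρ =
    trans (eval-* -[1+ 0 ] (norm e) ρ) (trans (-1⊛ _) (ap ⊝_ (norm-correct e ρ)))
  norm-correct (a :* e) ρ =
    trans (eval-* a (norm e) ρ) (ap (λ x → a ⊛ x) (norm-correct e ρ))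

  -- Identities of abelian groups by reflection: both sides are affine forms, so comparing
  -- coefficients suffices, and for closed scalars the premise is `refl`. A multiple by an open
  -- integer has to enter as one of the atoms `xs`.
  linear : ∀ {k} (xs : Vec Carrier k) (d e : Expr k) → coefs (norm d) ≡ coefs (norm e) →
    ⟦ d ⟧ (Vec.lookup xs) ≡ ⟦ e ⟧ (Vec.lookup xs)
  linear xs d e eq = begin
    ⟦ d ⟧ ρ           ≡⟨ norm-correct d ρ ⟨
    eval (norm d) ρ   ≡⟨ eval-coefs ρ (ap Vec.head eq) same ⟩
    eval (norm e) ρ   ≡⟨ norm-correct e ρ ⟩
    ⟦ e ⟧ ρ           ∎
    where
    open ≡-Reasoning
    ρ = Vec.lookup xs
    same : ∀ i → coef (norm d) i ≡ coef (norm e) i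
    same i = trans (sym (VecP.lookup∘tabulate (coef (norm d)) i))
      (trans (ap (λ w → Vec.lookup (Vec.tail w) i) eq) (VecP.lookup∘tabulate (coef (norm e)) i))

  ⊛-⊝ : ∀ a x → a ⊛ ⊝ x ≡ ⊝ (a ⊛ x)
  ⊛-⊝ a x = ⊝-unique (trans (sym (⊛-distribˡ a (⊝ x) x))
    (trans (ap (λ e → a ⊛ e) (⊝-inverseˡ x)) (⊛-zero a)))

  ⊛-minus : ∀ a b x → (a ℤ.- b) ⊛ x ≡ a ⊛ x ⊕ ⊝ (b ⊛ x)
  ⊛-minus a b x = trans (⊛-distribʳ x a (ℤ.- b)) (ap (λ e → a ⊛ x ⊕ e) (begin
    (ℤ.- b) ⊛ x            ≡⟨ ap (λ e → e ⊛ x) (ℤP.-1*i≡-i b) ⟨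
    (-[1+ 0 ] ℤ.* b) ⊛ x   ≡⟨ ⊛-assoc -[1+ 0 ] b x ⟩
    -[1+ 0 ] ⊛ b ⊛ x       ≡⟨ -1⊛ _ ⟩
    ⊝ (b ⊛ x)              ∎))
    where open ≡-Reasoning

  eval-compl : ∀ {k} (L : Lin k) ρ → eval (complᴸ L) ρ ≡ ⊝ eval L ρ ⊕ ⊝ oneC
  eval-compl L ρ = trans (eval-+ (-[1+ 0 ] *ᴸ L) (constᴸ -[1+ 0 ]) ρ)
    (cong₂ _⊕_ (trans (eval-* -[1+ 0 ] L ρ) (-1⊛ _)) (trans (eval-const -[1+ 0 ] ρ) (-1⊛ oneC)))

  -- Decidability of the order and of divisibility in G

  Pos : Carrier → Set
  Pos x = zeroC ≼ x

  -- By discreteness x < 0 is the weak inequality -x - 1 ≥ 0, so the complement of a sign condition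
  -- is again a sign condition; `complᴸ` is its counterpart for forms.
  Neg : Carrier → Set
  Neg x = Pos (⊝ x ⊕ ⊝ oneC)

  Pos-≡ : ∀ {x y} → x ≡ y → Pos x → Pos y
  Pos-≡ = subst Pos

  Pos-⊕ : ∀ {x y} → Pos x → Pos y → Pos (x ⊕ y)
  Pos-⊕ = 0≼-⊕ _ _

  Pos-• : ∀ n {x} → Pos x → Pos (n • x)
  Pos-• zero    p = 0≼0
  Pos-• (suc n) p = Pos-⊕ p (Pos-• n p)

  Pos-⊛ : ∀ n {x} → Pos x → Pos (+ n ⊛ x)
  Pos-⊛ n p = Pos-≡ (sym (+⊛ n _)) (Pos-• n p)

  ≼⇒Pos : ∀ {x y} → x ≼ y → Pos (y ⊕ ⊝ x)
  ≼⇒Pos {x} {y} x≼y = subst (λ e → e ≼ (y ⊕ ⊝ x)) (⊝-inverseʳ x) (≼-⊕ x y x≼y (⊝ x))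

  Pos⇒≼ : ∀ {x y} → Pos (y ⊕ ⊝ x) → x ≼ y
  Pos⇒≼ {x} {y} p = subst (λ e → e ≼ y) (⊕-identityˡ x)
    (subst (λ e → (zeroC ⊕ x) ≼ e)
      (linear (x ∷ y ∷ []) ((v₁ :+ :- v₀) :+ v₀) v₁ refl) (≼-⊕ _ _ p x))

  ¬Pos-1 : ¬ Pos (⊝ oneC)
  ¬Pos-1 p = 1⋠0 (Pos⇒≼ (Pos-≡ (sym (⊕-identityˡ _)) p))

  -1<0 : Neg (⊝ oneC)
  -1<0 = Pos-≡ (sym (trans (ap (λ e → e ⊕ ⊝ oneC) (⊝-involutive oneC)) (⊝-inverseʳ oneC))) 0≼0

  Pos-Neg : ∀ {x} → Pos x → Neg x → ⊥
  Pos-Neg {x} p n = ¬Pos-1 (Pos-≡ (linear (x ∷ []) (v₀ :+ (:- v₀ :+ :- :1)) (:- :1) refl) (Pos-⊕ p n))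

  pos⊎neg : ∀ x → Pos x ⊎ Neg x
  pos⊎neg x with ≼-discrete x
  ... | inj₁ p = inj₁ p
  ... | inj₂ n = inj₂ (Pos-≡ (linear (x ∷ []) (:0 :+ :- (v₀ :+ :1)) (:- v₀ :+ :- :1) refl) (≼⇒Pos n))

  Pos-antisym : ∀ {x} → Pos x → Pos (⊝ x) → x ≡ zeroC
  Pos-antisym {x} p q = ≼-antisym x p (Pos⇒≼ (Pos-≡ (sym (⊕-identityˡ _)) q))

  -- If x ≤ -1, then -1 = (n + 1)x + (n + 1)(-x - 1) + n would be a sum of nonnegative elements.
  Pos-cancel : ∀ n {x} → Pos (+ suc n ⊛ x) → Pos x
  Pos-cancel n {x} p with pos⊎neg x
  ... | inj₁ q = q
  ... | inj₂ q = ⊥-elim (¬Pos-1 (Pos-≡ eq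
                   (Pos-⊕ p (Pos-⊕ (Pos-⊛ (suc n) q) (Pos-⊛ n 0≼1)))))
    where
    open ≡-Reasoning
    eq : + suc n ⊛ x ⊕ (+ suc n ⊛ (⊝ x ⊕ ⊝ oneC) ⊕ + n ⊛ oneC) ≡ ⊝ oneC
    eq = begin
      + suc n ⊛ x ⊕ (+ suc n ⊛ (⊝ x ⊕ ⊝ oneC) ⊕ + n ⊛ oneC)
        ≡⟨ ⊕-assoc _ _ _ ⟨
      (+ suc n ⊛ x ⊕ + suc n ⊛ (⊝ x ⊕ ⊝ oneC)) ⊕ + n ⊛ oneC
        ≡⟨ cong₂ _⊕_ (sym (⊛-distribˡ (+ suc n) _ _)) refl ⟩
      + suc n ⊛ (x ⊕ (⊝ x ⊕ ⊝ oneC)) ⊕ + n ⊛ oneC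
        ≡⟨ ap (λ e → + suc n ⊛ e ⊕ + n ⊛ oneC)
             (linear (x ∷ []) (v₀ :+ (:- v₀ :+ :- :1)) (-[1+ 0 ] :* :1) refl) ⟩
      + suc n ⊛ -[1+ 0 ] ⊛ oneC ⊕ + n ⊛ oneC
        ≡⟨ ap (λ e → e ⊕ + n ⊛ oneC) (⊛-assoc (+ suc n) -[1+ 0 ] oneC) ⟨
      (+ suc n ℤ.* -[1+ 0 ]) ⊛ oneC ⊕ + n ⊛ oneC
        ≡⟨ ⊛-distribʳ oneC (+ suc n ℤ.* -[1+ 0 ]) (+ n) ⟨
      (+ suc n ℤ.* -[1+ 0 ] ℤ.+ + n) ⊛ oneC
        ≡⟨ ap (λ a → a ⊛ oneC) (minus (+ n)) ⟩
      -[1+ 0 ] ⊛ oneC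
        ≡⟨ -1⊛ oneC ⟩
      ⊝ oneC ∎
      where
      minus : ∀ a → (+ 1 ℤ.+ a) ℤ.* -[1+ 0 ] ℤ.+ a ≡ -[1+ 0 ]
      minus = solve-∀

  -- Torsion-freeness comes from the order: `Pos-cancel` applies to x - y and to y - x.
  ⊛-injective : ∀ n {x y} → + suc n ⊛ x ≡ + suc n ⊛ y → x ≡ y
  ⊛-injective n {x} {y} eq = begin
    x                 ≡⟨ linear (x ∷ y ∷ []) v₀ ((v₀ :+ :- v₁) :+ v₁) refl ⟩
    (x ⊕ ⊝ y) ⊕ y     ≡⟨ ap (λ e → e ⊕ y) (Pos-antisym (half eq)
                           (Pos-≡ (linear (x ∷ y ∷ []) (v₁ :+ :- v₀) (:- (v₀ :+ :- v₁)) refl)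
                             (half (sym eq)))) ⟩
    zeroC ⊕ y         ≡⟨ ⊕-identityˡ y ⟩
    y                 ∎
    where
    open ≡-Reasoning
    half : ∀ {x y} → + suc n ⊛ x ≡ + suc n ⊛ y → Pos (x ⊕ ⊝ y)
    half {x} {y} eq = Pos-cancel n (Pos-≡ zero≡ 0≼0)
      where
      zero≡ : zeroC ≡ + suc n ⊛ (x ⊕ ⊝ y)
      zero≡ = sym (trans (⊛-distribˡ (+ suc n) x (⊝ y)) (trans (ap (λ e → e ⊕ + suc n ⊛ ⊝ y) eq)
        (trans (sym (⊛-distribˡ (+ suc n) y (⊝ y)))
        (trans (ap (λ e → + suc n ⊛ e) (⊝-inverseʳ y)) (⊛-zero (+ suc n))))))

  abstract
    posB : Carrier → Bool
    posB x with pos⊎neg x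
    ... | inj₁ _ = true
    ... | inj₂ _ = false

    posB-true : ∀ {x} → Pos x → posB x ≡ true
    posB-true {x} p with pos⊎neg x
    ... | inj₁ _ = refl
    ... | inj₂ n = ⊥-elim (Pos-Neg p n)

    posB-false : ∀ {x} → Neg x → posB x ≡ false
    posB-false {x} n with pos⊎neg x
    ... | inj₁ p = ⊥-elim (Pos-Neg p n)
    ... | inj₂ _ = refl

    posB⇒Pos : ∀ {x} → posB x ≡ true → Pos x
    posB⇒Pos {x} eq with pos⊎neg x
    ... | inj₁ p = p

    posB⇒Neg : ∀ {x} → posB x ≡ false → Neg x
    posB⇒Neg {x} eq with pos⊎neg x
    ... | inj₂ n = n

  posB-⊛ : ∀ n x → posB (+ suc n ⊛ x) ≡ posB x
  posB-⊛ n x with posB x in eq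
  ... | true  = posB-true (Pos-⊛ (suc n) (posB⇒Pos eq))
  ... | false with posB (+ suc n ⊛ x) in eq′
  ...   | true  = ⊥-elim (Pos-Neg (Pos-cancel n (posB⇒Pos eq′)) (posB⇒Neg eq))
  ...   | false = refl

  posB-compl : ∀ x → posB (⊝ x ⊕ ⊝ oneC) ≡ not (posB x)
  posB-compl x with posB x in eq
  ... | true  = posB-false (Pos-≡ (linear (x ∷ []) v₀ (:- (:- v₀ :+ :- :1) :+ :- :1) refl) (posB⇒Pos eq))
  ... | false = posB-true (posB⇒Neg eq)

  -- For q ≤ -1 the identity -(c + (n + 1)q) - 1 = (n + 1)(-q - 1) + (n - c) exhibits a sum of
  -- nonnegative terms; this is where c ≤ n enters.
  posB-quotient : ∀ n c q → c ℕ.≤ n → posB (+ c ⊛ oneC ⊕ + suc n ⊛ q) ≡ posB q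
  posB-quotient n c q c≤n with pos⊎neg q
  ... | inj₁ p = trans (posB-true (Pos-⊕ (Pos-⊛ c 0≼1) (Pos-⊛ (suc n) p))) (sym (posB-true p))
  ... | inj₂ p = trans (posB-false (Pos-≡ eq (Pos-⊕ (Pos-⊛ (suc n) p) (Pos-⊛ (n ℕ.∸ c) 0≼1))))
                       (sym (posB-false p))
    where
    open ≡-Reasoning
    scaled : + suc n ⊛ (⊝ q ⊕ ⊝ oneC) ≡ ⊝ (+ suc n ⊛ q) ⊕ ⊝ (oneC ⊕ + n ⊛ oneC)
    scaled = trans (⊛-distribˡ (+ suc n) _ _) (cong₂ _⊕_ (⊛-⊝ (+ suc n) q)
      (trans (⊛-⊝ (+ suc n) oneC) (ap ⊝_ (trans (⊛-distribʳ oneC (+ 1) (+ n))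
        (ap (λ e → e ⊕ + n ⊛ oneC) (1⊛ oneC))))))
    gap : + (n ℕ.∸ c) ⊛ oneC ≡ + n ⊛ oneC ⊕ ⊝ (+ c ⊛ oneC)
    gap = trans (ap (λ a → a ⊛ oneC) (sym (trans (ℤP.m-n≡m⊖n n c) (ℤP.⊖-≥ c≤n))))
      (⊛-minus (+ n) (+ c) oneC)
    eq : + suc n ⊛ (⊝ q ⊕ ⊝ oneC) ⊕ + (n ℕ.∸ c) ⊛ oneC ≡ ⊝ (+ c ⊛ oneC ⊕ + suc n ⊛ q) ⊕ ⊝ oneC
    eq = trans (cong₂ _⊕_ scaled gap)
      (linear (+ suc n ⊛ q ∷ + n ⊛ oneC ∷ + c ⊛ oneC ∷ [])
        ((:- v₀ :+ :- (:1 :+ v₁)) :+ (v₁ :+ :- v₂)) (:- (v₂ :+ v₀) :+ :- :1) refl)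

  -- Induction on the standard bound: by discreteness x is at most n or equal to n + 1. Hence
  -- remainders are integers, and residue classes can be enumerated.
  numeral : ∀ n x → Pos x → Pos (+ n ⊛ oneC ⊕ ⊝ x) → Σ ℕ λ c → c ℕ.≤ n × x ≡ + c ⊛ oneC
  numeral zero x p q = 0 , z≤n , trans (Pos-antisym p
    (Pos-≡ (linear (x ∷ []) (+ 0 :* :1 :+ :- v₀) (:- v₀) refl) q)) (sym (0⊛ oneC))
  numeral (suc n) x p q with pos⊎neg (+ n ⊛ oneC ⊕ ⊝ x)
  ... | inj₁ q′ with numeral n x p q′
  ...   | c , c≤n , eq = c , ℕP.m≤n⇒m≤1+n c≤n , eq
  numeral (suc n) x p q | inj₂ x>n = suc n , ℕP.≤-refl , sym (begin
    + suc n ⊛ oneC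
      ≡⟨ linear (+ suc n ⊛ oneC ∷ x ∷ []) v₀ ((v₀ :+ :- v₁) :+ v₁) refl ⟩
    (+ suc n ⊛ oneC ⊕ ⊝ x) ⊕ x      ≡⟨ ap (λ e → e ⊕ x) (Pos-antisym q (Pos-≡ eq x>n)) ⟩
    zeroC ⊕ x                       ≡⟨ ⊕-identityˡ x ⟩
    x                               ∎)
    where
    open ≡-Reasoning
    eq : ⊝ (+ n ⊛ oneC ⊕ ⊝ x) ⊕ ⊝ oneC ≡ ⊝ (+ suc n ⊛ oneC ⊕ ⊝ x)
    eq = trans
      (linear (+ n ⊛ oneC ∷ x ∷ []) (:- (v₀ :+ :- v₁) :+ :- :1) (:- ((:1 :+ v₀) :+ :- v₁)) refl)
      (ap (λ e → ⊝ (e ⊕ ⊝ x)) (trans (ap (λ e → e ⊕ + n ⊛ oneC) (sym (1⊛ oneC)))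
        (sym (⊛-distribʳ oneC (+ 1) (+ n)))))

  Dvd : ℕ → Carrier → Set
  Dvd n x = Σ Carrier λ z → x ≡ + suc n ⊛ z

  remainder : ∀ n x → Σ Carrier λ q → Σ ℕ λ c → c ℕ.≤ n × x ≡ + c ⊛ oneC ⊕ + suc n ⊛ q
  remainder n x with divide n x
  ... | q , r , 0≼r , r≼n , eq
      with numeral n r 0≼r (Pos-≡ (ap (λ e → e ⊕ ⊝ r) (sym (+⊛ n oneC))) (≼⇒Pos r≼n))
  ...   | c , c≤n , r≡c = q , c , c≤n , trans eq (cong₂ _⊕_ r≡c (sym (+⊛ (suc n) q)))

  -- A quotient z satisfies z ≥ 0 by `Pos-cancel` and, since 0 = (c + 1) + (n + 1)(-z), also -z ≥ 0
  -- by `posB-quotient`; then c + 1 = 0, so -1 = c ≥ 0.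
  ¬Dvd-small : ∀ n c → suc c ℕ.≤ n → ¬ Dvd n (+ suc c ⊛ oneC)
  ¬Dvd-small n c c<n (z , eq) = ¬Pos-1 (Pos-≡ -1≡ (Pos-⊛ c 0≼1))
    where
    open ≡-Reasoning
    z≥0 : Pos z
    z≥0 = Pos-cancel n (Pos-≡ eq (Pos-⊛ (suc c) 0≼1))
    z≤0 : Pos (⊝ z)
    z≤0 = posB⇒Pos (trans (sym (posB-quotient n (suc c) (⊝ z) c<n)) (posB-true (Pos-≡ (begin
      zeroC                                  ≡⟨ ⊝-inverseʳ _ ⟨
      + suc n ⊛ z ⊕ ⊝ (+ suc n ⊛ z)          ≡⟨ cong₂ _⊕_ eq (⊛-⊝ (+ suc n) z) ⟨
      + suc c ⊛ oneC ⊕ + suc n ⊛ ⊝ z         ∎) 0≼0)))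
    -1≡ : + c ⊛ oneC ≡ ⊝ oneC
    -1≡ = begin
      + c ⊛ oneC
        ≡⟨ linear (+ c ⊛ oneC ∷ []) v₀ ((:1 :+ v₀) :+ :- :1) refl ⟩
      (oneC ⊕ + c ⊛ oneC) ⊕ ⊝ oneC
        ≡⟨ ap (λ e → (e ⊕ + c ⊛ oneC) ⊕ ⊝ oneC) (1⊛ oneC) ⟨
      (+ 1 ⊛ oneC ⊕ + c ⊛ oneC) ⊕ ⊝ oneC
        ≡⟨ ap (λ e → e ⊕ ⊝ oneC) (⊛-distribʳ oneC (+ 1) (+ c)) ⟨
      + suc c ⊛ oneC ⊕ ⊝ oneC
        ≡⟨ ap (λ e → e ⊕ ⊝ oneC) (trans eq (trans (ap (λ e → + suc n ⊛ e) (Pos-antisym z≥0 z≤0)) (⊛-zero (+ suc n)))) ⟩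
      zeroC ⊕ ⊝ oneC
        ≡⟨ ⊕-identityˡ _ ⟩
      ⊝ oneC ∎

  Dvd-⊕ : ∀ {n x y} → Dvd n x → Dvd n y → Dvd n (x ⊕ y)
  Dvd-⊕ {n} (z , p) (w , q) = z ⊕ w , trans (cong₂ _⊕_ p q) (sym (⊛-distribˡ (+ suc n) z w))

  Dvd-⊛ : ∀ {n x} a → Dvd n x → Dvd n (a ⊛ x)
  Dvd-⊛ {n} {x} a (z , p) = a ⊛ z , trans (ap (λ e → a ⊛ e) p)
    (trans (sym (⊛-assoc a (+ suc n) z))
    (trans (ap (λ b → b ⊛ z) (ℤP.*-comm a (+ suc n))) (⊛-assoc (+ suc n) a z)))

  Dvd? : ∀ n x → Dvd n x ⊎ (¬ Dvd n x)
  Dvd? n x with remainder n x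
  ... | q , zero , _ , eq = inj₁ (q , trans eq (trans (ap (λ e → e ⊕ + suc n ⊛ q) (0⊛ oneC)) (⊕-identityˡ _)))
  ... | q , suc c , c<n , eq = inj₂ λ d → ¬Dvd-small n c c<n
    (subst (Dvd n) (begin
      x ⊕ -[1+ 0 ] ⊛ + suc n ⊛ q
        ≡⟨ ap (λ e → e ⊕ _) eq ⟩
      (+ suc c ⊛ oneC ⊕ + suc n ⊛ q) ⊕ -[1+ 0 ] ⊛ + suc n ⊛ q
        ≡⟨ linear (+ suc c ⊛ oneC ∷ + suc n ⊛ q ∷ []) ((v₀ :+ v₁) :+ -[1+ 0 ] :* v₁) v₀ refl ⟩
      + suc c ⊛ oneC ∎)
      (Dvd-⊕ d (Dvd-⊛ -[1+ 0 ] (q , refl))))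
    where open ≡-Reasoning

  abstract
    dvdB : ℕ → Carrier → Bool
    dvdB n x with Dvd? n x
    ... | inj₁ _ = true
    ... | inj₂ _ = false

    dvdB-true : ∀ {n x} → Dvd n x → dvdB n x ≡ true
    dvdB-true {n} {x} d with Dvd? n x
    ... | inj₁ _ = refl
    ... | inj₂ ¬d = ⊥-elim (¬d d)

    dvdB⇒Dvd : ∀ {n x} → dvdB n x ≡ true → Dvd n x
    dvdB⇒Dvd {n} {x} eq with Dvd? n x
    ... | inj₁ d = d

    dvdB-cong : ∀ {n m x y} → (Dvd n x → Dvd m y) → (Dvd m y → Dvd n x) → dvdB n x ≡ dvdB m y
    dvdB-cong {n} {m} {x} {y} to from with Dvd? n x | Dvd? m y
    ... | inj₁ _  | inj₁ _  = refl
    ... | inj₁ d  | inj₂ ¬d = ⊥-elim (¬d (to d))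
    ... | inj₂ ¬d | inj₁ d  = ⊥-elim (¬d (from d))
    ... | inj₂ _  | inj₂ _  = refl

-- Quantifier-free formulas and quantifier elimination

contradictory : ∀ {A : Set} {b : Bool} → b ≡ true → b ≡ false → A
contradictory refl ()

-- The modulus of  dvd n  is suc n, as in Defs.
data QF (k : ℕ) : Set where
  ge   : Lin k → QF k
  dvd  : ℕ → Lin k → QF k
  nand : QF k → QF k → QF k

infixr 6 _∧ᶠ_

¬ᶠ_ : ∀ {k} → QF k → QF k
¬ᶠ φ = nand φ φ

_∧ᶠ_ _∨ᶠ_ : ∀ {k} → QF k → QF k → QF k
φ ∧ᶠ ψ = ¬ᶠ (nand φ ψ)
φ ∨ᶠ ψ = nand (¬ᶠ φ) (¬ᶠ ψ)

⊥ᶠ ⊤ᶠ : ∀ {k} → QF k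
⊥ᶠ = ge (constᴸ -[1+ 0 ])
⊤ᶠ = ¬ᶠ ⊥ᶠ

⋁ᶠ : ∀ {A : Set} {k} → List A → (A → QF k) → QF k
⋁ᶠ []       f = ⊥ᶠ
⋁ᶠ (x ∷ xs) f = f x ∨ᶠ ⋁ᶠ xs f

⋀ᶠ : ∀ {j k} → (Fin j → QF k) → QF k
⋀ᶠ {zero}  f = ⊤ᶠ
⋀ᶠ {suc j} f = f zero ∧ᶠ ⋀ᶠ (λ i → f (suc i))

-- suc (times m n) is the product of suc m and suc n.
times : ℕ → ℕ → ℕ
times m n = n ℕ.+ m ℕ.* suc n

-- Clearing the denominator suc N keeps the sign of an inequality, but it multiplies both sides of a
-- divisibility; hence the modulus `times N m`.
subᶠ : ∀ {j k} → ℕ → (Fin j → Lin k) → QF j → QF k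
subᶠ N e (ge L)     = ge (subᴸ (+ suc N) e L)
subᶠ N e (dvd m L)  = dvd (times N m) (subᴸ (+ suc N) e L)
subᶠ N e (nand φ ψ) = nand (subᶠ N e φ) (subᶠ N e ψ)

modulus : ∀ {k} → QF k → ℕ
modulus (ge L)     = 0
modulus (dvd m L)  = m
modulus (nand φ ψ) = times (modulus φ) (modulus ψ)

_∣⁺_ : ℕ → ℕ → Set
m ∣⁺ N = Σ ℕ λ q → suc N ≡ q ℕ.* suc m

ModuliDivide : ∀ {k} → QF k → ℕ → Set
ModuliDivide (ge L)     N = ⊤
ModuliDivide (dvd m L)  N = m ∣⁺ N
ModuliDivide (nand φ ψ) N = ModuliDivide φ N × ModuliDivide ψ N

∣⁺-trans : ∀ {l m n} → l ∣⁺ m → m ∣⁺ n → l ∣⁺ n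
∣⁺-trans {l} {m} {n} (q , p) (r , s) =
  r ℕ.* q , trans s (trans (ap (λ e → r ℕ.* e) p) (sym (ℕP.*-assoc r q (suc l))))

moduliDivide-mono : ∀ {k} (φ : QF k) {M N} → M ∣⁺ N → ModuliDivide φ M → ModuliDivide φ N
moduliDivide-mono (ge L)     d p       = tt
moduliDivide-mono (dvd m L)  d p       = ∣⁺-trans {m} p d
moduliDivide-mono (nand φ ψ) d (p , q) = moduliDivide-mono φ d p , moduliDivide-mono ψ d q

modulus-divides : ∀ {k} (φ : QF k) → ModuliDivide φ (modulus φ)
modulus-divides (ge L)     = tt
modulus-divides (dvd m L)  = 1 , sym (ℕP.*-identityˡ (suc m))
modulus-divides (nand φ ψ) =
  moduliDivide-mono φ (suc (modulus ψ) , ℕP.*-comm (suc (modulus φ)) (suc (modulus ψ))) (modulus-divides φ) ,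
  moduliDivide-mono ψ (suc (modulus φ) , refl) (modulus-divides ψ)

-- The breakpoint (a , s) stands for the condition (a + 1) t + s ≥ 0 on t.
Breakpoint : ℕ → Set
Breakpoint k = ℕ × Lin k

-- A negative coefficient is treated through the complementary inequality, so that every breakpoint
-- switches from false to true as t grows.
breakpoint : ∀ {k} → ℤ → Lin k → List (Breakpoint k)
breakpoint (+ zero)  s = []
breakpoint (+ suc a) s = (a , s) ∷ []
breakpoint -[1+ a ]  s = (a , complᴸ s) ∷ []

breakpoints : ∀ {k} → QF (suc k) → List (Breakpoint k)
breakpoints (ge L)     = breakpoint (coef L zero) (tailᴸ L)
breakpoints (dvd m L)  = []
breakpoints (nand φ ψ) = breakpoints φ ++ breakpoints ψ

-- The values 0, ..., n are reached from above and -n - 1, ..., -1 from below: the breakpoint must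
-- not be crossed, so one full period on either side is required.
candidates : ℕ → List ℤ
candidates n = map +_ (upTo (suc n)) ++ map (λ c → + c ℤ.- + suc n) (upTo (suc n))

+-candidate : ∀ {c n} → c ℕ.≤ n → + c ∈ candidates n
+-candidate c≤n = ∈P.∈-++⁺ˡ (∈P.∈-map⁺ +_ (∈P.∈-upTo⁺ (s≤s c≤n)))

−-candidate : ∀ {c n} → c ℕ.≤ n → + c ℤ.- + suc n ∈ candidates n
−-candidate {c} {n} c≤n = ∈P.∈-++⁺ʳ (map +_ (upTo (suc n)))
  (∈P.∈-map⁺ (λ c → + c ℤ.- + suc n) (∈P.∈-upTo⁺ (s≤s c≤n)))

-- (a + 1) t for the point t at which the breakpoint takes the value j.
numerator : ∀ {k} → Breakpoint k → ℤ → Lin k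
numerator (a , s) j = constᴸ j +ᴸ -[1+ 0 ] *ᴸ s

numerators : ∀ {k} → Breakpoint k → ℤ → Fin (suc k) → Lin k
numerators b       j zero    = numerator b j
numerators (a , s) j (suc i) = + suc a *ᴸ varᴸ i

-- The quotient (j - s)/(a + 1) lies in `G` only under a divisibility, which is therefore made part
-- of the condition.
holdsWhere : ∀ {k} → QF (suc k) → Breakpoint k → ℤ → QF k
holdsWhere φ b j = dvd (proj₁ b) (numerator b j) ∧ᶠ subᶠ (proj₁ b) (numerators b j) φ

-- The breakpoint t ≥ 0 is added so that there is always one.
allBreakpoints : ∀ {k} → QF (suc k) → List (Breakpoint k)
allBreakpoints φ = (0 , constᴸ (+ 0)) ∷ breakpoints φ

eliminate : ∀ {k} → QF (suc k) → QF k
eliminate φ = ⋁ᶠ (allBreakpoints φ) λ b →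
  -- Moving t by one period of the moduli changes the value at b by a + 1 times that period; the
  -- product is the length of the range of values to be tested.
  ⋁ᶠ (candidates (times (proj₁ b) (modulus φ))) (holdsWhere φ b)

termᴸ : ∀ {k} → Term k → Lin k
termᴸ (var i)  = varᴸ i
termᴸ `0       = constᴸ (+ 0)
termᴸ `1       = constᴸ (+ 1)
termᴸ (t `+ s) = termᴸ t +ᴸ termᴸ s

diffᴸ : ∀ {k} → Term k → Term k → Lin k
diffᴸ t s = termᴸ t +ᴸ -[1+ 0 ] *ᴸ termᴸ s

-- Implication and universal quantification are rendered by classical equivalences; this is
-- compatible with the constructive `Sat` because quantifier-free formulas have Boolean values.
qe : ∀ {k} → Formula k → QF k
qe (t `≈ s)     = ge (diffᴸ t s) ∧ᶠ ge (diffᴸ s t)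
qe (t `≤ s)     = ge (diffᴸ s t)
qe (cong n t s) = dvd n (diffᴸ t s)
qe `⊥           = ⊥ᶠ
qe (φ `∧ ψ)     = qe φ ∧ᶠ qe ψ
qe (φ `∨ ψ)     = qe φ ∨ᶠ qe ψ
qe (φ `⇒ ψ)     = nand (qe φ) (¬ᶠ qe ψ)
qe (`∀ φ)       = ¬ᶠ eliminate (¬ᶠ qe φ)
qe (`∃ φ)       = eliminate (qe φ)

∑ᵀ : ∀ {j k} → (Fin j → Term k) → Term k
∑ᵀ {zero}  f = `0
∑ᵀ {suc j} f = f zero `+ ∑ᵀ (λ i → f (suc i))

module QuantifierElimination (G : ZGroup) where
  open AffineForms G public

  evalB : ∀ {k} → QF k → Vector Carrier k → Bool
  evalB (ge L)     ρ = posB (eval L ρ)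
  evalB (dvd n L)  ρ = dvdB n (eval L ρ)
  evalB (nand φ ψ) ρ = not (evalB φ ρ ∧ evalB ψ ρ)

  Holds : ∀ {k} → QF k → Vector Carrier k → Set
  Holds φ ρ = evalB φ ρ ≡ true

  evalB-cong : ∀ {k} (φ : QF k) {ρ ρ′} → (∀ i → ρ i ≡ ρ′ i) → evalB φ ρ ≡ evalB φ ρ′
  evalB-cong (ge L)     eq = ap posB (eval-cong L eq)
  evalB-cong (dvd n L)  eq = ap (dvdB n) (eval-cong L eq)
  evalB-cong (nand φ ψ) eq = cong₂ (λ a b → not (a ∧ b)) (evalB-cong φ eq) (evalB-cong ψ eq)

  evalB-¬ : ∀ {k} (φ : QF k) ρ → evalB (¬ᶠ φ) ρ ≡ not (evalB φ ρ)
  evalB-¬ φ ρ = ap not (BoolP.∧-idem (evalB φ ρ))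

  Holds-¬⁺ : ∀ {k} (φ : QF k) {ρ} → evalB φ ρ ≡ false → Holds (¬ᶠ φ) ρ
  Holds-¬⁺ φ {ρ} eq = trans (evalB-¬ φ ρ) (ap not eq)

  Holds-¬⁻ : ∀ {k} (φ : QF k) {ρ} → Holds (¬ᶠ φ) ρ → evalB φ ρ ≡ false
  Holds-¬⁻ φ {ρ} h = BoolP.not-injective (trans (sym (evalB-¬ φ ρ)) h)

  refute : ∀ {k} (φ : QF k) {ρ} → ¬ Holds φ ρ → evalB φ ρ ≡ false
  refute φ {ρ} n with evalB φ ρ
  ... | true  = ⊥-elim (n refl)
  ... | false = refl

  confirm : ∀ {k} (φ : QF k) {ρ} → ¬ (evalB φ ρ ≡ false) → Holds φ ρ
  confirm φ {ρ} n with evalB φ ρ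
  ... | true  = refl
  ... | false = ⊥-elim (n refl)

  Holds-⇒⁺ : ∀ {k} (φ ψ : QF k) {ρ} → (Holds φ ρ → Holds ψ ρ) → Holds (nand φ (¬ᶠ ψ)) ρ
  Holds-⇒⁺ φ ψ {ρ} f with evalB φ ρ | evalB ψ ρ
  ... | false | _    = refl
  ... | true  | true = refl
  ... | true  | false with f refl
  ...   | ()

  Holds-⇒⁻ : ∀ {k} (φ ψ : QF k) {ρ} → Holds (nand φ (¬ᶠ ψ)) ρ → Holds φ ρ → Holds ψ ρ
  Holds-⇒⁻ φ ψ {ρ} h p with evalB φ ρ | evalB ψ ρ
  ... | true | true = refl

  Holds-∧⁺ : ∀ {k} (φ ψ : QF k) {ρ} → Holds φ ρ → Holds ψ ρ → Holds (φ ∧ᶠ ψ) ρ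
  Holds-∧⁺ φ ψ {ρ} p q with evalB φ ρ | evalB ψ ρ
  Holds-∧⁺ φ ψ {ρ} p q | true | true = refl

  Holds-∧⁻ : ∀ {k} (φ ψ : QF k) {ρ} → Holds (φ ∧ᶠ ψ) ρ → Holds φ ρ × Holds ψ ρ
  Holds-∧⁻ φ ψ {ρ} p with evalB φ ρ | evalB ψ ρ
  ... | true | true = refl , refl

  Holds-∨⁺ˡ : ∀ {k} (φ ψ : QF k) {ρ} → Holds φ ρ → Holds (φ ∨ᶠ ψ) ρ
  Holds-∨⁺ˡ φ ψ {ρ} p with evalB φ ρ
  Holds-∨⁺ˡ φ ψ {ρ} p | true = refl

  Holds-∨⁺ʳ : ∀ {k} (φ ψ : QF k) {ρ} → Holds ψ ρ → Holds (φ ∨ᶠ ψ) ρ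
  Holds-∨⁺ʳ φ ψ {ρ} q with evalB φ ρ | evalB ψ ρ
  Holds-∨⁺ʳ φ ψ {ρ} q | true  | true = refl
  Holds-∨⁺ʳ φ ψ {ρ} q | false | true = refl

  Holds-∨⁻ : ∀ {k} (φ ψ : QF k) {ρ} → Holds (φ ∨ᶠ ψ) ρ → Holds φ ρ ⊎ Holds ψ ρ
  Holds-∨⁻ φ ψ {ρ} p with evalB φ ρ | evalB ψ ρ
  ... | true  | _    = inj₁ refl
  ... | false | true = inj₂ refl

  ¬Holds-⊥ : ∀ {k} {ρ : Vector Carrier k} → ¬ Holds ⊥ᶠ ρ
  ¬Holds-⊥ {ρ = ρ} h = ¬Pos-1 (Pos-≡ (trans (eval-const -[1+ 0 ] ρ) (-1⊛ oneC)) (posB⇒Pos h))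

  Holds-⊤ : ∀ {k} {ρ : Vector Carrier k} → Holds ⊤ᶠ ρ
  Holds-⊤ {ρ = ρ} with evalB ⊥ᶠ ρ in eq
  ... | true  = ⊥-elim (¬Holds-⊥ {ρ = ρ} eq)
  ... | false = refl

  Holds-⋁⁺ : ∀ {A : Set} {k} (xs : List A) (f : A → QF k) {ρ x} → x ∈ xs → Holds (f x) ρ →
    Holds (⋁ᶠ xs f) ρ
  Holds-⋁⁺ (x ∷ xs) f (here refl) h = Holds-∨⁺ˡ (f x) (⋁ᶠ xs f) h
  Holds-⋁⁺ (x ∷ xs) f (there i)   h = Holds-∨⁺ʳ (f x) (⋁ᶠ xs f) (Holds-⋁⁺ xs f i h)

  Holds-⋁⁻ : ∀ {A : Set} {k} (xs : List A) (f : A → QF k) {ρ} → Holds (⋁ᶠ xs f) ρ →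
    Σ A λ x → Holds (f x) ρ
  Holds-⋁⁻ []       f {ρ} h = ⊥-elim (¬Holds-⊥ {ρ = ρ} h)
  Holds-⋁⁻ (x ∷ xs) f h with Holds-∨⁻ (f x) (⋁ᶠ xs f) h
  ... | inj₁ hx = x , hx
  ... | inj₂ hs = Holds-⋁⁻ xs f hs

  Holds-⋀⁺ : ∀ {j k} (f : Fin j → QF k) {ρ} → (∀ i → Holds (f i) ρ) → Holds (⋀ᶠ f) ρ
  Holds-⋀⁺ {zero}  f {ρ} h = Holds-⊤ {ρ = ρ}
  Holds-⋀⁺ {suc j} f     h =
    Holds-∧⁺ (f zero) (⋀ᶠ λ i → f (suc i)) (h zero) (Holds-⋀⁺ (λ i → f (suc i)) λ i → h (suc i))

  Holds-⋀⁻ : ∀ {j k} (f : Fin j → QF k) {ρ} → Holds (⋀ᶠ f) ρ → ∀ i → Holds (f i) ρ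
  Holds-⋀⁻ {suc j} f h i with Holds-∧⁻ (f zero) (⋀ᶠ λ i → f (suc i)) h
  Holds-⋀⁻ {suc j} f h zero    | h₀ , hs = h₀
  Holds-⋀⁻ {suc j} f h (suc i) | h₀ , hs = Holds-⋀⁻ (λ i → f (suc i)) hs i

  evalB-sub : ∀ {j k} N (e : Fin j → Lin k) (φ : QF j) {ρ ρ′} →
    (∀ i → eval (e i) ρ′ ≡ + suc N ⊛ ρ i) → evalB (subᶠ N e φ) ρ′ ≡ evalB φ ρ
  evalB-sub N e (ge L) {ρ} {ρ′} eq =
    trans (ap posB (eval-sub (+ suc N) e L eq)) (posB-⊛ N (eval L ρ))
  evalB-sub N e (dvd m L) {ρ} {ρ′} eq = trans
    (ap (dvdB (times N m)) (eval-sub (+ suc N) e L eq))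
    (dvdB-cong
      (λ { (z , p) → z , ⊛-injective N (trans p (⊛-assoc (+ suc N) (+ suc m) z)) })
      (λ { (z , p) → z , trans (ap (λ x → + suc N ⊛ x) p) (sym (⊛-assoc (+ suc N) (+ suc m) z)) }))
  evalB-sub N e (nand φ ψ) eq =
    cong₂ (λ a b → not (a ∧ b)) (evalB-sub N e φ eq) (evalB-sub N e ψ eq)

  Dvd-∣⁺ : ∀ {m N x} → m ∣⁺ N → Dvd N x → Dvd m x
  Dvd-∣⁺ {m} {N} {x} (q , eq) (z , p) = + q ⊛ z , (begin
    x                        ≡⟨ p ⟩
    + suc N ⊛ z              ≡⟨ ap (λ e → + e ⊛ z) (trans eq (ℕP.*-comm q (suc m))) ⟩
    + (suc m ℕ.* q) ⊛ z      ≡⟨ ap (λ e → e ⊛ z) (ℤP.pos-* (suc m) q) ⟩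
    (+ suc m ℤ.* + q) ⊛ z    ≡⟨ ⊛-assoc (+ suc m) (+ q) z ⟩
    + suc m ⊛ + q ⊛ z        ∎)
    where open ≡-Reasoning

  dvdB-shift : ∀ {n x y} → Dvd n (y ⊕ ⊝ x) → dvdB n x ≡ dvdB n y
  dvdB-shift {n} {x} {y} d = dvdB-cong
    (λ p → subst (Dvd n) (linear (x ∷ y ∷ []) (v₀ :+ (v₁ :+ :- v₀)) v₁ refl)
             (Dvd-⊕ p d))
    (λ p → subst (Dvd n)
             (linear (x ∷ y ∷ []) (v₁ :+ -[1+ 0 ] :* (v₁ :+ :- v₀)) v₀ refl)
             (Dvd-⊕ p (Dvd-⊛ -[1+ 0 ] d)))

  module _ {k} (ρ : Vector Carrier k) where

    value : Breakpoint k → Carrier → Carrier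
    value (a , s) t = + suc a ⊛ t ⊕ eval s ρ

    Agree : Carrier → Carrier → Breakpoint k → Set
    Agree t t′ b = posB (value b t) ≡ posB (value b t′)

    value-diff : ∀ b t t′ → value b t′ ≡ value b t ⊕ + suc (proj₁ b) ⊛ (t′ ⊕ ⊝ t)
    value-diff (a , s) t t′ = begin
      A ⊛ t′ ⊕ eval s ρ
        ≡⟨ ap (λ e → A ⊛ e ⊕ eval s ρ) (linear (t ∷ t′ ∷ []) v₁ (v₀ :+ (v₁ :+ :- v₀)) refl) ⟩
      A ⊛ (t ⊕ (t′ ⊕ ⊝ t)) ⊕ eval s ρ
        ≡⟨ ap (λ e → e ⊕ eval s ρ) (⊛-distribˡ A t (t′ ⊕ ⊝ t)) ⟩
      (A ⊛ t ⊕ A ⊛ (t′ ⊕ ⊝ t)) ⊕ eval s ρ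
        ≡⟨ linear (A ⊛ t ∷ A ⊛ (t′ ⊕ ⊝ t) ∷ eval s ρ ∷ [])
             ((v₀ :+ v₁) :+ v₂) ((v₀ :+ v₂) :+ v₁) refl ⟩
      (A ⊛ t ⊕ eval s ρ) ⊕ A ⊛ (t′ ⊕ ⊝ t) ∎
      where
      open ≡-Reasoning
      A = + suc a

    value-mono : ∀ b {t t′} → Pos (t′ ⊕ ⊝ t) → Pos (value b t) → Pos (value b t′)
    value-mono b p q = Pos-≡ (sym (value-diff b _ _)) (Pos-⊕ q (Pos-⊛ (suc (proj₁ b)) p))

    -- Monotonicity lets a breakpoint switch at most once along the line, so equal values at the
    -- ends leave no room for a switch in between.
    agree-between : ∀ b {x y z} → Pos (y ⊕ ⊝ x) → Pos (z ⊕ ⊝ y) → Agree x z b →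
      Agree x y b × Agree z y b
    agree-between b {x} {y} {z} x≤y y≤z xz with posB (value b x) in ex | posB (value b z) in ez
    ... | true | true =
      sym (posB-true (value-mono b x≤y (posB⇒Pos ex))) , sym (posB-true (value-mono b x≤y (posB⇒Pos ex)))
    ... | false | false with posB (value b y) in ey
    ...   | true  = ⊥-elim (Pos-Neg (value-mono b y≤z (posB⇒Pos ey)) (posB⇒Neg ez))
    ...   | false = refl , refl

    reflects-order : ∀ b {x y} → posB (value b x) ≡ false → posB (value b y) ≡ true → Pos (y ⊕ ⊝ x)
    reflects-order b {x} {y} ex ey with pos⊎neg (y ⊕ ⊝ x)
    ... | inj₁ p = p
    ... | inj₂ n = ⊥-elim (Pos-Neg (value-mono b x≥y (posB⇒Pos ey)) (posB⇒Neg ex))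
      where
      x≥y : Pos (x ⊕ ⊝ y)
      x≥y = Pos-≡ (linear (x ∷ y ∷ []) ((:- (v₁ :+ :- v₀) :+ :- :1) :+ :1) (v₀ :+ :- v₁) refl)
              (Pos-⊕ n 0≼1)

    -- The variable enters the atoms only through its side of each breakpoint and its class modulo
    -- the moduli; the hypotheses fix both.
    agree⇒evalB : ∀ (φ : QF (suc k)) {N t t′} → ModuliDivide φ N → Dvd N (t′ ⊕ ⊝ t) →
      All (Agree t t′) (breakpoints φ) → evalB φ (t VF.∷ ρ) ≡ evalB φ (t′ VF.∷ ρ)
    agree⇒evalB (ge L) {N} {t} {t′} _ d ag = begin
      posB (eval L (t VF.∷ ρ))   ≡⟨ ap posB (eval-tail L (t VF.∷ ρ)) ⟩
      posB (coef L zero ⊛ t ⊕ eval (tailᴸ L) ρ)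
        ≡⟨ agree (coef L zero) (tailᴸ L) ag ⟩
      posB (coef L zero ⊛ t′ ⊕ eval (tailᴸ L) ρ)
        ≡⟨ ap posB (eval-tail L (t′ VF.∷ ρ)) ⟨
      posB (eval L (t′ VF.∷ ρ))  ∎
      where
      open ≡-Reasoning
      flip : ∀ a s t → posB (-[1+ a ] ⊛ t ⊕ eval s ρ) ≡ not (posB (value (a , complᴸ s) t))
      flip a s t = trans (ap posB eq) (posB-compl _)
        where
        eq : -[1+ a ] ⊛ t ⊕ eval s ρ ≡ ⊝ value (a , complᴸ s) t ⊕ ⊝ oneC
        eq = begin
          (ℤ.- + suc a) ⊛ t ⊕ eval s ρ
            ≡⟨ ap (λ e → e ⊛ t ⊕ eval s ρ) (ℤP.-1*i≡-i (+ suc a)) ⟨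
          (-[1+ 0 ] ℤ.* + suc a) ⊛ t ⊕ eval s ρ
            ≡⟨ ap (λ e → e ⊕ eval s ρ) (⊛-assoc -[1+ 0 ] (+ suc a) t) ⟩
          -[1+ 0 ] ⊛ + suc a ⊛ t ⊕ eval s ρ
            ≡⟨ linear (+ suc a ⊛ t ∷ eval s ρ ∷ []) (-[1+ 0 ] :* v₀ :+ v₁)
                 (:- (v₀ :+ (:- v₁ :+ :- :1)) :+ :- :1) refl ⟩
          ⊝ (+ suc a ⊛ t ⊕ (⊝ eval s ρ ⊕ ⊝ oneC)) ⊕ ⊝ oneC
            ≡⟨ ap (λ e → ⊝ (+ suc a ⊛ t ⊕ e) ⊕ ⊝ oneC) (eval-compl s ρ) ⟨
          ⊝ value (a , complᴸ s) t ⊕ ⊝ oneC ∎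
      agree : ∀ a s → All (Agree t t′) (breakpoint a s) →
        posB (a ⊛ t ⊕ eval s ρ) ≡ posB (a ⊛ t′ ⊕ eval s ρ)
      agree (+ zero)  s ag       =
        ap (λ e → posB (e ⊕ eval s ρ)) (trans (0⊛ t) (sym (0⊛ t′)))
      agree (+ suc a) s (h ∷ []) = h
      agree -[1+ a ]  s (h ∷ []) = trans (flip a s t) (trans (ap not h) (sym (flip a s t′)))
    agree⇒evalB (dvd m L) {N} {t} {t′} m∣N d ag = dvdB-shift
      (subst (Dvd m) (begin
        coef L zero ⊛ (t′ ⊕ ⊝ t)
          ≡⟨ linear (eval L (t VF.∷ ρ) ∷ coef L zero ⊛ (t′ ⊕ ⊝ t) ∷ []) v₁ ((v₀ :+ v₁) :+ :- v₀) refl ⟩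
        (eval L (t VF.∷ ρ) ⊕ coef L zero ⊛ (t′ ⊕ ⊝ t)) ⊕ ⊝ eval L (t VF.∷ ρ)
          ≡⟨ ap (λ e → e ⊕ ⊝ eval L (t VF.∷ ρ)) (eval-update L zero (t′ ⊕ ⊝ t) {t VF.∷ ρ} {t′ VF.∷ ρ}
               (linear (t ∷ t′ ∷ []) v₁ (v₀ :+ (v₁ :+ :- v₀)) refl)
               λ { zero 0≢0 → ⊥-elim (0≢0 refl) ; (suc j) _ → refl }) ⟨
        eval L (t′ VF.∷ ρ) ⊕ ⊝ eval L (t VF.∷ ρ) ∎)
        (Dvd-⊛ (coef L zero) (Dvd-∣⁺ {m} {N} m∣N d)))
      where open ≡-Reasoning
    agree⇒evalB (nand φ ψ) (p , q) d ag = cong₂ (λ a b → not (a ∧ b))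
      (agree⇒evalB φ p d (AllP.++⁻ˡ (breakpoints φ) ag))
      (agree⇒evalB ψ q d (AllP.++⁻ʳ (breakpoints φ) ag))

    Candidate : ℕ → Breakpoint k → Carrier → Set
    Candidate d b t = Σ ℤ λ j → j ∈ candidates (times (proj₁ b) d) × value b t ≡ j ⊛ oneC

    -- t is moved towards the breakpoint by a multiple of suc d, without crossing it.
    approach : ∀ d b t → Σ Carrier λ t′ → Dvd d (t′ ⊕ ⊝ t) × Candidate d b t′ × Agree t t′ b ×
      ((posB (value b t) ≡ true × Pos (t ⊕ ⊝ t′)) ⊎ (posB (value b t) ≡ false × Pos (t′ ⊕ ⊝ t)))
    approach d b@(a , s) t with remainder (times a d) (value b t)
    ... | q , c , c≤n , eq with pos⊎neg q
    ...   | inj₁ q≥0 = t ⊕ ⊝ (+ suc d ⊛ q) , (⊝ q , shift) , (+ c , +-candidate c≤n , value≡) ,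
              trans sign (sym (posB-true (Pos-≡ (sym value≡) (Pos-⊛ c 0≼1)))) ,
              inj₁ (sign , Pos-≡ (linear (t ∷ + suc d ⊛ q ∷ []) v₁ (v₀ :+ :- (v₀ :+ :- v₁)) refl)
                (Pos-⊛ (suc d) q≥0))
      where
      open ≡-Reasoning
      t′ = t ⊕ ⊝ (+ suc d ⊛ q)
      sign : posB (value b t) ≡ true
      sign = trans (ap posB eq) (trans (posB-quotient (times a d) c q c≤n) (posB-true q≥0))
      shift : t′ ⊕ ⊝ t ≡ + suc d ⊛ ⊝ q
      shift = trans (linear (t ∷ + suc d ⊛ q ∷ []) ((v₀ :+ :- v₁) :+ :- v₀) (:- v₁) refl)
        (sym (⊛-⊝ (+ suc d) q))
      value≡ : value b t′ ≡ + c ⊛ oneC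
      value≡ = begin
        value b t′
          ≡⟨ value-diff b t t′ ⟩
        value b t ⊕ + suc a ⊛ (t′ ⊕ ⊝ t)
          ≡⟨ cong₂ (λ e f → e ⊕ + suc a ⊛ f) eq shift ⟩
        (+ c ⊛ oneC ⊕ + suc (times a d) ⊛ q) ⊕ + suc a ⊛ + suc d ⊛ ⊝ q
          ≡⟨ ap (λ e → (+ c ⊛ oneC ⊕ + suc (times a d) ⊛ q) ⊕ e)
               (trans (sym (⊛-assoc (+ suc a) (+ suc d) (⊝ q))) (⊛-⊝ (+ suc (times a d)) q)) ⟩
        (+ c ⊛ oneC ⊕ + suc (times a d) ⊛ q) ⊕ ⊝ (+ suc (times a d) ⊛ q)
          ≡⟨ linear (+ c ⊛ oneC ∷ + suc (times a d) ⊛ q ∷ []) ((v₀ :+ v₁) :+ :- v₁) v₀ refl ⟩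
        + c ⊛ oneC ∎
    ...   | inj₂ q<0 = t ⊕ + suc d ⊛ (⊝ q ⊕ ⊝ oneC) , (⊝ q ⊕ ⊝ oneC , shift) ,
              (+ c ℤ.- + M , −-candidate c≤n , value≡) ,
              trans sign (sym sign′) ,
              inj₂ (sign , Pos-≡ (sym shift) (Pos-⊛ (suc d) q<0))
      where
      open ≡-Reasoning
      n M : ℕ
      n = times a d
      M = suc n
      -- All -q periods would bring the value to c ≥ 0 and cross the breakpoint; with -q - 1 of them
      -- it is c - M, still negative.
      t′ = t ⊕ + suc d ⊛ (⊝ q ⊕ ⊝ oneC)
      shift : t′ ⊕ ⊝ t ≡ + suc d ⊛ (⊝ q ⊕ ⊝ oneC)
      shift = linear (t ∷ + suc d ⊛ (⊝ q ⊕ ⊝ oneC) ∷ []) ((v₀ :+ v₁) :+ :- v₀) v₁ refl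
      value≡ : value b t′ ≡ (+ c ℤ.- + M) ⊛ oneC
      value≡ = begin
        value b t′
          ≡⟨ value-diff b t t′ ⟩
        value b t ⊕ + suc a ⊛ (t′ ⊕ ⊝ t)
          ≡⟨ cong₂ (λ e f → e ⊕ + suc a ⊛ f) eq shift ⟩
        (+ c ⊛ oneC ⊕ + M ⊛ q) ⊕ + suc a ⊛ + suc d ⊛ (⊝ q ⊕ ⊝ oneC)
          ≡⟨ ap (λ e → (+ c ⊛ oneC ⊕ + M ⊛ q) ⊕ e) (begin
               + suc a ⊛ + suc d ⊛ (⊝ q ⊕ ⊝ oneC)     ≡⟨ ⊛-assoc (+ suc a) (+ suc d) _ ⟨
               + M ⊛ (⊝ q ⊕ ⊝ oneC)                   ≡⟨ ⊛-distribˡ (+ M) _ _ ⟩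
               + M ⊛ ⊝ q ⊕ + M ⊛ ⊝ oneC               ≡⟨ cong₂ _⊕_ (⊛-⊝ (+ M) q) (⊛-⊝ (+ M) oneC) ⟩
               ⊝ (+ M ⊛ q) ⊕ ⊝ (+ M ⊛ oneC)           ∎) ⟩
        (+ c ⊛ oneC ⊕ + M ⊛ q) ⊕ (⊝ (+ M ⊛ q) ⊕ ⊝ (+ M ⊛ oneC))
          ≡⟨ linear (+ c ⊛ oneC ∷ + M ⊛ q ∷ + M ⊛ oneC ∷ [])
               ((v₀ :+ v₁) :+ (:- v₁ :+ :- v₂)) (v₀ :+ :- v₂) refl ⟩
        + c ⊛ oneC ⊕ ⊝ (+ M ⊛ oneC)
          ≡⟨ ⊛-minus (+ c) (+ M) oneC ⟨
        (+ c ℤ.- + M) ⊛ oneC ∎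
      sign : posB (value b t) ≡ false
      sign = trans (ap posB eq) (trans (posB-quotient n c q c≤n) (posB-false q<0))
      sign′ : posB (value b t′) ≡ false
      sign′ = trans (ap posB (trans value≡ (trans (⊛-minus (+ c) (+ M) oneC)
          (ap (λ e → + c ⊛ oneC ⊕ e) (sym (⊛-⊝ (+ M) oneC))))))
        (trans (posB-quotient n c (⊝ oneC) c≤n) (posB-false -1<0))

    -- The point found for the tail is kept unless it has crossed `b`. In that case stopping at `b`
    -- gives a point between t and the one found, which by `agree-between` crosses no breakpoint of
    -- the tail.
    approachAll : ∀ d b bs t → Σ Carrier λ t′ → Dvd d (t′ ⊕ ⊝ t) ×
      (Σ (Breakpoint k) λ b′ → b′ ∈ b ∷ bs × Candidate d b′ t′) × All (Agree t t′) (b ∷ bs)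
    approachAll d b [] t with approach d b t
    ... | t′ , shift , cand , agree , _ = t′ , shift , (b , here refl , cand) , agree ∷ []
    approachAll d b (b₁ ∷ bs) t with approachAll d b₁ bs t
    ... | t₁ , shift₁ , (b′ , b′∈ , cand₁) , agree₁ = closer (posB (value b t)) (posB (value b t₁)) refl refl
      where
      Result = Σ Carrier λ t′ → Dvd d (t′ ⊕ ⊝ t) ×
        (Σ (Breakpoint k) λ b′ → b′ ∈ b ∷ b₁ ∷ bs × Candidate d b′ t′) ×
        All (Agree t t′) (b ∷ b₁ ∷ bs)
      keep : Agree t t₁ b → Result
      keep ag = t₁ , shift₁ , (b′ , there b′∈ , cand₁) , ag ∷ agree₁
      closer : ∀ x y → posB (value b t) ≡ x → posB (value b t₁) ≡ y → Result
      closer true  true  et et₁ = keep (trans et (sym et₁))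
      closer false false et et₁ = keep (trans et (sym et₁))
      closer true false et et₁ with approach d b t
      ... | _ , _ , _ , _ , inj₂ (e , _) = contradictory et e
      ... | t₂ , shift₂ , cand₂ , agree₂ , inj₁ (_ , t₂≤t) =
        t₂ , shift₂ , (b , here refl , cand₂) , agree₂ ∷ All.map
          (λ {c} ag → proj₂ (agree-between c
            (reflects-order b et₁ (trans (sym agree₂) et)) t₂≤t (sym ag))) agree₁
      closer false true et et₁ with approach d b t
      ... | _ , _ , _ , _ , inj₁ (e , _) = contradictory e et
      ... | t₂ , shift₂ , cand₂ , agree₂ , inj₂ (_ , t≤t₂) =
        t₂ , shift₂ , (b , here refl , cand₂) , agree₂ ∷ All.map
          (λ {c} ag → proj₁ (agree-between c t≤t₂
            (reflects-order b (trans (sym agree₂) et) et₁) ag)) agree₁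

    eval-numerator : ∀ b j → eval (numerator b j) ρ ≡ j ⊛ oneC ⊕ ⊝ eval (proj₂ b) ρ
    eval-numerator (a , s) j = trans (eval-+ (constᴸ j) (-[1+ 0 ] *ᴸ s) ρ)
      (cong₂ _⊕_ (eval-const j ρ) (trans (eval-* -[1+ 0 ] s ρ) (-1⊛ _)))

    eval-numerators : ∀ b j t → eval (numerator b j) ρ ≡ + suc (proj₁ b) ⊛ t →
      ∀ i → eval (numerators b j i) ρ ≡ + suc (proj₁ b) ⊛ (t VF.∷ ρ) i
    eval-numerators b       j t eq zero    = eq
    eval-numerators (a , s) j t eq (suc i) =
      trans (eval-* (+ suc a) (varᴸ i) ρ) (ap (λ e → + suc a ⊛ e) (eval-var i ρ))

    -- A witness moved by `approachAll` is still a witness, and it gives some breakpoint one of the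
    -- listed values; this selects a disjunct.
    eliminate-complete : ∀ (φ : QF (suc k)) t → Holds φ (t VF.∷ ρ) → Holds (eliminate φ) ρ
    eliminate-complete φ t h
        with approachAll (modulus φ) (0 , constᴸ (+ 0)) (breakpoints φ) t
    ... | t′ , shift , (b , b∈ , (j , j∈ , eq)) , (_ ∷ agree) =
      Holds-⋁⁺ (allBreakpoints φ) _ b∈ (Holds-⋁⁺ (candidates (times (proj₁ b) (modulus φ))) (holdsWhere φ b) j∈
        (Holds-∧⁺ (dvd (proj₁ b) (numerator b j)) (subᶠ (proj₁ b) (numerators b j) φ)
          (dvdB-true (t′ , num))
          (trans (evalB-sub (proj₁ b) (numerators b j) φ (eval-numerators b j t′ num))
            (trans (sym (agree⇒evalB φ (modulus-divides φ) shift agree)) h))))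
      where
      num : eval (numerator b j) ρ ≡ + suc (proj₁ b) ⊛ t′
      num = trans (eval-numerator b j) (trans (ap (λ e → e ⊕ ⊝ eval (proj₂ b) ρ) (sym eq))
        (linear (+ suc (proj₁ b) ⊛ t′ ∷ eval (proj₂ b) ρ ∷ []) ((v₀ :+ v₁) :+ :- v₁) v₀ refl))

    eliminate-sound : ∀ (φ : QF (suc k)) → Holds (eliminate φ) ρ →
      Σ Carrier λ t → Holds φ (t VF.∷ ρ)
    eliminate-sound φ h with Holds-⋁⁻ (allBreakpoints φ) _ h
    ... | b , hb with Holds-⋁⁻ (candidates (times (proj₁ b) (modulus φ))) (holdsWhere φ b) hb
    ... | j , hj with Holds-∧⁻ (dvd (proj₁ b) (numerator b j)) (subᶠ (proj₁ b) (numerators b j) φ) hj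
    ... | hd , hs with dvdB⇒Dvd {proj₁ b} hd
    ... | t , eq = t , trans
      (sym (evalB-sub (proj₁ b) (numerators b j) φ (eval-numerators b j t eq))) hs

  eval-term : ∀ {k} (t : Term k) ρ → eval (termᴸ t) ρ ≡ evalT structure t ρ
  eval-term (var i)  ρ = eval-var i ρ
  eval-term `0       ρ = trans (eval-const (+ 0) ρ) (0⊛ oneC)
  eval-term `1       ρ = trans (eval-const (+ 1) ρ) (1⊛ oneC)
  eval-term (t `+ s) ρ = trans (eval-+ (termᴸ t) (termᴸ s) ρ) (cong₂ _⊕_ (eval-term t ρ) (eval-term s ρ))

  eval-diff : ∀ {k} (t s : Term k) ρ →
    eval (diffᴸ t s) ρ ≡ evalT structure t ρ ⊕ ⊝ evalT structure s ρ
  eval-diff t s ρ = trans (eval-+ (termᴸ t) (-[1+ 0 ] *ᴸ termᴸ s) ρ)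
    (cong₂ _⊕_ (eval-term t ρ)
      (trans (eval-* -[1+ 0 ] (termᴸ s) ρ) (trans (-1⊛ _) (ap ⊝_ (eval-term s ρ)))))

  Holds-ge-diff⁺ : ∀ {k} (t s : Term k) {ρ} → evalT structure t ρ ≼ evalT structure s ρ →
    Holds (ge (diffᴸ s t)) ρ
  Holds-ge-diff⁺ t s {ρ} p = posB-true (Pos-≡ (sym (eval-diff s t ρ)) (≼⇒Pos p))

  Holds-ge-diff⁻ : ∀ {k} (t s : Term k) {ρ} → Holds (ge (diffᴸ s t)) ρ →
    evalT structure t ρ ≼ evalT structure s ρ
  Holds-ge-diff⁻ t s {ρ} h = Pos⇒≼ (Pos-≡ (eval-diff s t ρ) (posB⇒Pos h))

  ≼-refl-≡ : ∀ {x y} → x ≡ y → x ≼ y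
  ≼-refl-≡ {x} refl = Pos⇒≼ (Pos-≡ (sym (⊝-inverseʳ x)) 0≼0)

  ≼-antisym′ : ∀ {x y} → x ≼ y → y ≼ x → x ≡ y
  ≼-antisym′ {x} {y} p q = begin
    x               ≡⟨ linear (x ∷ y ∷ []) v₀ ((v₀ :+ :- v₁) :+ v₁) refl ⟩
    (x ⊕ ⊝ y) ⊕ y   ≡⟨ ap (λ e → e ⊕ y) (Pos-antisym (≼⇒Pos q)
                         (Pos-≡ (linear (x ∷ y ∷ []) (v₁ :+ :- v₀) (:- (v₀ :+ :- v₁)) refl) (≼⇒Pos p))) ⟩
    zeroC ⊕ y       ≡⟨ ⊕-identityˡ y ⟩
    y               ∎
    where open ≡-Reasoning

  Cong⇒Dvd : ∀ {n x y} → Cong n x y → Dvd n (x ⊕ ⊝ y)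
  Cong⇒Dvd {n} {x} {y} c with Cong⇒ n x y c
  ... | z , eq = z , trans (ap (λ e → e ⊕ ⊝ y) eq)
    (trans (linear (y ∷ suc n • z ∷ []) ((v₀ :+ v₁) :+ :- v₀) v₁ refl) (sym (+⊛ (suc n) z)))

  Dvd⇒Cong : ∀ {n x y} → Dvd n (x ⊕ ⊝ y) → Cong n x y
  Dvd⇒Cong {n} {x} {y} (z , eq) = ⇒Cong n x y z
    (trans (linear (x ∷ y ∷ []) v₀ (v₁ :+ (v₀ :+ :- v₁)) refl)
      (ap (λ e → y ⊕ e) (trans eq (+⊛ (suc n) z))))

  -- Mutual with the converse, since the premise of an implication has to be translated in the
  -- opposite direction.
  qe-complete : ∀ {k} (φ : Formula k) {ρ} → Sat structure φ ρ → Holds (qe φ) ρ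
  qe-sound    : ∀ {k} (φ : Formula k) {ρ} → Holds (qe φ) ρ → Sat structure φ ρ

  qe-complete (t `≈ s) p = Holds-∧⁺ (ge (diffᴸ t s)) (ge (diffᴸ s t))
    (Holds-ge-diff⁺ s t (≼-refl-≡ (sym p))) (Holds-ge-diff⁺ t s (≼-refl-≡ p))
  qe-complete (t `≤ s) p = Holds-ge-diff⁺ t s p
  qe-complete (cong n t s) {ρ} p = dvdB-true (subst (Dvd n) (sym (eval-diff t s ρ)) (Cong⇒Dvd p))
  qe-complete (φ `∧ ψ) (p , q) = Holds-∧⁺ (qe φ) (qe ψ) (qe-complete φ p) (qe-complete ψ q)
  qe-complete (φ `∨ ψ) (inj₁ p) = Holds-∨⁺ˡ (qe φ) (qe ψ) (qe-complete φ p)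
  qe-complete (φ `∨ ψ) (inj₂ q) = Holds-∨⁺ʳ (qe φ) (qe ψ) (qe-complete ψ q)
  qe-complete (φ `⇒ ψ) f = Holds-⇒⁺ (qe φ) (qe ψ) λ h → qe-complete ψ (f (qe-sound φ h))
  qe-complete (`∀ φ) {ρ} f = Holds-¬⁺ (eliminate (¬ᶠ qe φ)) (refute (eliminate (¬ᶠ qe φ)) λ h →
    let t , ht = eliminate-sound ρ (¬ᶠ qe φ) h
    in contradictory (qe-complete φ (f t)) (Holds-¬⁻ (qe φ) ht))
  qe-complete (`∃ φ) {ρ} (t , p) = eliminate-complete ρ (qe φ) t (qe-complete φ p)

  qe-sound (t `≈ s) h with Holds-∧⁻ (ge (diffᴸ t s)) (ge (diffᴸ s t)) h
  ... | p , q = ≼-antisym′ (Holds-ge-diff⁻ t s q) (Holds-ge-diff⁻ s t p)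
  qe-sound (t `≤ s) h = Holds-ge-diff⁻ t s h
  qe-sound (cong n t s) {ρ} h = Dvd⇒Cong (subst (Dvd n) (eval-diff t s ρ) (dvdB⇒Dvd h))
  qe-sound `⊥ {ρ} h = ¬Holds-⊥ {ρ = ρ} h
  qe-sound (φ `∧ ψ) h = let p , q = Holds-∧⁻ (qe φ) (qe ψ) h in qe-sound φ p , qe-sound ψ q
  qe-sound (φ `∨ ψ) h = Sum.map (qe-sound φ) (qe-sound ψ) (Holds-∨⁻ (qe φ) (qe ψ) h)
  qe-sound (φ `⇒ ψ) h p = qe-sound ψ (Holds-⇒⁻ (qe φ) (qe ψ) h (qe-complete φ p))
  qe-sound (`∀ φ) {ρ} h t = qe-sound φ (confirm (qe φ) λ e →
    contradictory (eliminate-complete ρ (¬ᶠ qe φ) t (Holds-¬⁺ (qe φ) e))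
                  (Holds-¬⁻ (eliminate (¬ᶠ qe φ)) h))
  qe-sound (`∃ φ) {ρ} h = let t , ht = eliminate-sound ρ (qe φ) h in t , qe-sound φ ht

  -- The language has no subtraction, so a form is split into two terms with natural coefficients,
  -- and an atom on it becomes a comparison of these.
  partᵀ : ∀ {k} → (ℤ → ℕ) → Lin k → Term k
  partᵀ f L = multT (f (const L)) `1 `+ ∑ᵀ (λ i → multT (f (coef L i)) (var i))

  toFormula : ∀ {k} → QF k → Formula k
  toFormula (ge L)     = partᵀ (negPart G) L `≤ partᵀ (posPart G) L
  toFormula (dvd n L)  = cong n (partᵀ (posPart G) L) (partᵀ (negPart G) L)
  toFormula (nand φ ψ) = (toFormula φ `∧ toFormula ψ) `⇒ `⊥

  evalT-∑ : ∀ {j k} (f : Fin j → Term k) ρ → evalT structure (∑ᵀ f) ρ ≡ ∑ (λ i → evalT structure (f i) ρ)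
  evalT-∑ {zero}  f ρ = refl
  evalT-∑ {suc j} f ρ = ap (λ e → evalT structure (f zero) ρ ⊕ e) (evalT-∑ (λ i → f (suc i)) ρ)

  evalT-part : ∀ {k} f (L : Lin k) ρ → evalT structure (partᵀ f L) ρ ≡
    f (const L) • oneC ⊕ ∑ (λ i → f (coef L i) • ρ i)
  evalT-part f L ρ = cong₂ _⊕_ (evalT-multT (f (const L)) `1 ρ)
    (trans (evalT-∑ (λ i → multT (f (coef L i)) (var i)) ρ)
           (∑-cong λ i → evalT-multT (f (coef L i)) (var i) ρ))

  ∑-⊛-parts : ∀ {k} (a : Vector ℤ k) (x : Vector Carrier k) → ∑ (λ i → a i ⊛ x i) ≡
    ∑ (λ i → posPart G (a i) • x i) ⊕ ⊝ ∑ (λ i → negPart G (a i) • x i)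
  ∑-⊛-parts a x = begin
    ∑ (λ i → a i ⊛ x i)
      ≡⟨ ∑-cong (λ i → trans (⊛-parts (a i) (x i)) (ap (λ e → posPart G (a i) • x i ⊕ e) (sym (-1⊛ _)))) ⟩
    ∑ (λ i → posPart G (a i) • x i ⊕ -[1+ 0 ] ⊛ (negPart G (a i) • x i))
      ≡⟨ ∑-⊕ (λ i → posPart G (a i) • x i) (λ i → -[1+ 0 ] ⊛ (negPart G (a i) • x i)) ⟩
    ∑ (λ i → posPart G (a i) • x i) ⊕ ∑ (λ i → -[1+ 0 ] ⊛ (negPart G (a i) • x i))
      ≡⟨ ap (λ e → ∑ (λ i → posPart G (a i) • x i) ⊕ e)
           (trans (∑-⊛ -[1+ 0 ] (λ i → negPart G (a i) • x i)) (-1⊛ _)) ⟩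
    ∑ (λ i → posPart G (a i) • x i) ⊕ ⊝ ∑ (λ i → negPart G (a i) • x i) ∎
    where open ≡-Reasoning

  evalT-parts : ∀ {k} (L : Lin k) ρ → eval L ρ ≡
    evalT structure (partᵀ (posPart G) L) ρ ⊕ ⊝ evalT structure (partᵀ (negPart G) L) ρ
  evalT-parts L ρ = begin
    eval L ρ
      ≡⟨ cong₂ _⊕_ (⊛-parts (const L) oneC) (∑-⊛-parts (coef L) ρ) ⟩
    (posPart G (const L) • oneC ⊕ ⊝ (negPart G (const L) • oneC)) ⊕ (P ⊕ ⊝ N)
      ≡⟨ linear (posPart G (const L) • oneC ∷ negPart G (const L) • oneC ∷ P ∷ N ∷ [])
           ((v₀ :+ :- v₁) :+ (v₂ :+ :- v₃)) ((v₀ :+ v₂) :+ :- (v₁ :+ v₃)) refl ⟩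
    (posPart G (const L) • oneC ⊕ P) ⊕ ⊝ (negPart G (const L) • oneC ⊕ N)
      ≡⟨ cong₂ (λ e f → e ⊕ ⊝ f) (evalT-part (posPart G) L ρ) (evalT-part (negPart G) L ρ) ⟨
    _ ∎
    where
    open ≡-Reasoning
    P = ∑ (λ i → posPart G (coef L i) • ρ i)
    N = ∑ (λ i → negPart G (coef L i) • ρ i)

  toFormula-complete : ∀ {k} (φ : QF k) {ρ} → Holds φ ρ → Sat structure (toFormula φ) ρ
  toFormula-sound    : ∀ {k} (φ : QF k) {ρ} → Sat structure (toFormula φ) ρ → Holds φ ρ

  toFormula-complete (ge L) {ρ} h = Pos⇒≼ (Pos-≡ (evalT-parts L ρ) (posB⇒Pos h))
  toFormula-complete (dvd n L) {ρ} h = Dvd⇒Cong (subst (Dvd n) (evalT-parts L ρ) (dvdB⇒Dvd h))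
  toFormula-complete (nand φ ψ) {ρ} h (p , q)
      with evalB φ ρ | evalB ψ ρ | toFormula-sound φ {ρ} p | toFormula-sound ψ {ρ} q
  toFormula-complete (nand φ ψ) {ρ} () (p , q) | true | true | _ | _

  toFormula-sound (ge L) {ρ} p = posB-true (Pos-≡ (sym (evalT-parts L ρ)) (≼⇒Pos p))
  toFormula-sound (dvd n L) {ρ} p = dvdB-true (subst (Dvd n) (sym (evalT-parts L ρ)) (Cong⇒Dvd p))
  toFormula-sound (nand φ ψ) {ρ} f with evalB φ ρ in eφ | evalB ψ ρ in eψ
  ... | false | _     = refl
  ... | true  | false = refl
  ... | true  | true  = ⊥-elim (f (toFormula-complete φ eφ , toFormula-complete ψ eψ))

-- Definable families of fibres in coordinates: orthants times bounded sets

split-elim : ∀ {m n} (P : Fin (m ℕ.+ n) → Set) →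
  (∀ j → P (j ↑ˡ n)) → (∀ i → P (m ↑ʳ i)) → ∀ k → P k
split-elim {m} {n} P f g k = subst P (FinP.join-splitAt m n k) (onJoin (splitAt m k))
  where
  onJoin : ∀ s → P (join m n s)
  onJoin (inj₁ j) = f j
  onJoin (inj₂ i) = g i

δ-↑ʳ : ∀ m {n} (i j : Fin n) → δ (m ↑ʳ i) (m ↑ʳ j) ≡ δ i j
δ-↑ʳ zero    i j = refl
δ-↑ʳ (suc m) i j = δ-↑ʳ m i j

δ-↑ʳ-↑ˡ : ∀ {m n} (i : Fin n) (j : Fin m) → δ (m ↑ʳ i) (j ↑ˡ n) ≡ + 0
δ-↑ʳ-↑ˡ i zero    = refl
δ-↑ʳ-↑ˡ i (suc j) = δ-↑ʳ-↑ˡ i j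

module Pieces (G : ZGroup) where
  open QuantifierElimination G public

  eval-pointwise : ∀ {k} (L : Lin k) {ρ ρ′} → (∀ i → coef L i ⊛ ρ i ≡ coef L i ⊛ ρ′ i) →
    eval L ρ ≡ eval L ρ′
  eval-pointwise L eq = ap (λ e → const L ⊛ oneC ⊕ e) (∑-cong eq)

  Pos-∑ : ∀ {k} (f : Vector Carrier k) → (∀ i → Pos (f i)) → Pos (∑ f)
  Pos-∑ {zero}  f p = 0≼0
  Pos-∑ {suc k} f p = Pos-⊕ (p zero) (Pos-∑ (λ i → f (suc i)) λ i → p (suc i))

  Pos-eval : ∀ {k} (L : Lin k) {ρ} → const L ≡ + 0 → (∀ i → Pos (coef L i ⊛ ρ i)) → Pos (eval L ρ)
  Pos-eval L {ρ} c≡0 p = Pos-≡ (sym (trans (ap (λ e → e ⊕ s) (trans (ap (λ a → a ⊛ oneC) c≡0) (0⊛ oneC)))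
    (⊕-identityˡ _))) (Pos-∑ (λ i → coef L i ⊛ ρ i) p)
    where s = ∑ (λ i → coef L i ⊛ ρ i)

  Pos-⊛⁺ : ∀ {a x} → + 0 ℤ.≤ a → Pos x → Pos (a ⊛ x)
  Pos-⊛⁺ {+ n} _ p = Pos-⊛ n p

  module Charts (m n N : ℕ) where

    Env : Set
    Env = Vector Carrier (m ℕ.+ n)

    infixr 5 _⋆_
    _⋆_ : Vector Carrier m → Vector Carrier n → Env
    l ⋆ p = l VF.++ p

    ⋆ˡ : ∀ l p j → (l ⋆ p) (j ↑ˡ n) ≡ l j
    ⋆ˡ = VFP.lookup-++ˡ

    ⋆ʳ : ∀ l p i → (l ⋆ p) (m ↑ʳ i) ≡ p i
    ⋆ʳ = VFP.lookup-++ʳ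

    ⋆-cong : ∀ l {p q} → (∀ i → p i ≡ q i) → ∀ k → (l ⋆ p) k ≡ (l ⋆ q) k
    ⋆-cong l eq = VFP.++-cong l l (λ _ → refl) eq

    withParams : (Fin n → Lin (m ℕ.+ n)) → Fin (m ℕ.+ n) → Lin (m ℕ.+ n)
    withParams e = (λ j → varᴸ (j ↑ˡ n)) VF.++ e

    withParams-ˡ : ∀ e j → withParams e (j ↑ˡ n) ≡ varᴸ (j ↑ˡ n)
    withParams-ˡ e j = VFP.lookup-++ˡ (λ j → varᴸ (j ↑ˡ n)) e j

    withParams-ʳ : ∀ e i → withParams e (m ↑ʳ i) ≡ e i
    withParams-ʳ e i = VFP.lookup-++ʳ (λ j → varᴸ (j ↑ˡ n)) e i

    image : (Fin n → Lin (m ℕ.+ n)) → Vector Carrier m → Vector Carrier n → Vector Carrier n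
    image e l p i = eval (e i) (l ⋆ p)

    point : (Fin n → Lin (m ℕ.+ n)) → Vector Carrier m → Vector Carrier n → Env
    point e l p = l ⋆ image e l p

    compose : (Fin n → Lin (m ℕ.+ n)) → Lin (m ℕ.+ n) → Lin (m ℕ.+ n)
    compose e = subᴸ (+ 1) (withParams e)

    eval-compose : ∀ e L l p → eval (compose e L) (l ⋆ p) ≡ eval L (point e l p)
    eval-compose e L l p = trans
      (eval-sub (+ 1) (withParams e) L (λ k → trans (coordinate k) (sym (1⊛ _)))) (1⊛ _)
      where
      coordinate : ∀ k → eval (withParams e k) (l ⋆ p) ≡ point e l p k
      coordinate = split-elim _
        (λ j → trans (ap (λ L → eval L (l ⋆ p)) (withParams-ˡ e j))
          (trans (eval-var (j ↑ˡ n) (l ⋆ p)) (trans (⋆ˡ l p j) (sym (⋆ˡ l _ j)))))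
        (λ i → trans (ap (λ L → eval L (l ⋆ p)) (withParams-ʳ e i)) (sym (⋆ʳ l _ i)))

    scaled : (Fin n → Lin (m ℕ.+ n)) → Fin (m ℕ.+ n) → Lin (m ℕ.+ n)
    scaled e = (λ j → + suc N *ᴸ varᴸ (j ↑ˡ n)) VF.++ e

    AgreeOff : (Fin n → Bool) → Vector Carrier n → Vector Carrier n → Set
    AgreeOff free p q = ∀ i → free i ≡ false → p i ≡ q i

    -- For every l, the affine map p ↦ image bwd l p identifies a set of the form
    -- H^free × (bounded set) with the fibre of D over l; its inverse is fwd divided by suc N.
    record Piece (D : QF (m ℕ.+ n)) : Set where
      field
        fwd bwd   : Fin n → Lin (m ℕ.+ n)
        free      : Fin n → Bool
        -- Demanded for every p, whether or not the point lies in `D`. It recovers p from x with the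
        -- denominator suc N, so that conditions on p become formulas on x.
        fwd-bwd   : ∀ l p i → eval (fwd i) (point bwd l p) ≡ + suc N ⊛ p i
        onto      : ∀ l x → Holds D (l ⋆ x) → Σ (Vector Carrier n) λ p → ∀ i → x i ≡ image bwd l p i
        nonneg    : ∀ l p → Holds D (point bwd l p) → ∀ i → free i ≡ true → Pos (p i)
        bounded   : ∀ l → Σ Carrier λ b → Pos b × (∀ p → Holds D (point bwd l p) →
                      ∀ i → free i ≡ false → Pos (b ⊕ p i) × Pos (b ⊕ ⊝ p i))
        -- Together with `nonneg` this makes the set of admissible p a product of H^free with a set
        -- in the remaining coordinates.
        saturated : ∀ l p q → Holds D (point bwd l p) → AgreeOff free p q →
                      (∀ i → free i ≡ true → Pos (q i)) → Holds D (point bwd l q)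
        -- The classes of x are constant on all of `D`; this settles the divisibility atoms and
        -- provides the residues in the definition of linearity.
        residue   : Fin n → ℕ
        residue≤  : ∀ i → residue i ℕ.≤ N
        residual  : ∀ l x → Holds D (l ⋆ x) → ∀ i → Dvd N (x i ⊕ ⊝ (+ residue i ⊛ oneC))

    open Piece public

    at : ∀ {D} → Piece D → Vector Carrier m → Vector Carrier n → Env
    at P = point (bwd P)

    -- The aim of the refinement: once `X` has this property, intersecting with `X` preserves the
    -- product form.
    Indep : ∀ {D} → Piece D → QF (m ℕ.+ n) → Set
    Indep {D} P φ = ∀ l p q → Holds D (at P l p) → Holds D (at P l q) → AgreeOff (free P) p q →
      evalB φ (at P l p) ≡ evalB φ (at P l q)

    infix 4 _⊑_
    -- What a refined piece has to inherit is the independence already achieved for other formulas,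
    -- so this is taken as the order, rather than an inclusion of domains.
    _⊑_ : ∀ {D D′} → Piece D′ → Piece D → Set
    P′ ⊑ P = ∀ φ → Indep P φ → Indep P′ φ

    -- The atom remains a formula on x while the chart changes; K records how it looks in the
    -- current coordinates.
    Tracks : ∀ {D} → Piece D → Lin (m ℕ.+ n) → Lin (m ℕ.+ n) → Set
    Tracks P L K = ∀ l p → eval L (at P l p) ≡ eval K (l ⋆ p)

    slope : Lin (m ℕ.+ n) → Fin n → ℤ
    slope K i = coef K (m ↑ʳ i)

    -- A cut must be a formula on x. Since p is `fwd` divided by suc N, a sign condition on p
    -- becomes one by substitution with that denominator.
    condition : ∀ {D} → Piece D → Lin (m ℕ.+ n) → QF (m ℕ.+ n)
    condition P K = subᶠ N (scaled (fwd P)) (ge K)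

    scaled-at : ∀ {D} (P : Piece D) l p k → eval (scaled (fwd P) k) (at P l p) ≡ + suc N ⊛ (l ⋆ p) k
    scaled-at P l p = split-elim _
      (λ j → trans (ap (λ L → eval L (at P l p)) (VFP.lookup-++ˡ (λ j → + suc N *ᴸ varᴸ (j ↑ˡ n)) (fwd P) j))
        (trans (eval-* (+ suc N) (varᴸ (j ↑ˡ n)) (at P l p))
          (ap (λ e → + suc N ⊛ e) (trans (eval-var (j ↑ˡ n) (at P l p)) (trans (⋆ˡ l _ j) (sym (⋆ˡ l p j)))))))
      (λ i → trans (ap (λ L → eval L (at P l p)) (VFP.lookup-++ʳ (λ j → + suc N *ᴸ varᴸ (j ↑ˡ n)) (fwd P) i))
        (trans (fwd-bwd P l p i) (ap (λ e → + suc N ⊛ e) (sym (⋆ʳ l p i)))))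

    evalB-condition : ∀ {D} (P : Piece D) K l p → evalB (condition P K) (at P l p) ≡ posB (eval K (l ⋆ p))
    evalB-condition P K l p = evalB-sub N (scaled (fwd P)) (ge K) (scaled-at P l p)

    onto-Holds : ∀ {D} (P : Piece D) l x → Holds D (l ⋆ x) →
      Σ (Vector Carrier n) λ p → (∀ k → (l ⋆ x) k ≡ at P l p k) × Holds D (at P l p)
    onto-Holds {D} P l x h = let p , eq = onto P l x h in
      p , ⋆-cong l eq , trans (sym (evalB-cong D (⋆-cong l eq))) h

    Indep-true : ∀ {D} (P : Piece D) φ → (∀ l x → Holds D (l ⋆ x) → Holds φ (l ⋆ x)) → Indep P φ
    Indep-true P φ f l p q hp hq _ = trans (f l _ hp) (sym (f l _ hq))

    true≢false : ∀ {b : Bool} → b ≡ true → ¬ (b ≡ false)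
    true≢false refl ()

    module _ {D} (P : Piece D) (φ : QF (m ℕ.+ n)) (free′ : Fin n → Bool)
      (sub : ∀ i → free′ i ≡ true → free P i ≡ true)
      (bounded′ : ∀ l → Σ Carrier λ b → Pos b × (∀ p → Holds (D ∧ᶠ φ) (at P l p) →
        ∀ i → free′ i ≡ false → Pos (b ⊕ p i) × Pos (b ⊕ ⊝ p i)))
      (indep : ∀ l p q → Holds D (at P l p) → Holds D (at P l q) → AgreeOff free′ p q →
        evalB φ (at P l p) ≡ evalB φ (at P l q)) where

      private
        agree-sub : ∀ {p q} → AgreeOff free′ p q → AgreeOff (free P) p q
        agree-sub ag i e = ag i (BoolP.¬-not λ e′ → true≢false (sub i e′) e)

      -- Serves two purposes: restriction to a condition on the bounded coordinates, and the passage
      -- of a coordinate from free to bounded once the condition bounds it.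
      subpiece : Piece (D ∧ᶠ φ)
      subpiece = record
        { fwd = fwd P ; bwd = bwd P ; free = free′ ; fwd-bwd = fwd-bwd P
        ; onto = λ l x h → onto P l x (proj₁ (Holds-∧⁻ D φ h))
        ; nonneg = λ l p h i e → nonneg P l p (proj₁ (Holds-∧⁻ D φ h)) i (sub i e)
        ; bounded = bounded′
        ; saturated = λ l p q h ag q≥0 →
            let hD , hφ = Holds-∧⁻ D φ h
                hq = saturated P l p q hD (agree-sub ag) (q-nonneg l p q hD ag q≥0)
            in Holds-∧⁺ D φ hq (trans (sym (indep l p q hD hq ag)) hφ)
        ; residue = residue P ; residue≤ = residue≤ P
        ; residual = λ l x h → residual P l x (proj₁ (Holds-∧⁻ D φ h)) }
        where
        -- A coordinate that has just ceased to be free is the same for p and q, and for p it is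
        -- nonnegative.
        q-nonneg : ∀ l p q → Holds D (at P l p) → AgreeOff free′ p q →
          (∀ i → free′ i ≡ true → Pos (q i)) → ∀ i → free P i ≡ true → Pos (q i)
        q-nonneg l p q hD ag q≥0 i e with free′ i in e′
        ... | true  = q≥0 i e′
        ... | false = Pos-≡ (ag i e′) (nonneg P l p hD i e)

      subpiece-⊑ : subpiece ⊑ P
      subpiece-⊑ ψ ind l p q hp hq ag =
        ind l p q (proj₁ (Holds-∧⁻ D φ hp)) (proj₁ (Holds-∧⁻ D φ hq)) (agree-sub ag)

    bounded-∧ : ∀ {D} (P : Piece D) φ l → Σ Carrier λ b → Pos b × (∀ p → Holds (D ∧ᶠ φ) (at P l p) →
      ∀ i → free P i ≡ false → Pos (b ⊕ p i) × Pos (b ⊕ ⊝ p i))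
    bounded-∧ {D} P φ l = let b , b≥0 , f = bounded P l in
      b , b≥0 , λ p h → f p (proj₁ (Holds-∧⁻ D φ h))

    restrict : ∀ {D} (P : Piece D) φ → Indep P φ → Piece (D ∧ᶠ φ)
    restrict P φ ind = subpiece P φ (free P) (λ i e → e) (bounded-∧ P φ) ind

    restrict-⊑ : ∀ {D} (P : Piece D) φ (ind : Indep P φ) → restrict P φ ind ⊑ P
    restrict-⊑ P φ ind = subpiece-⊑ P φ (free P) (λ i e → e) (bounded-∧ P φ) ind

    Indep-¬ : ∀ {D} (P : Piece D) φ → Indep P φ → Indep P (¬ᶠ φ)
    Indep-¬ P φ ind l p q hp hq ag =
      trans (evalB-¬ φ _) (trans (ap not (ind l p q hp hq ag)) (sym (evalB-¬ φ _)))

    -- The change of coordinates p i ↦ p i − E p, on the part where this is nonnegative.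
    module _ {D} (P : Piece D) (i : Fin n) (i-free : free P i ≡ true)
      (E : Lin (m ℕ.+ n)) (E-i : slope E i ≡ + 0) (φ : QF (m ℕ.+ n))
      (φ-spec : ∀ l p → Holds D (at P l p) → evalB φ (at P l p) ≡ posB (p i ⊕ ⊝ eval E (l ⋆ p)))
      (E≥0 : ∀ l p q → Holds D (at P l p) → AgreeOff (free P) p q →
        (∀ j → free P j ≡ true → Pos (q j)) → Pos (eval E (l ⋆ q))) where

      private
        move : Carrier → Vector Carrier n → Vector Carrier n
        move d p k = p k ⊕ δ i k ⊛ d

        unshear : Vector Carrier m → Vector Carrier n → Vector Carrier n
        unshear l p = move (eval E (l ⋆ p)) p

        move-at : ∀ d p → move d p i ≡ p i ⊕ d
        move-at d p = ap (λ e → p i ⊕ e) (trans (ap (λ a → a ⊛ d) (δ-refl i)) (1⊛ d))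

        move-off : ∀ d p k → i ≢ k → move d p k ≡ p k
        move-off d p k i≢k = trans (ap (λ e → p k ⊕ e) (trans (ap (λ a → a ⊛ d) (δ-≢ i≢k)) (0⊛ d)))
          (⊕-identityʳ _)

        eval-move : ∀ L l d p → eval L (l ⋆ move d p) ≡ eval L (l ⋆ p) ⊕ slope L i ⊛ d
        eval-move L l d p = eval-update L (m ↑ʳ i) d
          (trans (⋆ʳ l (move d p) i) (trans (move-at d p) (ap (λ e → e ⊕ d) (sym (⋆ʳ l p i)))))
          (split-elim _
            (λ j _ → trans (⋆ˡ l _ j) (sym (⋆ˡ l p j)))
            (λ k i≢k → trans (⋆ʳ l _ k) (trans (move-off d p k λ { refl → i≢k refl }) (sym (⋆ʳ l p k)))))

        -- E does not involve p i, so it has the same value in the old and the new coordinates; this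
        -- makes the change invertible.
        E-move : ∀ l d p → eval E (l ⋆ move d p) ≡ eval E (l ⋆ p)
        E-move l d p = trans (eval-move E l d p)
          (trans (ap (λ e → eval E (l ⋆ p) ⊕ e) (trans (ap (λ a → a ⊛ d) E-i) (0⊛ d))) (⊕-identityʳ _))

        bwd′ : Fin n → Lin (m ℕ.+ n)
        bwd′ k = bwd P k +ᴸ slope (bwd P k) i *ᴸ E

        -- The inverse subtracts E, expressed in x with the denominator suc N; as E has integral
        -- coefficients, the denominator does not grow.
        fwd′ : Fin n → Lin (m ℕ.+ n)
        fwd′ k = fwd P k +ᴸ (ℤ.- δ i k) *ᴸ subᴸ (+ suc N) (scaled (fwd P)) E

      eval-sheared : ∀ L l p → eval (L +ᴸ slope L i *ᴸ E) (l ⋆ p) ≡ eval L (l ⋆ unshear l p)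
      eval-sheared L l p = trans (eval-+ L (slope L i *ᴸ E) (l ⋆ p))
        (trans (ap (λ e → eval L (l ⋆ p) ⊕ e) (eval-* (slope L i) E (l ⋆ p)))
          (sym (eval-move L l _ p)))

      private
        image′ : ∀ l p k → image bwd′ l p k ≡ image (bwd P) l (unshear l p) k
        image′ l p k = eval-sheared (bwd P k) l p

        point′ : ∀ l p k → point bwd′ l p k ≡ at P l (unshear l p) k
        point′ l p = ⋆-cong l (image′ l p)

        down : ∀ {l p} → Holds (D ∧ᶠ φ) (point bwd′ l p) →
          Holds D (at P l (unshear l p)) × Holds φ (at P l (unshear l p))
        down {l} {p} h = let hD , hφ = Holds-∧⁻ D φ h in
          trans (sym (evalB-cong D (point′ l p))) hD , trans (sym (evalB-cong φ (point′ l p))) hφ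

        unshear-nonfree : ∀ l p k → free P k ≡ false → unshear l p k ≡ p k
        unshear-nonfree l p k e = move-off _ p k λ { refl → true≢false i-free e }

        unshear-φ : ∀ l p → Holds D (at P l (unshear l p)) → evalB φ (at P l (unshear l p)) ≡ posB (p i)
        unshear-φ l p h = trans (φ-spec l (unshear l p) h) (ap posB (begin
          unshear l p i ⊕ ⊝ eval E (l ⋆ unshear l p)
            ≡⟨ cong₂ (λ e f → e ⊕ ⊝ f) (move-at _ p) (E-move l _ p) ⟩
          (p i ⊕ eval E (l ⋆ p)) ⊕ ⊝ eval E (l ⋆ p)
            ≡⟨ linear (p i ∷ eval E (l ⋆ p) ∷ []) ((v₀ :+ v₁) :+ :- v₁) v₀ refl ⟩
          p i ∎))
          where open ≡-Reasoning

        fwd-bwd′ : ∀ l p k → eval (fwd′ k) (point bwd′ l p) ≡ + suc N ⊛ p k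
        fwd-bwd′ l p k = begin
          eval (fwd′ k) (point bwd′ l p)
            ≡⟨ eval-cong (fwd′ k) (point′ l p) ⟩
          eval (fwd′ k) (at P l u)
            ≡⟨ eval-+ (fwd P k) _ (at P l u) ⟩
          eval (fwd P k) (at P l u) ⊕ eval ((ℤ.- δ i k) *ᴸ subᴸ (+ suc N) (scaled (fwd P)) E) (at P l u)
            ≡⟨ cong₂ _⊕_ (fwd-bwd P l u k) (trans (eval-* (ℤ.- δ i k) _ (at P l u))
                 (ap (λ e → (ℤ.- δ i k) ⊛ e) (trans (eval-sub (+ suc N) (scaled (fwd P)) E (scaled-at P l u)) (ap (λ e → + suc N ⊛ e) (E-move l d p))))) ⟩
          + suc N ⊛ u k ⊕ (ℤ.- δ i k) ⊛ + suc N ⊛ d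
            ≡⟨ cong₂ _⊕_ (⊛-distribˡ (+ suc N) (p k) _) swap ⟩
          (+ suc N ⊛ p k ⊕ + suc N ⊛ δ i k ⊛ d) ⊕ ⊝ (+ suc N ⊛ δ i k ⊛ d)
            ≡⟨ linear (+ suc N ⊛ p k ∷ + suc N ⊛ δ i k ⊛ d ∷ []) ((v₀ :+ v₁) :+ :- v₁) v₀ refl ⟩
          + suc N ⊛ p k ∎
          where
          open ≡-Reasoning
          d = eval E (l ⋆ p)
          u = unshear l p
          swap : (ℤ.- δ i k) ⊛ + suc N ⊛ d ≡ ⊝ (+ suc N ⊛ δ i k ⊛ d)
          swap = begin
            (ℤ.- δ i k) ⊛ + suc N ⊛ d       ≡⟨ ⊛-assoc (ℤ.- δ i k) (+ suc N) d ⟨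
            (ℤ.- δ i k ℤ.* + suc N) ⊛ d     ≡⟨ ap (λ a → a ⊛ d) (ints (δ i k) (+ suc N)) ⟩
            (-[1+ 0 ] ℤ.* (+ suc N ℤ.* δ i k)) ⊛ d
                                            ≡⟨ ⊛-assoc -[1+ 0 ] (+ suc N ℤ.* δ i k) d ⟩
            -[1+ 0 ] ⊛ (+ suc N ℤ.* δ i k) ⊛ d
                                            ≡⟨ -1⊛ _ ⟩
            ⊝ ((+ suc N ℤ.* δ i k) ⊛ d)     ≡⟨ ap ⊝_ (⊛-assoc (+ suc N) (δ i k) d) ⟩
            ⊝ (+ suc N ⊛ δ i k ⊛ d)         ∎
            where
            ints : ∀ a b → (ℤ.- a) ℤ.* b ≡ -[1+ 0 ] ℤ.* (b ℤ.* a)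
            ints = solve-∀

        onto′ : ∀ l x → Holds (D ∧ᶠ φ) (l ⋆ x) → Σ (Vector Carrier n) λ p → ∀ k → x k ≡ image bwd′ l p k
        onto′ l x h with onto P l x (proj₁ (Holds-∧⁻ D φ h))
        ... | p , eq = move (⊝ d) p , λ k → trans (eq k) (sym (trans (image′ l (move (⊝ d) p) k)
            (eval-cong (bwd P k) (⋆-cong l back))))
          where
          d = eval E (l ⋆ p)
          back : ∀ k → unshear l (move (⊝ d) p) k ≡ p k
          back k = trans (ap (λ e → (p k ⊕ δ i k ⊛ ⊝ d) ⊕ δ i k ⊛ e) (E-move l (⊝ d) p))
            (trans (ap (λ e → (p k ⊕ e) ⊕ δ i k ⊛ d) (⊛-⊝ (δ i k) d))
              (linear (p k ∷ δ i k ⊛ d ∷ []) ((v₀ :+ :- v₁) :+ v₁) v₀ refl))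

        nonneg′ : ∀ l p → Holds (D ∧ᶠ φ) (point bwd′ l p) → ∀ k → free P k ≡ true → Pos (p k)
        nonneg′ l p h k e with down {l} {p} h | i Fin.≟ k
        ... | hD , hφ | yes refl = posB⇒Pos (trans (sym (unshear-φ l p hD)) hφ)
        ... | hD , hφ | no i≢k = Pos-≡ (move-off _ p k i≢k) (nonneg P l (unshear l p) hD k e)

      shear : Piece (D ∧ᶠ φ)
      shear = record
        { fwd = fwd′ ; bwd = bwd′ ; free = free P
        ; fwd-bwd = fwd-bwd′ ; onto = onto′ ; nonneg = nonneg′
        ; bounded = λ l → let b , b≥0 , f = bounded P l in b , b≥0 , λ p h k e →
            subst (λ x → Pos (b ⊕ x) × Pos (b ⊕ ⊝ x)) (unshear-nonfree l p k e)
              (f (unshear l p) (proj₁ (down {l} {p} h)) k e)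
        ; saturated = saturated′
        ; residue = residue P ; residue≤ = residue≤ P
        ; residual = λ l x h → residual P l x (proj₁ (Holds-∧⁻ D φ h)) }
        where
        saturated′ : ∀ l p q → Holds (D ∧ᶠ φ) (point bwd′ l p) → AgreeOff (free P) p q →
          (∀ k → free P k ≡ true → Pos (q k)) → Holds (D ∧ᶠ φ) (point bwd′ l q)
        saturated′ l p q h ag q≥0 = Holds-∧⁺ D φ
          (trans (evalB-cong D (point′ l q)) hq)
          (trans (evalB-cong φ (point′ l q)) (trans (unshear-φ l q hq) (posB-true (q≥0 i i-free))))
          where
          u : Vector Carrier n
          u = unshear l p
          hD : Holds D (at P l u)
          hD = proj₁ (down {l} {p} h)
          agree : ∀ {r} → (∀ k → free P k ≡ false → r k ≡ q k) → AgreeOff (free P) u r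
          agree r k e = trans (unshear-nonfree l p k e) (trans (ag k e) (sym (r k e)))
          -- The old coordinate is q i + E, so E ≥ 0 is what makes the whole new orthant land in the
          -- old one.
          uq≥0 : ∀ k → free P k ≡ true → Pos (unshear l q k)
          uq≥0 k e with i Fin.≟ k
          ... | yes refl = Pos-≡ (sym (move-at _ q)) (Pos-⊕ (q≥0 i i-free) (E≥0 l u q hD (agree λ _ _ → refl) q≥0))
          ... | no i≢k = Pos-≡ (sym (move-off _ q k i≢k)) (q≥0 k e)
          hq : Holds D (at P l (unshear l q))
          hq = saturated P l u (unshear l q) hD (agree (unshear-nonfree l q)) uq≥0

      shear-⊑ : shear ⊑ P
      shear-⊑ ψ ind l p q hp hq ag = trans (evalB-cong ψ (point′ l p))
        (trans (ind l (unshear l p) (unshear l q) (proj₁ (down {l} {p} hp)) (proj₁ (down {l} {q} hq))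
          λ k e → trans (unshear-nonfree l p k e) (trans (ag k e) (sym (unshear-nonfree l q k e))))
          (sym (evalB-cong ψ (point′ l q))))

      shear-tracks : ∀ {L K} → Tracks P L K → Tracks shear L (K +ᴸ slope K i *ᴸ E)
      shear-tracks {L} {K} tr l p = trans (eval-cong L (point′ l p))
        (trans (tr l (unshear l p)) (sym (eval-sheared K l p)))

-- Refinement until a formula depends on the bounded coordinates only

fin-bound : ∀ {n} (f : Fin n → ℕ) → Σ ℕ λ b → ∀ i → f i ℕ.≤ b
fin-bound {zero}  f = 0 , λ ()
fin-bound {suc n} f with fin-bound (λ i → f (suc i))
... | b , f≤b = f zero ℕ.+ b , λ { zero → ℕP.m≤m+n (f zero) b ; (suc i) → ℕP.m≤n⇒m≤o+n (f zero) (f≤b i) }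

i≤∣i∣ : ∀ i → i ℤ.≤ + ℤ.∣ i ∣
i≤∣i∣ (+ n)    = ℤP.≤-refl
i≤∣i∣ -[1+ n ] = ℤ.-≤+

≤⇒<⊎≡ : ∀ {i j} → i ℤ.≤ j → i ℤ.< j ⊎ i ≡ j
≤⇒<⊎≡ {i} {j} i≤j with i ℤP.≟ j
... | yes eq = inj₂ eq
... | no neq = inj₁ (ℤP.≤∧≢⇒< i≤j neq)

<suc⇒≤ : ∀ {i n} → i ℤ.< + suc n → i ℤ.≤ + n
<suc⇒≤ {+ i}      (ℤ.+<+ (s≤s p)) = ℤ.+≤+ p
<suc⇒≤ { -[1+ i ]} p = ℤ.-≤+

-suc<⇒≤ : ∀ {n i} → ℤ.- + suc n ℤ.< i → ℤ.- + n ℤ.≤ i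
-suc<⇒≤ {n = zero}  {i = + i}      p = ℤ.+≤+ z≤n
-suc<⇒≤ {n = zero}  {i = -[1+ i ]} (ℤ.-<- ())
-suc<⇒≤ {n = suc n} {i = + i}      p = ℤ.-≤+
-suc<⇒≤ {n = suc n} {i = -[1+ i ]} (ℤ.-<- (s≤s p)) = ℤ.-≤- p

module Refinement (G : ZGroup) where
  open Pieces G public

  -- The procedure grows a binary tree of cuts. It is kept generic in the property `R` to be shown
  -- of a domain; `node` joins the two sides of a cut.
  module Refine (m n N : ℕ) (R : QF (m ℕ.+ n) → Set₁)
    (node : ∀ D c → R (D ∧ᶠ c) → R (D ∧ᶠ ¬ᶠ c) → R D) where
    open Charts m n N public

    -- A continuation, because the number and shape of the final pieces emerge only during the
    -- recursion.
    Cont : ∀ {D} → Piece D → QF (m ℕ.+ n) → Set₁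
    Cont P φ = ∀ {D′} (P′ : Piece D′) → P′ ⊑ P → Indep P′ φ → R D′

    via : ∀ {D D₁} (P : Piece D) (P₁ : Piece D₁) φ → P₁ ⊑ P → Cont P φ → Cont P₁ φ
    via P P₁ φ P₁⊑P k P′ P′⊑P₁ ind = k P′ (λ ψ i → P′⊑P₁ ψ (P₁⊑P ψ i)) ind

    ge-condition : ∀ {D} {P : Piece D} {L K} → Tracks P L K → ∀ l p →
      evalB (ge L) (at P l p) ≡ posB (eval K (l ⋆ p))
    ge-condition tr l p = ap posB (tr l p)

    eval-agree : ∀ {D} (P : Piece D) K → (∀ i → free P i ≡ true → slope K i ≡ + 0) →
      ∀ l p q → AgreeOff (free P) p q → eval K (l ⋆ p) ≡ eval K (l ⋆ q)
    eval-agree P K K-free l p q ag = eval-pointwise K (split-elim _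
      (λ j → ap (λ e → coef K (j ↑ˡ n) ⊛ e) (trans (⋆ˡ l p j) (sym (⋆ˡ l q j))))
      (λ i → trans (ap (λ e → slope K i ⊛ e) (⋆ʳ l p i))
        (trans (onFree i (free P i) refl) (ap (λ e → slope K i ⊛ e) (sym (⋆ʳ l q i))))))
      where
      onFree : ∀ i b → free P i ≡ b → slope K i ⊛ p i ≡ slope K i ⊛ q i
      onFree i true  e = trans (ap (λ a → a ⊛ p i) (K-free i e))
        (trans (trans (0⊛ (p i)) (sym (0⊛ (q i)))) (ap (λ a → a ⊛ q i) (sym (K-free i e))))
      onFree i false e = ap (λ x → slope K i ⊛ x) (ag i e)

    -- The β of the overview: K with the free coordinates set to 0.
    base : (Fin n → Bool) → Lin (m ℕ.+ n) → Lin (m ℕ.+ n)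
    base free K = lin ((λ j → coef K (j ↑ˡ n)) VF.++ λ i → if free i then + 0 else slope K i) (const K)

    base-ˡ : ∀ f K j → coef (base f K) (j ↑ˡ n) ≡ coef K (j ↑ˡ n)
    base-ˡ f K j = VFP.lookup-++ˡ (λ j → coef K (j ↑ˡ n)) _ j

    base-ʳ : ∀ f K i → slope (base f K) i ≡ (if f i then + 0 else slope K i)
    base-ʳ f K i = VFP.lookup-++ʳ (λ j → coef K (j ↑ˡ n)) _ i

    base-free : ∀ f K i → f i ≡ true → slope (base f K) i ≡ + 0
    base-free f K i e = trans (base-ʳ f K i) (ap (λ b → if b then + 0 else slope K i) e)

    base-nonfree : ∀ f K i → f i ≡ false → slope (base f K) i ≡ slope K i
    base-nonfree f K i e = trans (base-ʳ f K i) (ap (λ b → if b then + 0 else slope K i) e)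

    a+-1*a≡0 : ∀ a → a ℤ.+ -[1+ 0 ] ℤ.* a ≡ + 0
    a+-1*a≡0 = solve-∀

    Pos-eval-free : ∀ {D} (P : Piece D) M → const M ≡ + 0 → (∀ j → coef M (j ↑ˡ n) ≡ + 0) →
      (∀ i → free P i ≡ false → slope M i ≡ + 0) → (∀ i → free P i ≡ true → + 0 ℤ.≤ slope M i) →
      ∀ l p → (∀ i → free P i ≡ true → Pos (p i)) → Pos (eval M (l ⋆ p))
    Pos-eval-free P M c≡0 l≡0 nf≡0 f≥0 l p p≥0 = Pos-eval M c≡0 (split-elim _
      (λ j → Pos-≡ (sym (trans (ap (λ a → a ⊛ (l ⋆ p) (j ↑ˡ n)) (l≡0 j)) (0⊛ _))) 0≼0)
      (λ i → Pos-≡ (ap (λ e → slope M i ⊛ e) (sym (⋆ʳ l p i))) (term i (free P i) refl)))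
      where
      term : ∀ i b → free P i ≡ b → Pos (slope M i ⊛ p i)
      term i true  e = Pos-⊛⁺ (f≥0 i e) (p≥0 i e)
      term i false e = Pos-≡ (sym (trans (ap (λ a → a ⊛ p i) (nf≡0 i e)) (0⊛ _))) 0≼0

    -- The sum Σ aₖ pₖ over the free coordinates alone.
    excess : (Fin n → Bool) → Lin (m ℕ.+ n) → Lin (m ℕ.+ n)
    excess f K = K +ᴸ -[1+ 0 ] *ᴸ base f K

    excess-free : ∀ f K i → f i ≡ true → slope (excess f K) i ≡ slope K i
    excess-free f K i e = trans (ap (λ a → slope K i ℤ.+ -[1+ 0 ] ℤ.* a) (base-free f K i e))
      (ℤP.+-identityʳ _)

    excess-nonfree : ∀ f K i → f i ≡ false → slope (excess f K) i ≡ + 0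
    excess-nonfree f K i e = trans (ap (λ a → slope K i ℤ.+ -[1+ 0 ] ℤ.* a) (base-nonfree f K i e))
      (a+-1*a≡0 (slope K i))

    excess-ˡ : ∀ f K j → coef (excess f K) (j ↑ˡ n) ≡ + 0
    excess-ˡ f K j = trans (ap (λ a → coef K (j ↑ˡ n) ℤ.+ -[1+ 0 ] ℤ.* a) (base-ˡ f K j))
      (a+-1*a≡0 (coef K (j ↑ˡ n)))

    eval-excess : ∀ f K ρ → eval K ρ ≡ eval (base f K) ρ ⊕ eval (excess f K) ρ
    eval-excess f K ρ = trans
      (linear (eval K ρ ∷ eval (base f K) ρ ∷ []) v₀ (v₁ :+ (v₀ :+ -[1+ 0 ] :* v₁)) refl)
      (ap (λ e → eval (base f K) ρ ⊕ e)
        (sym (trans (eval-+ K (-[1+ 0 ] *ᴸ base f K) ρ) (ap (λ e → eval K ρ ⊕ e) (eval-* -[1+ 0 ] (base f K) ρ)))))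

    Nonneg-slopes : ∀ {D} → Piece D → Lin (m ℕ.+ n) → Set
    Nonneg-slopes P K = ∀ i → free P i ≡ true → + 0 ℤ.≤ slope K i

    K≥base : ∀ {D} (P : Piece D) K → Nonneg-slopes P K → ∀ l p → Holds D (at P l p) →
      Pos (eval (base (free P) K) (l ⋆ p)) → Pos (eval K (l ⋆ p))
    K≥base P K K≥0 l p h b≥0 = Pos-≡ (sym (eval-excess (free P) K (l ⋆ p))) (Pos-⊕ b≥0
      (Pos-eval-free P (excess (free P) K) (a+-1*a≡0 (const K)) (excess-ˡ (free P) K) (excess-nonfree (free P) K)
        (λ i e → subst (λ a → + 0 ℤ.≤ a) (sym (excess-free (free P) K i e)) (K≥0 i e)) l p (nonneg P l p h)))

    module _ (f : Fin n → Bool) (K : Lin (m ℕ.+ n)) (i : Fin n) where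

      -- Σ aₖ pₖ - pᵢ, whose slopes are still nonnegative when the aₖ are and aᵢ ≥ 1.
      surplus : Lin (m ℕ.+ n)
      surplus = excess f K +ᴸ -[1+ 0 ] *ᴸ varᴸ (m ↑ʳ i)

      slope-surplus : ∀ k → slope surplus k ≡ slope (excess f K) k ℤ.+ -[1+ 0 ] ℤ.* δ i k
      slope-surplus k = ap (λ a → slope (excess f K) k ℤ.+ -[1+ 0 ] ℤ.* a) (δ-↑ʳ m i k)

      surplus-ˡ : ∀ j → coef surplus (j ↑ˡ n) ≡ + 0
      surplus-ˡ j = cong₂ (λ a b → a ℤ.+ -[1+ 0 ] ℤ.* b) (excess-ˡ f K j) (δ-↑ʳ-↑ˡ i j)

      eval-surplus : ∀ l p → eval (base f K) (l ⋆ p) ⊕ p i ⊕ eval surplus (l ⋆ p) ≡ eval K (l ⋆ p)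
      eval-surplus l p = begin
        eval (base f K) ρ ⊕ p i ⊕ eval surplus ρ
          ≡⟨ ap (λ e → eval (base f K) ρ ⊕ p i ⊕ e) (trans (eval-+ (excess f K) _ ρ)
               (ap (λ e → eval (excess f K) ρ ⊕ e) (trans (eval-* -[1+ 0 ] (varᴸ (m ↑ʳ i)) ρ)
                 (ap (λ e → -[1+ 0 ] ⊛ e) (trans (eval-var (m ↑ʳ i) ρ) (⋆ʳ l p i)))))) ⟩
        eval (base f K) ρ ⊕ p i ⊕ (eval (excess f K) ρ ⊕ -[1+ 0 ] ⊛ p i)
          ≡⟨ linear (eval (base f K) ρ ∷ p i ∷ eval (excess f K) ρ ∷ [])
               (v₀ :+ v₁ :+ (v₂ :+ -[1+ 0 ] :* v₁)) (v₀ :+ v₂) refl ⟩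
        eval (base f K) ρ ⊕ eval (excess f K) ρ
          ≡⟨ eval-excess f K ρ ⟨
        eval K ρ ∎
        where
        open ≡-Reasoning
        ρ = l ⋆ p

    -- A nonnegative nonzero integer slope is at least 1, hence K ≥ β + pᵢ on the piece.
    K≥base+ : ∀ {D} (P : Piece D) K → Nonneg-slopes P K → ∀ i → free P i ≡ true → slope K i ≢ + 0 →
      ∀ l p → Holds D (at P l p) → Pos (eval (base (free P) K) (l ⋆ p) ⊕ p i) → Pos (eval K (l ⋆ p))
    K≥base+ P K K≥0 i i-free Ki≢0 l p h b≥0 = Pos-≡ (eval-surplus f K i l p) (Pos-⊕ b≥0
      (Pos-eval-free P (surplus f K i) const≡0 (surplus-ˡ f K i)
        (λ k e → trans (slope-surplus f K i k) (cong₂ (λ a b → a ℤ.+ -[1+ 0 ] ℤ.* b)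
          (excess-nonfree f K k e) (δ-≢ {i = i} {k} λ { refl → true≢false i-free e })))
        (λ k e → subst (λ a → + 0 ℤ.≤ a)
          (sym (trans (slope-surplus f K i k)
            (ap (λ a → a ℤ.+ -[1+ 0 ] ℤ.* δ i k) (excess-free f K k e)))) (slope≥0 k e (i Fin.≟ k)))
        l p (nonneg P l p h)))
      where
      f = free P
      const≡0 : const K ℤ.+ -[1+ 0 ] ℤ.* const K ℤ.+ + 0 ≡ + 0
      const≡0 = trans (ℤP.+-identityʳ _) (a+-1*a≡0 (const K))
      minus1 : ∀ {a} → + 0 ℤ.≤ a → a ≢ + 0 → + 0 ℤ.≤ a ℤ.+ -[1+ 0 ]
      minus1 {+ zero}  _ a≢0 = ⊥-elim (a≢0 refl)
      minus1 {+ suc a} _ a≢0 = ℤ.+≤+ z≤n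
      slope≥0 : ∀ k → free P k ≡ true → Dec (i ≡ k) → + 0 ℤ.≤ slope K k ℤ.+ -[1+ 0 ] ℤ.* δ i k
      slope≥0 k e (yes refl) = subst (λ a → + 0 ℤ.≤ slope K i ℤ.+ -[1+ 0 ] ℤ.* a) (sym (δ-refl i))
        (minus1 (K≥0 i e) Ki≢0)
      slope≥0 k e (no i≢k) = subst (λ a → + 0 ℤ.≤ slope K k ℤ.+ -[1+ 0 ] ℤ.* a) (sym (δ-≢ i≢k))
        (subst (λ a → + 0 ℤ.≤ a) (sym (ℤP.+-identityʳ _)) (K≥0 k e))

    base-agree : ∀ {D} (P : Piece D) K l p q → AgreeOff (free P) p q →
      eval (base (free P) K) (l ⋆ p) ≡ eval (base (free P) K) (l ⋆ q)
    base-agree P K = eval-agree P (base (free P) K) (base-free (free P) K)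

    -- For fixed l the constant and the parameters contribute fixed elements of `G`, free
    -- coordinates contribute 0, and the others are bounded; the separate bounds are added up.
    lower-bound : ∀ {D} (P : Piece D) K → (∀ i → free P i ≡ true → slope K i ≡ + 0) → ∀ l →
      Σ Carrier λ c → Pos c × (∀ p → Holds D (at P l p) → Pos (c ⊕ eval K (l ⋆ p)))
    lower-bound {D} P K K-free l =
      proj₁ constant ⊕ ∑ bound , Pos-⊕ (proj₁ (proj₂ constant)) (Pos-∑ bound λ k → proj₁ (proj₂ (coordinate k))) ,
      λ p h → Pos-≡ (begin
        (proj₁ constant ⊕ const K ⊛ oneC) ⊕ ∑ (λ k → bound k ⊕ coef K k ⊛ (l ⋆ p) k)
          ≡⟨ ap (λ e → (proj₁ constant ⊕ const K ⊛ oneC) ⊕ e) (∑-⊕ bound (λ k → coef K k ⊛ (l ⋆ p) k)) ⟩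
        (proj₁ constant ⊕ const K ⊛ oneC) ⊕ (∑ bound ⊕ ∑ (λ k → coef K k ⊛ (l ⋆ p) k))
          ≡⟨ ⊕-interchange _ _ _ _ ⟩
        (proj₁ constant ⊕ ∑ bound) ⊕ eval K (l ⋆ p) ∎)
        (Pos-⊕ (proj₂ (proj₂ constant)) (Pos-∑ (λ k → bound k ⊕ coef K k ⊛ (l ⋆ p) k)
          λ k → proj₂ (proj₂ (coordinate k)) p h))
      where
      open ≡-Reasoning
      absolute : ∀ x → Σ Carrier λ c → Pos c × Pos (c ⊕ x)
      absolute x with pos⊎neg x
      ... | inj₁ p = zeroC , 0≼0 , Pos-≡ (sym (⊕-identityˡ x)) p
      ... | inj₂ p = ⊝ x , Pos-≡ (linear (x ∷ []) ((:- v₀ :+ :- :1) :+ :1) (:- v₀) refl) (Pos-⊕ p 0≼1) ,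
                     Pos-≡ (sym (⊝-inverseˡ x)) 0≼0
      constant = absolute (const K ⊛ oneC)
      Bound : Fin (m ℕ.+ n) → Set
      Bound k = Σ Carrier λ c → Pos c × (∀ p → Holds D (at P l p) → Pos (c ⊕ coef K k ⊛ (l ⋆ p) k))
      multiple : ∀ a b x → Pos (b ⊕ x) → Pos (b ⊕ ⊝ x) → Pos (+ ℤ.∣ a ∣ ⊛ b ⊕ a ⊛ x)
      multiple (+ c)    b x p q = Pos-≡ (⊛-distribˡ (+ c) b x) (Pos-⊛ c p)
      multiple -[1+ c ] b x p q = Pos-≡ (trans (⊛-distribˡ (+ suc c) b (⊝ x))
        (ap (λ e → + suc c ⊛ b ⊕ e) (begin
          + suc c ⊛ ⊝ x                ≡⟨ ⊛-⊝ (+ suc c) x ⟩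
          ⊝ (+ suc c ⊛ x)              ≡⟨ -1⊛ _ ⟨
          -[1+ 0 ] ⊛ + suc c ⊛ x       ≡⟨ ⊛-assoc -[1+ 0 ] (+ suc c) x ⟨
          (-[1+ 0 ] ℤ.* + suc c) ⊛ x   ≡⟨ ap (λ a → a ⊛ x) (ℤP.-1*i≡-i (+ suc c)) ⟩
          -[1+ c ] ⊛ x                 ∎))) (Pos-⊛ (suc c) q)
      onFree : ∀ i b → free P i ≡ b → Bound (m ↑ʳ i)
      onFree i true e = zeroC , 0≼0 , λ p _ → Pos-≡ (sym (trans (⊕-identityˡ _)
        (trans (ap (λ a → a ⊛ (l ⋆ p) (m ↑ʳ i)) (K-free i e)) (0⊛ _)))) 0≼0
      onFree i false e with bounded P l
      ... | b , b≥0 , f = + ℤ.∣ slope K i ∣ ⊛ b , Pos-⊛ ℤ.∣ slope K i ∣ b≥0 , λ p h →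
        Pos-≡ (ap (λ x → + ℤ.∣ slope K i ∣ ⊛ b ⊕ slope K i ⊛ x) (sym (⋆ʳ l p i)))
          (multiple (slope K i) b (p i) (proj₁ (f p h i e)) (proj₂ (f p h i e)))
      coordinate : ∀ k → Bound k
      coordinate = split-elim Bound
        (λ j → let c , c≥0 , q = absolute (coef K (j ↑ˡ n) ⊛ l j) in
          c , c≥0 , λ p _ → Pos-≡ (ap (λ x → c ⊕ coef K (j ↑ˡ n) ⊛ x) (sym (⋆ˡ l p j))) q)
        (λ i → onFree i (free P i) refl)
      bound : Fin (m ℕ.+ n) → Carrier
      bound k = proj₁ (coordinate k)

    _without_ : (Fin n → Bool) → Fin n → Fin n → Bool
    (f without i) k with i Fin.≟ k
    ... | yes _ = false
    ... | no _  = f k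

    without-sub : ∀ f i k → (f without i) k ≡ true → f k ≡ true
    without-sub f i k e with i Fin.≟ k
    ... | no _ = e

    without-≢ : ∀ f i k → (f without i) k ≡ true → i ≢ k
    without-≢ f i k e with i Fin.≟ k
    ... | no i≢k = i≢k

    without-false : ∀ f i k → (f without i) k ≡ false → i ≡ k ⊎ f k ≡ false
    without-false f i k e with i Fin.≟ k
    ... | yes i≡k = inj₁ i≡k
    ... | no _    = inj₂ e

    without-at : ∀ f i → (f without i) i ≡ false
    without-at f i with i Fin.≟ i
    ... | yes _ = refl
    ... | no i≢i = ⊥-elim (i≢i refl)

    -- β ≥ 0 on `P₁` and β + pᵢ ≥ 0 on `P₃`, either of which makes the atom true throughout; on `P₄`
    -- one has 0 ≤ pᵢ < -β, so pᵢ ceases to be free and the atom stays open.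
    module Step {D} (P : Piece D) (L K : Lin (m ℕ.+ n)) (tr : Tracks P L K) (K≥0 : Nonneg-slopes P K)
      (i : Fin n) (i-free : free P i ≡ true) (Ki≢0 : slope K i ≢ + 0) where

      private
        β : Lin (m ℕ.+ n)
        β = base (free P) K

        c₁ : QF (m ℕ.+ n)
        c₁ = condition P β

        c₁-indep : Indep P c₁
        c₁-indep l p q _ _ ag = trans (evalB-condition P β l p)
          (trans (ap posB (base-agree P K l p q ag)) (sym (evalB-condition P β l q)))

        ge-L : ∀ l p → Pos (eval K (l ⋆ p)) → Holds (ge L) (at P l p)
        ge-L l p K≥0 = trans (ge-condition {P = P} {L} {K} tr l p) (posB-true K≥0)

      P₁ : Piece (D ∧ᶠ c₁)
      P₁ = restrict P c₁ c₁-indep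

      P₁⊑P : P₁ ⊑ P
      P₁⊑P = restrict-⊑ P c₁ c₁-indep

      P₁-indep : Indep P₁ (ge L)
      P₁-indep = Indep-true P₁ (ge L) λ l x h →
        let p , eq , hp = onto-Holds P₁ l x h
            hD , hc = Holds-∧⁻ D c₁ hp
        in trans (evalB-cong (ge L) eq) (ge-L l p (K≥base P K K≥0 l p hD
             (posB⇒Pos (trans (sym (evalB-condition P β l p)) hc))))

      P₂ : Piece (D ∧ᶠ ¬ᶠ c₁)
      P₂ = restrict P (¬ᶠ c₁) (Indep-¬ P c₁ c₁-indep)

      P₂⊑P : P₂ ⊑ P
      P₂⊑P = restrict-⊑ P (¬ᶠ c₁) (Indep-¬ P c₁ c₁-indep)

      private
        β<0 : ∀ l p → Holds (D ∧ᶠ ¬ᶠ c₁) (at P l p) → Neg (eval β (l ⋆ p))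
        β<0 l p h = posB⇒Neg (trans (sym (evalB-condition P β l p))
          (Holds-¬⁻ c₁ (proj₂ (Holds-∧⁻ D (¬ᶠ c₁) h))))

        T : Lin (m ℕ.+ n)
        T = β +ᴸ varᴸ (m ↑ʳ i)

        eval-T : ∀ l p → eval T (l ⋆ p) ≡ eval β (l ⋆ p) ⊕ p i
        eval-T l p = trans (eval-+ β (varᴸ (m ↑ʳ i)) (l ⋆ p))
          (ap (λ e → eval β (l ⋆ p) ⊕ e) (trans (eval-var (m ↑ʳ i) (l ⋆ p)) (⋆ʳ l p i)))

        -- β is negative here, so E = -β is nonnegative; it contains no free coordinate, and the
        -- shear translates pᵢ by an amount fixed by λ and the bounded coordinates.
        E : Lin (m ℕ.+ n)
        E = -[1+ 0 ] *ᴸ β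

        eval-E : ∀ l p → eval E (l ⋆ p) ≡ ⊝ eval β (l ⋆ p)
        eval-E l p = trans (eval-* -[1+ 0 ] β (l ⋆ p)) (-1⊛ _)

        E-i : slope E i ≡ + 0
        E-i = ap (λ a → -[1+ 0 ] ℤ.* a) (base-free (free P) K i i-free)

      c₂ : QF (m ℕ.+ n)
      c₂ = condition P₂ T

      private
        c₂-spec : ∀ l p → Holds (D ∧ᶠ ¬ᶠ c₁) (at P₂ l p) →
          evalB c₂ (at P₂ l p) ≡ posB (p i ⊕ ⊝ eval E (l ⋆ p))
        c₂-spec l p _ = trans (evalB-condition P₂ T l p) (ap posB (trans (eval-T l p)
          (trans (linear (eval β (l ⋆ p) ∷ p i ∷ []) (v₀ :+ v₁) (v₁ :+ :- :- v₀) refl)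
            (ap (λ e → p i ⊕ ⊝ e) (sym (eval-E l p))))))

        E≥0 : ∀ l p q → Holds (D ∧ᶠ ¬ᶠ c₁) (at P₂ l p) → AgreeOff (free P) p q →
          (∀ j → free P j ≡ true → Pos (q j)) → Pos (eval E (l ⋆ q))
        E≥0 l p q h ag _ = Pos-≡ (trans
          (trans (linear (eval β (l ⋆ p) ∷ []) ((:- v₀ :+ :- :1) :+ :1) (:- v₀) refl)
            (ap ⊝_ (base-agree P K l p q ag))) (sym (eval-E l q)))
          (Pos-⊕ (β<0 l p h) 0≼1)

      P₃ : Piece ((D ∧ᶠ ¬ᶠ c₁) ∧ᶠ c₂)
      P₃ = shear P₂ i i-free E E-i c₂ c₂-spec E≥0

      P₃⊑P : P₃ ⊑ P
      P₃⊑P φ ind = shear-⊑ P₂ i i-free E E-i c₂ c₂-spec E≥0 φ (P₂⊑P φ ind)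

      P₃-indep : Indep P₃ (ge L)
      P₃-indep = Indep-true P₃ (ge L) λ l x h →
        let h₂ , hc = Holds-∧⁻ (D ∧ᶠ ¬ᶠ c₁) c₂ h
            p , eq , hp = onto-Holds P₂ l x h₂
        in trans (evalB-cong (ge L) eq) (ge-L l p (K≥base+ P K K≥0 i i-free Ki≢0 l p
             (proj₁ (Holds-∧⁻ D (¬ᶠ c₁) hp))
             (Pos-≡ (eval-T l p) (posB⇒Pos (trans (sym (evalB-condition P₂ T l p))
               (trans (sym (evalB-cong c₂ eq)) hc))))))

      private
        free′ : Fin n → Bool
        free′ = free P without i

        c₃-bounded : ∀ l → Σ Carrier λ b → Pos b × (∀ p → Holds ((D ∧ᶠ ¬ᶠ c₁) ∧ᶠ ¬ᶠ c₂) (at P₂ l p) →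
          ∀ k → free′ k ≡ false → Pos (b ⊕ p k) × Pos (b ⊕ ⊝ p k))
        c₃-bounded l = b ⊕ c , Pos-⊕ b≥0 c≥0 , λ p h k e →
          bounds p (proj₁ (Holds-∧⁻ (D ∧ᶠ ¬ᶠ c₁) (¬ᶠ c₂) h)) (proj₂ (Holds-∧⁻ (D ∧ᶠ ¬ᶠ c₁) (¬ᶠ c₂) h))
            k (without-false (free P) i k e)
          where
          b c : Carrier
          b = proj₁ (bounded P₂ l)
          c = proj₁ (lower-bound P₂ β (base-free (free P) K) l)
          b≥0 : Pos b
          b≥0 = proj₁ (proj₂ (bounded P₂ l))
          c≥0 : Pos c
          c≥0 = proj₁ (proj₂ (lower-bound P₂ β (base-free (free P) K) l))
          bounds : ∀ p → Holds (D ∧ᶠ ¬ᶠ c₁) (at P₂ l p) → Holds (¬ᶠ c₂) (at P₂ l p) →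
            ∀ k → i ≡ k ⊎ free P k ≡ false → Pos ((b ⊕ c) ⊕ p k) × Pos ((b ⊕ c) ⊕ ⊝ p k)
          bounds p h hc k (inj₂ k-nonfree) =
            Pos-≡ (linear (b ∷ c ∷ p k ∷ []) ((v₀ :+ v₂) :+ v₁) ((v₀ :+ v₁) :+ v₂) refl)
              (Pos-⊕ (proj₁ (proj₂ (proj₂ (bounded P₂ l)) p h k k-nonfree)) c≥0) ,
            Pos-≡ (linear (b ∷ c ∷ p k ∷ []) ((v₀ :+ :- v₂) :+ v₁) ((v₀ :+ v₁) :+ :- v₂) refl)
              (Pos-⊕ (proj₂ (proj₂ (proj₂ (bounded P₂ l)) p h k k-nonfree)) c≥0)
          bounds p h hc .i (inj₁ refl) =
            Pos-⊕ (Pos-⊕ b≥0 c≥0) (nonneg P₂ l p h i i-free) ,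
            -- b + c - pᵢ = b + (c + β) - (β + pᵢ), where c + β ≥ 0 by the choice of c and β + pᵢ <
            -- 0 by the case.
            Pos-≡ (linear (b ∷ c ∷ p i ∷ eval β (l ⋆ p) ∷ [])
                (v₀ :+ ((v₁ :+ v₃) :+ ((:- (v₃ :+ v₂) :+ :- :1) :+ :1))) ((v₀ :+ v₁) :+ :- v₂) refl)
              (Pos-⊕ b≥0 (Pos-⊕ (proj₂ (proj₂ (lower-bound P₂ β (base-free (free P) K) l)) p h)
                (Pos-⊕ T<0 0≼1)))
            where
            T<0 : Neg (eval β (l ⋆ p) ⊕ p i)
            T<0 = Pos-≡ (ap (λ e → ⊝ e ⊕ ⊝ oneC) (eval-T l p))
              (posB⇒Neg (trans (sym (evalB-condition P₂ T l p)) (Holds-¬⁻ c₂ hc)))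

        c₃-indep : ∀ l p q → Holds (D ∧ᶠ ¬ᶠ c₁) (at P₂ l p) → Holds (D ∧ᶠ ¬ᶠ c₁) (at P₂ l q) →
          AgreeOff free′ p q → evalB (¬ᶠ c₂) (at P₂ l p) ≡ evalB (¬ᶠ c₂) (at P₂ l q)
        c₃-indep l p q _ _ ag = trans (evalB-¬ c₂ _) (trans (ap not (begin
          evalB c₂ (at P₂ l p)            ≡⟨ evalB-condition P₂ T l p ⟩
          posB (eval T (l ⋆ p))           ≡⟨ ap posB (eval-T l p) ⟩
          posB (eval β (l ⋆ p) ⊕ p i)
            ≡⟨ cong₂ (λ e f → posB (e ⊕ f))
                 (base-agree P K l p q λ k e → ag k (BoolP.¬-not λ e′ → true≢false (without-sub (free P) i k e′) e))
                 (ag i (without-at (free P) i)) ⟩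
          posB (eval β (l ⋆ q) ⊕ q i)     ≡⟨ ap posB (eval-T l q) ⟨
          posB (eval T (l ⋆ q))           ≡⟨ evalB-condition P₂ T l q ⟨
          evalB c₂ (at P₂ l q)            ∎)) (sym (evalB-¬ c₂ _)))
          where open ≡-Reasoning

      P₄ : Piece ((D ∧ᶠ ¬ᶠ c₁) ∧ᶠ ¬ᶠ c₂)
      P₄ = subpiece P₂ (¬ᶠ c₂) free′ (without-sub (free P) i) c₃-bounded c₃-indep

      P₄⊑P : P₄ ⊑ P
      P₄⊑P φ ind = subpiece-⊑ P₂ (¬ᶠ c₂) free′ (without-sub (free P) i) c₃-bounded c₃-indep φ (P₂⊑P φ ind)

      step : Cont P (ge L) → R ((D ∧ᶠ ¬ᶠ c₁) ∧ᶠ ¬ᶠ c₂) → R D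
      step k r₄ = node D c₁ (k P₁ P₁⊑P P₁-indep) (node (D ∧ᶠ ¬ᶠ c₁) c₂ (k P₃ P₃⊑P P₃-indep) r₄)

    -- The list contains every free coordinate that K still involves. It loses one in the only
    -- branch where the atom stays open, and when it is empty K depends on bounded coordinates
    -- alone.
    refine⁺ : ∀ (is : List (Fin n)) {D} (P : Piece D) L K → Tracks P L K → Nonneg-slopes P K →
      (∀ i → free P i ≡ true → slope K i ≢ + 0 → i ∈ is) → Cont P (ge L) → R D
    refine⁺ [] P L K tr K≥0 support k = k P (λ _ ind → ind) λ l p q _ _ ag →
      trans (ge-condition {P = P} {L} {K} tr l p)
        (trans (ap posB (eval-agree P K K-free l p q ag)) (sym (ge-condition {P = P} {L} {K} tr l q)))
      where
      K-free : ∀ i → free P i ≡ true → slope K i ≡ + 0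
      K-free i e with slope K i ℤP.≟ + 0
      ... | yes eq = eq
      ... | no neq with support i e neq
      ...   | ()
    refine⁺ (i ∷ is) {D} P L K tr K≥0 support k = cases (free P i) refl (slope K i ℤP.≟ + 0)
      (λ notI → refine⁺ is P L K tr K≥0 (λ j e neq → drop j (notI j e neq) (support j e neq)) k)
      (λ i-free Ki≢0 → let open Step P L K tr K≥0 i i-free Ki≢0 in
        step k (refine⁺ is P₄ L K tr (λ j e → K≥0 j (without-sub (free P) i j e))
          (λ j e neq → drop j (λ j≡i → without-≢ (free P) i j e (sym j≡i))
            (support j (without-sub (free P) i j e) neq))
          (via P P₄ (ge L) P₄⊑P k)))
      where
      drop : ∀ j → ¬ (j ≡ i) → j ∈ i ∷ is → j ∈ is
      drop j j≢i (here j≡i)  = ⊥-elim (j≢i j≡i)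
      drop j j≢i (there j∈)  = j∈
      cases : ∀ b → free P i ≡ b → Dec (slope K i ≡ + 0) →
        ((∀ j → free P j ≡ true → slope K j ≢ + 0 → ¬ (j ≡ i)) → R D) →
        (free P i ≡ true → slope K i ≢ + 0 → R D) → R D
      cases false e _ skip go = skip λ { j e′ _ refl → true≢false e′ e }
      cases true  e (yes eq) skip go = skip λ { j _ neq refl → neq eq }
      cases true  e (no neq) skip go = go e neq

    Indep-compl : ∀ {D} (P : Piece D) L → Indep P (ge (complᴸ L)) → Indep P (ge L)
    Indep-compl P L ind l p q hp hq ag = BoolP.not-injective (begin
      not (posB (eval L (at P l p)))    ≡⟨ flip (at P l p) ⟨
      posB (eval (complᴸ L) (at P l p)) ≡⟨ ind l p q hp hq ag ⟩
      posB (eval (complᴸ L) (at P l q)) ≡⟨ flip (at P l q) ⟩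
      not (posB (eval L (at P l q)))    ∎)
      where
      open ≡-Reasoning
      flip : ∀ ρ → posB (eval (complᴸ L) ρ) ≡ not (posB (eval L ρ))
      flip ρ = trans (ap posB (eval-compl L ρ)) (posB-compl _)

    -- The complementary atom has nonnegative slopes, and its independence is equivalent to that of
    -- the atom.
    refine⁻ : ∀ {D} (P : Piece D) L K → Tracks P L K →
      (∀ i → free P i ≡ true → slope K i ℤ.≤ + 0) → Cont P (ge L) → R D
    refine⁻ P L K tr K≤0 k = refine⁺ (allFin n) P (complᴸ L) (complᴸ K)
      (λ l p → trans (eval-compl L _) (trans (ap (λ e → ⊝ e ⊕ ⊝ oneC) (tr l p)) (sym (eval-compl K _))))
      (λ i e → negate (K≤0 i e)) (λ i _ _ → ∈P.∈-allFin i)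
      (λ P′ P′⊑P ind → k P′ P′⊑P (Indep-compl P′ L ind))
      where
      negate : ∀ {a} → a ℤ.≤ + 0 → + 0 ℤ.≤ -[1+ 0 ] ℤ.* a ℤ.+ + 0
      negate {+ zero}   _ = ℤ.+≤+ z≤n
      negate {+ suc a}  (ℤ.+≤+ ())
      negate { -[1+ a ]} _ = ℤ.+≤+ z≤n

    -- The slopes on free coordinates lie in [−B, A], the extreme values being attained only in is and js.
    Above : ∀ {D} → Piece D → Lin (m ℕ.+ n) → ℕ → List (Fin n) → Set
    Above P K A is = ∀ k → free P k ≡ true → slope K k ℤ.< + A ⊎ (slope K k ≡ + A × k ∈ is)

    Below : ∀ {D} → Piece D → Lin (m ℕ.+ n) → ℕ → List (Fin n) → Set
    Below P K B js = ∀ k → free P k ≡ true → ℤ.- + B ℤ.< slope K k ⊎ (slope K k ≡ ℤ.- + B × k ∈ js)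

    -- The new slope A - B lies strictly between -(B + 1) and A + 1. So the coordinate whose slope
    -- changes leaves its list of extremes, and neither list gains a member.
    module Compare {D} (P : Piece D) (L K : Lin (m ℕ.+ n)) (tr : Tracks P L K) (A B : ℕ)
      (is js : List (Fin n)) (i j : Fin n)
      (i-free : free P i ≡ true) (Ki : slope K i ≡ + suc A)
      (j-free : free P j ≡ true) (Kj : slope K j ≡ -[1+ B ])
      (above : Above P K (suc A) (i ∷ is)) (below : Below P K (suc B) (j ∷ js)) where

      private
        i≢j : i ≢ j
        i≢j refl with trans (sym Ki) Kj
        ... | ()

        difference : Lin (m ℕ.+ n)
        difference = varᴸ (m ↑ʳ i) +ᴸ -[1+ 0 ] *ᴸ varᴸ (m ↑ʳ j)

        eval-ʳ : ∀ k l p → eval (varᴸ (m ↑ʳ k)) (l ⋆ p) ≡ p k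
        eval-ʳ k l p = trans (eval-var (m ↑ʳ k) (l ⋆ p)) (⋆ʳ l p k)

        eval-difference : ∀ l p → eval difference (l ⋆ p) ≡ p i ⊕ ⊝ p j
        eval-difference l p = trans (eval-+ (varᴸ (m ↑ʳ i)) _ (l ⋆ p)) (cong₂ _⊕_ (eval-ʳ i l p)
          (trans (eval-* -[1+ 0 ] (varᴸ (m ↑ʳ j)) (l ⋆ p)) (trans (-1⊛ _) (ap ⊝_ (eval-ʳ j l p)))))

        E₁ E₂ : Lin (m ℕ.+ n)
        E₁ = varᴸ (m ↑ʳ j)
        -- The 1 turns the strict inequality p j > p i into nonnegativity of the new coordinate;
        -- ties belong to the other case.
        E₂ = varᴸ (m ↑ʳ i) +ᴸ constᴸ (+ 1)

        E₁-slope : ∀ k → slope E₁ k ≡ δ j k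
        E₁-slope = δ-↑ʳ m j

        E₂-slope : ∀ k → slope E₂ k ≡ δ i k
        E₂-slope k = trans (ℤP.+-identityʳ _) (δ-↑ʳ m i k)

        eval-E₂ : ∀ l p → eval E₂ (l ⋆ p) ≡ p i ⊕ oneC
        eval-E₂ l p = trans (eval-+ (varᴸ (m ↑ʳ i)) (constᴸ (+ 1)) (l ⋆ p))
          (cong₂ _⊕_ (eval-ʳ i l p) (trans (eval-const (+ 1) (l ⋆ p)) (1⊛ oneC)))

      c : QF (m ℕ.+ n)
      c = condition P difference

      private
        c-spec : ∀ l p → Holds D (at P l p) → evalB c (at P l p) ≡ posB (p i ⊕ ⊝ eval E₁ (l ⋆ p))
        c-spec l p _ = trans (evalB-condition P difference l p) (ap posB (trans (eval-difference l p)
          (ap (λ e → p i ⊕ ⊝ e) (sym (eval-ʳ j l p)))))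

        ¬c-spec : ∀ l p → Holds D (at P l p) → evalB (¬ᶠ c) (at P l p) ≡ posB (p j ⊕ ⊝ eval E₂ (l ⋆ p))
        ¬c-spec l p _ = begin
          evalB (¬ᶠ c) (at P l p)               ≡⟨ evalB-¬ c (at P l p) ⟩
          not (evalB c (at P l p))              ≡⟨ ap not (evalB-condition P difference l p) ⟩
          not (posB (eval difference (l ⋆ p)))  ≡⟨ ap (λ e → not (posB e)) (eval-difference l p) ⟩
          not (posB (p i ⊕ ⊝ p j))              ≡⟨ posB-compl _ ⟨
          posB (⊝ (p i ⊕ ⊝ p j) ⊕ ⊝ oneC)
            ≡⟨ ap posB (linear (p i ∷ p j ∷ []) (:- (v₀ :+ :- v₁) :+ :- :1) (v₁ :+ :- (v₀ :+ :1)) refl) ⟩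
          posB (p j ⊕ ⊝ (p i ⊕ oneC))           ≡⟨ ap (λ e → posB (p j ⊕ ⊝ e)) (eval-E₂ l p) ⟨
          posB (p j ⊕ ⊝ eval E₂ (l ⋆ p))        ∎
          where open ≡-Reasoning

        E₁-i : slope E₁ i ≡ + 0
        E₁-i = trans (E₁-slope i) (δ-≢ λ j≡i → i≢j (sym j≡i))

        E₂-j : slope E₂ j ≡ + 0
        E₂-j = trans (E₂-slope j) (δ-≢ i≢j)

        E₁≥0 : ∀ l p q → Holds D (at P l p) → AgreeOff (free P) p q →
          (∀ k → free P k ≡ true → Pos (q k)) → Pos (eval E₁ (l ⋆ q))
        E₁≥0 l p q _ _ q≥0 = Pos-≡ (sym (eval-ʳ j l q)) (q≥0 j j-free)

        E₂≥0 : ∀ l p q → Holds D (at P l p) → AgreeOff (free P) p q →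
          (∀ k → free P k ≡ true → Pos (q k)) → Pos (eval E₂ (l ⋆ q))
        E₂≥0 l p q _ _ q≥0 = Pos-≡ (sym (eval-E₂ l q)) (Pos-⊕ (q≥0 i i-free) 0≼1)

      P₁ : Piece (D ∧ᶠ c)
      P₁ = shear P i i-free E₁ E₁-i c c-spec E₁≥0

      P₁⊑P : P₁ ⊑ P
      P₁⊑P = shear-⊑ P i i-free E₁ E₁-i c c-spec E₁≥0

      K₁ : Lin (m ℕ.+ n)
      K₁ = K +ᴸ slope K i *ᴸ E₁

      P₁-tracks : Tracks P₁ L K₁
      P₁-tracks = shear-tracks P i i-free E₁ E₁-i c c-spec E₁≥0 {L} {K} tr

      P₂ : Piece (D ∧ᶠ ¬ᶠ c)
      P₂ = shear P j j-free E₂ E₂-j (¬ᶠ c) ¬c-spec E₂≥0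

      P₂⊑P : P₂ ⊑ P
      P₂⊑P = shear-⊑ P j j-free E₂ E₂-j (¬ᶠ c) ¬c-spec E₂≥0

      K₂ : Lin (m ℕ.+ n)
      K₂ = K +ᴸ slope K j *ᴸ E₂

      P₂-tracks : Tracks P₂ L K₂
      P₂-tracks = shear-tracks P j j-free E₂ E₂-j (¬ᶠ c) ¬c-spec E₂≥0 {L} {K} tr

      private
        K₁-j : slope K₁ j ≡ A ⊖ B
        K₁-j = trans (cong₂ (λ a b → slope K j ℤ.+ a ℤ.* b) Ki (trans (E₁-slope j) (δ-refl j)))
          (trans (cong₂ ℤ._+_ Kj (ℤP.*-identityʳ (+ suc A))) (ℤP.[1+m]⊖[1+n]≡m⊖n A B))

        K₁-off : ∀ k → j ≢ k → slope K₁ k ≡ slope K k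
        K₁-off k j≢k = trans (ap (λ a → slope K k ℤ.+ slope K i ℤ.* a) (trans (E₁-slope k) (δ-≢ j≢k)))
          (trans (ap (λ a → slope K k ℤ.+ a) (ℤP.*-zeroʳ (slope K i))) (ℤP.+-identityʳ _))

        K₂-i : slope K₂ i ≡ A ⊖ B
        K₂-i = trans (cong₂ (λ a b → slope K i ℤ.+ a ℤ.* b) Kj (trans (E₂-slope i) (δ-refl i)))
          (trans (cong₂ ℤ._+_ Ki (ℤP.*-identityʳ -[1+ B ])) (ℤP.[1+m]⊖[1+n]≡m⊖n A B))

        K₂-off : ∀ k → i ≢ k → slope K₂ k ≡ slope K k
        K₂-off k i≢k = trans (ap (λ a → slope K k ℤ.+ slope K j ℤ.* a) (trans (E₂-slope k) (δ-≢ i≢k)))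
          (trans (ap (λ a → slope K k ℤ.+ a) (ℤP.*-zeroʳ (slope K j))) (ℤP.+-identityʳ _))

        A⊖B< : A ⊖ B ℤ.< + suc A
        A⊖B< = ℤP.m⊖n<1+m A B

        <A⊖B : -[1+ B ] ℤ.< A ⊖ B
        <A⊖B = ℤP.-1+m<n⊖m B A

      above₁ : Above P₁ K₁ (suc A) (i ∷ is)
      above₁ k e with j Fin.≟ k
      ... | yes refl = inj₁ (subst (λ a → a ℤ.< + suc A) (sym K₁-j) A⊖B<)
      ... | no j≢k   = subst (λ a → a ℤ.< + suc A ⊎ (a ≡ + suc A × k ∈ i ∷ is)) (sym (K₁-off k j≢k)) (above k e)

      below₁ : Below P₁ K₁ (suc B) js
      below₁ k e with j Fin.≟ k
      ... | yes refl = inj₁ (subst (λ a → -[1+ B ] ℤ.< a) (sym K₁-j) <A⊖B)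
      ... | no j≢k with below k e
      ...   | inj₁ lt = inj₁ (subst (λ a → -[1+ B ] ℤ.< a) (sym (K₁-off k j≢k)) lt)
      ...   | inj₂ (eq , here k≡j) = ⊥-elim (j≢k (sym k≡j))
      ...   | inj₂ (eq , there k∈) = inj₂ (trans (K₁-off k j≢k) eq , k∈)

      above₂ : Above P₂ K₂ (suc A) is
      above₂ k e with i Fin.≟ k
      ... | yes refl = inj₁ (subst (λ a → a ℤ.< + suc A) (sym K₂-i) A⊖B<)
      ... | no i≢k with above k e
      ...   | inj₁ lt = inj₁ (subst (λ a → a ℤ.< + suc A) (sym (K₂-off k i≢k)) lt)
      ...   | inj₂ (eq , here k≡i) = ⊥-elim (i≢k (sym k≡i))
      ...   | inj₂ (eq , there k∈) = inj₂ (trans (K₂-off k i≢k) eq , k∈)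

      below₂ : Below P₂ K₂ (suc B) (j ∷ js)
      below₂ k e with i Fin.≟ k
      ... | yes refl = inj₁ (subst (λ a → -[1+ B ] ℤ.< a) (sym K₂-i) <A⊖B)
      ... | no i≢k   = subst (λ a → -[1+ B ] ℤ.< a ⊎ (a ≡ -[1+ B ] × k ∈ j ∷ js)) (sym (K₂-off k i≢k)) (below k e)

    Above-drop : ∀ {D} (P : Piece D) K A i is → (free P i ≡ true → slope K i ≢ + A) →
      Above P K A (i ∷ is) → Above P K A is
    Above-drop P K A i is no-i above k e with above k e
    ... | inj₁ lt               = inj₁ lt
    ... | inj₂ (eq , here refl) = ⊥-elim (no-i e eq)
    ... | inj₂ (eq , there k∈)  = inj₂ (eq , k∈)

    Below-drop : ∀ {D} (P : Piece D) K B j js → (free P j ≡ true → slope K j ≢ ℤ.- + B) →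
      Below P K B (j ∷ js) → Below P K B js
    Below-drop P K B j js no-j below k e with below k e
    ... | inj₁ lt               = inj₁ lt
    ... | inj₂ (eq , here refl) = ⊥-elim (no-j e eq)
    ... | inj₂ (eq , there k∈)  = inj₂ (eq , k∈)

    -- With no coordinate left at the extreme slope, the bound drops by one and the list is refilled
    -- with all coordinates.
    Above-pred : ∀ {D} (P : Piece D) K A → Above P K (suc A) [] → Above P K A (allFin n)
    Above-pred P K A above k e with above k e
    ... | inj₁ lt = Sum.map₂ (λ eq → eq , ∈P.∈-allFin k) (≤⇒<⊎≡ (<suc⇒≤ lt))

    Below-pred : ∀ {D} (P : Piece D) K B → Below P K (suc B) [] → Below P K B (allFin n)
    Below-pred P K B below k e with below k e
    ... | inj₁ lt = Sum.map₂ (λ eq → sym eq , ∈P.∈-allFin k) (≤⇒<⊎≡ (-suc<⇒≤ lt))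

    hit? : ∀ {D} (P : Piece D) K a i →
      (free P i ≡ true × slope K i ≡ a) ⊎ (free P i ≡ true → slope K i ≢ a)
    hit? P K a i with free P i | slope K i ℤP.≟ a
    ... | true  | yes eq = inj₁ (refl , eq)
    ... | true  | no neq = inj₂ λ _ → neq
    ... | false | _      = inj₂ λ ()

    -- Slopes of opposite signs are removed by a Euclidean algorithm: for the extreme slopes A = K i
    -- and −B = K j, either p i ≥ p j, and p i ↦ p i − p j changes K j to A − B, or p j > p i,
    -- and p j ↦ p j − p i − 1 changes K i to A − B.
    refine : ∀ A B (is js : List (Fin n)) {D} (P : Piece D) L K → Tracks P L K →
      Above P K A is → Below P K B js → Cont P (ge L) → R D
    refine zero B is js P L K tr above below k = refine⁻ P L K tr
      (λ i e → Sum.[ ℤP.<⇒≤ , (λ { (eq , _) → ℤP.≤-reflexive eq }) ]′ (above i e)) k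
    refine (suc A) zero is js P L K tr above below k = refine⁺ (allFin n) P L K tr
      (λ i e → Sum.[ ℤP.<⇒≤ , (λ { (eq , _) → ℤP.≤-reflexive (sym eq) }) ]′ (below i e))
      (λ i _ _ → ∈P.∈-allFin i) k
    -- Termination: in each recursive call either A + B decreases, or it stays the same and one of
    -- the lists gets shorter.
    refine (suc A) (suc B) [] js P L K tr above below k =
      refine A (suc B) (allFin n) js P L K tr (Above-pred P K A above) below k
    refine (suc A) (suc B) (i ∷ is) [] P L K tr above below k =
      refine (suc A) B (i ∷ is) (allFin n) P L K tr above (Below-pred P K B below) k
    refine (suc A) (suc B) (i ∷ is) (j ∷ js) {D} P L K tr above below k =
      dispatch (hit? P K (+ suc A) i) (hit? P K (ℤ.- + suc B) j)
        (λ i-free Ki j-free Kj →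
          let open Compare P L K tr A B is js i j i-free Ki j-free Kj above below in
          node D c
            (refine (suc A) (suc B) (i ∷ is) js P₁ L K₁ P₁-tracks above₁ below₁ (via P P₁ (ge L) P₁⊑P k))
            (refine (suc A) (suc B) is (j ∷ js) P₂ L K₂ P₂-tracks above₂ below₂ (via P P₂ (ge L) P₂⊑P k)))
        (λ no-i → refine (suc A) (suc B) is (j ∷ js) P L K tr (Above-drop P K (suc A) i is no-i above) below k)
        (λ no-j → refine (suc A) (suc B) (i ∷ is) js P L K tr above (Below-drop P K (suc B) j js no-j below) k)
      where
      dispatch : ∀ {I I′ J J′ No-i No-j : Set} → (I × I′) ⊎ No-i → (J × J′) ⊎ No-j →
        (I → I′ → J → J′ → R D) → (No-i → R D) → (No-j → R D) → R D
      dispatch (inj₁ (a , b)) (inj₁ (c , d)) go skip-i skip-j = go a b c d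
      dispatch (inj₁ _)       (inj₂ no-j)    go skip-i skip-j = skip-j no-j
      dispatch (inj₂ no-i)    _              go skip-i skip-j = skip-i no-i

    refineAtom : ∀ {D} (P : Piece D) L → Cont P (ge L) → R D
    refineAtom {D} P L k with fin-bound (λ i → ℤ.∣ slope (compose (bwd P) L) i ∣)
    ... | A , ≤A = refine A A (allFin n) (allFin n) P L K (λ l p → sym (eval-compose (bwd P) L l p)) above below k
      where
      K = compose (bwd P) L
      above : Above P K A (allFin n)
      above i _ = Sum.map₂ (λ eq → eq , ∈P.∈-allFin i)
        (≤⇒<⊎≡ (ℤP.≤-trans (i≤∣i∣ (slope K i)) (ℤ.+≤+ (≤A i))))
      below : Below P K A (allFin n)
      below i _ = Sum.map₂ (λ eq → sym eq , ∈P.∈-allFin i)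
        (≤⇒<⊎≡ (subst (λ a → ℤ.- + A ℤ.≤ a) (ℤP.neg-involutive (slope K i))
          (ℤP.neg-mono-≤ (ℤP.≤-trans (i≤∣i∣ (ℤ.- slope K i))
            (subst (λ a → + a ℤ.≤ + A) (sym (ℤP.∣-i∣≡∣i∣ (slope K i))) (ℤ.+≤+ (≤A i)))))))

    congruent : ∀ {D} (P : Piece D) l x y → Holds D (l ⋆ x) → Holds D (l ⋆ y) → ∀ i → Dvd N (y i ⊕ ⊝ x i)
    congruent P l x y hx hy i = subst (Dvd N)
      (linear (x i ∷ y i ∷ + residue P i ⊛ oneC ∷ [])
        ((v₁ :+ :- v₂) :+ -[1+ 0 ] :* (v₀ :+ :- v₂)) (v₁ :+ :- v₀) refl)
      (Dvd-⊕ (residual P l y hy i) (Dvd-⊛ -[1+ 0 ] (residual P l x hx i)))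

    Dvd-∑ : ∀ {M k} (f : Vector Carrier k) → (∀ i → Dvd M (f i)) → Dvd M (∑ f)
    Dvd-∑ {k = zero}  f d = zeroC , sym (⊛-zero _)
    Dvd-∑ {k = suc k} f d = Dvd-⊕ (d zero) (Dvd-∑ (λ i → f (suc i)) λ i → d (suc i))

    eval-congruent : ∀ {M} L {ρ ρ′ : Env} → (∀ k → Dvd M (ρ′ k ⊕ ⊝ ρ k)) → Dvd M (eval L ρ′ ⊕ ⊝ eval L ρ)
    eval-congruent {M} L {ρ} {ρ′} d = subst (Dvd M) (begin
      ∑ (λ k → coef L k ⊛ (ρ′ k ⊕ ⊝ ρ k))
        ≡⟨ ∑-cong (λ k → trans (ap (λ e → coef L k ⊛ (ρ′ k ⊕ e)) (sym (-1⊛ _)))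
             (trans (⊛-distribˡ (coef L k) _ _) (ap (λ e → coef L k ⊛ ρ′ k ⊕ e) (swap (coef L k) (ρ k))))) ⟩
      ∑ (λ k → coef L k ⊛ ρ′ k ⊕ -[1+ 0 ] ⊛ coef L k ⊛ ρ k)
        ≡⟨ trans (∑-⊕ (λ k → coef L k ⊛ ρ′ k) (λ k → -[1+ 0 ] ⊛ coef L k ⊛ ρ k))
             (ap (λ e → S′ ⊕ e) (∑-⊛ -[1+ 0 ] (λ k → coef L k ⊛ ρ k))) ⟩
      S′ ⊕ -[1+ 0 ] ⊛ S
        ≡⟨ linear (S ∷ S′ ∷ const L ⊛ oneC ∷ []) (v₁ :+ -[1+ 0 ] :* v₀)
             ((v₂ :+ v₁) :+ :- (v₂ :+ v₀)) refl ⟩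
      eval L ρ′ ⊕ ⊝ eval L ρ ∎)
      (Dvd-∑ (λ k → coef L k ⊛ (ρ′ k ⊕ ⊝ ρ k)) λ k → Dvd-⊛ (coef L k) (d k))
      where
      open ≡-Reasoning
      S  = ∑ (λ k → coef L k ⊛ ρ k)
      S′ = ∑ (λ k → coef L k ⊛ ρ′ k)
      swap : ∀ a x → a ⊛ -[1+ 0 ] ⊛ x ≡ -[1+ 0 ] ⊛ a ⊛ x
      swap a x = trans (sym (⊛-assoc a -[1+ 0 ] x))
        (trans (ap (λ b → b ⊛ x) (ℤP.*-comm a -[1+ 0 ])) (⊛-assoc -[1+ 0 ] a x))

    ⋆-congruent : ∀ {M} l {x y} → (∀ i → Dvd M (y i ⊕ ⊝ x i)) → ∀ k → Dvd M ((l ⋆ y) k ⊕ ⊝ (l ⋆ x) k)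
    ⋆-congruent {M} l {x} {y} d = split-elim _
      (λ j → zeroC , trans (cong₂ (λ a b → a ⊕ ⊝ b) (⋆ˡ l y j) (⋆ˡ l x j))
        (trans (⊝-inverseʳ (l j)) (sym (⊛-zero _))))
      (λ i → subst (Dvd M) (cong₂ (λ a b → a ⊕ ⊝ b) (sym (⋆ʳ l y i)) (sym (⋆ʳ l x i))) (d i))

    -- A divisibility is already constant on each fibre, whose points are congruent modulo suc N, a
    -- multiple of its modulus. For `nand`, the order on pieces carries the independence of φ
    -- through the refinement for ψ.
    refineAll : ∀ φ → ModuliDivide φ N → ∀ {D} (P : Piece D) → Cont P φ → R D
    refineAll (ge L) _ P k = refineAtom P L k
    refineAll (dvd M L) M∣N P k = k P (λ _ ind → ind) λ l p q hp hq _ →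
      dvdB-shift (eval-congruent L (⋆-congruent l λ i →
        Dvd-∣⁺ {M} {N} M∣N (congruent P l (image (bwd P) l p) (image (bwd P) l q) hp hq i)))
    refineAll (nand φ ψ) (dφ , dψ) P k = refineAll φ dφ P λ P₁ P₁⊑P ind₁ →
      refineAll ψ dψ P₁ λ P₂ P₂⊑P₁ ind₂ →
        k P₂ (λ χ i → P₂⊑P₁ χ (P₁⊑P χ i)) λ l p q hp hq ag →
          cong₂ (λ a b → not (a ∧ b)) (P₂⊑P₁ φ ind₁ l p q hp hq ag) (ind₂ l p q hp hq ag)

-- From a piece to the linear bijection onto H^l × Λ

-- The free coordinates are numbered by Fin l and the others by Fin r.
record Sorting {n} (free : Fin n → Bool) : Set where
  field
    l r              : ℕ
    l+r≡n            : l ℕ.+ r ≡ n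
    place            : Fin n → Fin l ⊎ Fin r
    coordinate       : Fin l ⊎ Fin r → Fin n
    coordinate-place : ∀ k → coordinate (place k) ≡ k
    place-coordinate : ∀ s → place (coordinate s) ≡ s
    coordinate-free  : ∀ i → free (coordinate (inj₁ i)) ≡ true
    coordinate-rest  : ∀ i → free (coordinate (inj₂ i)) ≡ false

  slot : Fin l ⊎ Fin r → Fin n
  slot s = Fin.cast l+r≡n (join l r s)

  unslot : Fin n → Fin l ⊎ Fin r
  unslot j = splitAt l (Fin.cast (sym l+r≡n) j)

  slot-unslot : ∀ j → slot (unslot j) ≡ j
  slot-unslot j = trans (ap (Fin.cast l+r≡n) (FinP.join-splitAt l r _))
    (FinP.cast-involutive l+r≡n (sym l+r≡n) j)

  unslot-slot : ∀ s → unslot (slot s) ≡ s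
  unslot-slot s = trans (ap (splitAt l) (FinP.cast-involutive (sym l+r≡n) l+r≡n (join l r s)))
    (FinP.splitAt-join l r s)

  -- The permutation that lists the free coordinates first, as the form H^l × Λ demands.
  ω ω⁻¹ : Fin n → Fin n
  ω j = coordinate (unslot j)
  ω⁻¹ k = slot (place k)

  ω-ω⁻¹ : ∀ k → ω (ω⁻¹ k) ≡ k
  ω-ω⁻¹ k = trans (ap coordinate (unslot-slot (place k))) (coordinate-place k)

  ω⁻¹-ω : ∀ j → ω⁻¹ (ω j) ≡ j
  ω⁻¹-ω j = trans (ap slot (place-coordinate (unslot j))) (slot-unslot j)

sorting : ∀ {n} (free : Fin n → Bool) → Sorting free
sorting {zero} free = record
  { l = 0 ; r = 0 ; l+r≡n = refl ; place = λ () ; coordinate = λ { (inj₁ ()) ; (inj₂ ()) }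
  ; coordinate-place = λ () ; place-coordinate = λ { (inj₁ ()) ; (inj₂ ()) }
  ; coordinate-free = λ () ; coordinate-rest = λ () }
sorting {suc n} free with sorting (λ i → free (suc i)) | free zero in free₀
... | s | true = record
  { l = suc l ; r = r ; l+r≡n = ap suc l+r≡n ; place = place′ ; coordinate = coordinate′
  ; coordinate-place = coordinate-place′ ; place-coordinate = place-coordinate′
  ; coordinate-free = λ { zero → free₀ ; (suc i) → coordinate-free i }
  ; coordinate-rest = coordinate-rest }
  where
  open Sorting s
  place′ : Fin (suc n) → Fin (suc l) ⊎ Fin r
  place′ zero    = inj₁ zero
  place′ (suc k) = Sum.map₁ suc (place k)
  coordinate′ : Fin (suc l) ⊎ Fin r → Fin (suc n)
  coordinate′ (inj₁ zero)    = zero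
  coordinate′ (inj₁ (suc i)) = suc (coordinate (inj₁ i))
  coordinate′ (inj₂ i)       = suc (coordinate (inj₂ i))
  coordinate′-map : ∀ s → coordinate′ (Sum.map₁ suc s) ≡ suc (coordinate s)
  coordinate′-map (inj₁ i) = refl
  coordinate′-map (inj₂ i) = refl
  coordinate-place′ : ∀ k → coordinate′ (place′ k) ≡ k
  coordinate-place′ zero    = refl
  coordinate-place′ (suc k) = trans (coordinate′-map (place k)) (ap suc (coordinate-place k))
  place-coordinate′ : ∀ s → place′ (coordinate′ s) ≡ s
  place-coordinate′ (inj₁ zero)    = refl
  place-coordinate′ (inj₁ (suc i)) = ap (Sum.map₁ suc) (place-coordinate (inj₁ i))
  place-coordinate′ (inj₂ i)       = ap (Sum.map₁ suc) (place-coordinate (inj₂ i))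
... | s | false = record
  { l = l ; r = suc r ; l+r≡n = trans (ℕP.+-suc l r) (ap suc l+r≡n) ; place = place′ ; coordinate = coordinate′
  ; coordinate-place = coordinate-place′ ; place-coordinate = place-coordinate′
  ; coordinate-free = coordinate-free
  ; coordinate-rest = λ { zero → free₀ ; (suc i) → coordinate-rest i } }
  where
  open Sorting s
  place′ : Fin (suc n) → Fin l ⊎ Fin (suc r)
  place′ zero    = inj₂ zero
  place′ (suc k) = Sum.map₂ suc (place k)
  coordinate′ : Fin l ⊎ Fin (suc r) → Fin (suc n)
  coordinate′ (inj₁ i)       = suc (coordinate (inj₁ i))
  coordinate′ (inj₂ zero)    = zero
  coordinate′ (inj₂ (suc i)) = suc (coordinate (inj₂ i))
  coordinate′-map : ∀ s → coordinate′ (Sum.map₂ suc s) ≡ suc (coordinate s)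
  coordinate′-map (inj₁ i) = refl
  coordinate′-map (inj₂ i) = refl
  coordinate-place′ : ∀ k → coordinate′ (place′ k) ≡ k
  coordinate-place′ zero    = refl
  coordinate-place′ (suc k) = trans (coordinate′-map (place k)) (ap suc (coordinate-place k))
  place-coordinate′ : ∀ s → place′ (coordinate′ s) ≡ s
  place-coordinate′ (inj₁ i)       = ap (Sum.map₂ suc) (place-coordinate (inj₁ i))
  place-coordinate′ (inj₂ zero)    = refl
  place-coordinate′ (inj₂ (suc i)) = ap (Sum.map₂ suc) (place-coordinate (inj₂ i))

zeroᶠ : ∀ {k} → Lin k → QF k
zeroᶠ L = ge L ∧ᶠ ge (-[1+ 0 ] *ᴸ L)

module GoodPieces (G : ZGroup) where
  open Refinement G public

  Holds-zero⁺ : ∀ {k} (L : Lin k) {ρ} → eval L ρ ≡ zeroC → Holds (zeroᶠ L) ρ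
  Holds-zero⁺ L {ρ} eq = Holds-∧⁺ (ge L) (ge (-[1+ 0 ] *ᴸ L)) (posB-true (Pos-≡ (sym eq) 0≼0))
    (posB-true (Pos-≡ (sym (trans (eval-* -[1+ 0 ] L ρ) (trans (ap (λ e → -[1+ 0 ] ⊛ e) eq) (⊛-zero _)))) 0≼0))

  Holds-zero⁻ : ∀ {k} (L : Lin k) {ρ} → Holds (zeroᶠ L) ρ → eval L ρ ≡ zeroC
  Holds-zero⁻ L {ρ} h = let p , q = Holds-∧⁻ (ge L) (ge (-[1+ 0 ] *ᴸ L)) h in
    Pos-antisym (posB⇒Pos p) (Pos-≡ (trans (eval-* -[1+ 0 ] L ρ) (-1⊛ _)) (posB⇒Pos q))

  ∑-++ : ∀ m {n} (f : Vector Carrier (m ℕ.+ n)) → ∑ f ≡ ∑ (λ j → f (j ↑ˡ n)) ⊕ ∑ (λ i → f (m ↑ʳ i))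
  ∑-++ zero    f = sym (⊕-identityˡ _)
  ∑-++ (suc m) f = trans (ap (λ e → f zero ⊕ e) (∑-++ m (λ k → f (suc k)))) (sym (⊕-assoc _ _ _))

  module Leaf (m n N : ℕ) (X D : QF (m ℕ.+ n)) where
    open Charts m n N

    module _ (P : Piece D) (X-indep : Indep P X) where
      open Sorting (sorting (free P))

      private
        A : QF (m ℕ.+ n)
        A = D ∧ᶠ X

        coords : Vector Carrier n → Vector Carrier n
        coords y k = y (ω⁻¹ k)

        fillᴸ : Fin n → Lin (m ℕ.+ r)
        fillᴸ k = Sum.[ (λ _ → constᴸ (+ 0)) , (λ i → varᴸ (m ↑ʳ i)) ]′ (place k)

        fillEnvᴸ : Fin (m ℕ.+ n) → Lin (m ℕ.+ r)
        fillEnvᴸ = (λ j → varᴸ (j ↑ˡ r)) VF.++ fillᴸ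

        pointᴸ : Fin (m ℕ.+ n) → Lin (m ℕ.+ r)
        pointᴸ = (λ j → varᴸ (j ↑ˡ r)) VF.++ λ i → subᴸ (+ 1) fillEnvᴸ (bwd P i)

        -- By saturation, membership need only be tested for one choice of the free coordinates, and
        -- 0 is taken.
        θ : QF (m ℕ.+ r)
        θ = subᶠ 0 pointᴸ A

        fill : Vector Carrier r → Vector Carrier n
        fill w k = Sum.[ (λ _ → zeroC) , w ]′ (place k)

        eval-params : ∀ λ′ w (e : Fin n → Lin (m ℕ.+ r)) p → (∀ i → eval (e i) (λ′ VF.++ w) ≡ p i) →
          ∀ k → eval (((λ j → varᴸ (j ↑ˡ r)) VF.++ e) k) (λ′ VF.++ w) ≡ + 1 ⊛ (λ′ ⋆ p) k
        eval-params λ′ w e p eq = split-elim _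
          (λ j → trans (ap (λ L → eval L (λ′ VF.++ w)) (VFP.lookup-++ˡ (λ j → varᴸ (j ↑ˡ r)) e j))
            (trans (eval-var (j ↑ˡ r) _) (trans (VFP.lookup-++ˡ λ′ w j)
              (trans (sym (⋆ˡ λ′ p j)) (sym (1⊛ _))))))
          (λ i → trans (ap (λ L → eval L (λ′ VF.++ w)) (VFP.lookup-++ʳ (λ j → varᴸ (j ↑ˡ r)) e i))
            (trans (eq i) (trans (sym (⋆ʳ λ′ p i)) (sym (1⊛ _)))))

        eval-fill : ∀ λ′ w k → eval (fillᴸ k) (λ′ VF.++ w) ≡ fill w k
        eval-fill λ′ w k with place k
        ... | inj₁ _ = trans (eval-const (+ 0) (λ′ VF.++ w)) (0⊛ oneC)
        ... | inj₂ i = trans (eval-var (m ↑ʳ i) _) (VFP.lookup-++ʳ λ′ w i)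

        evalB-θ : ∀ λ′ w → evalB θ (λ′ VF.++ w) ≡ evalB A (at P λ′ (fill w))
        evalB-θ λ′ w = evalB-sub 0 pointᴸ A (eval-params λ′ w (λ i → subᴸ (+ 1) fillEnvᴸ (bwd P i))
          (image (bwd P) λ′ (fill w))
          λ i → trans (eval-sub (+ 1) fillEnvᴸ (bwd P i) (eval-params λ′ w fillᴸ (fill w) (eval-fill λ′ w))) (1⊛ _))

        A-saturated : ∀ λ′ p q → Holds A (at P λ′ p) → AgreeOff (free P) p q →
          (∀ i → free P i ≡ true → Pos (q i)) → Holds A (at P λ′ q)
        A-saturated λ′ p q h ag q≥0 =
          let hD , hX = Holds-∧⁻ D X h
              hq = saturated P λ′ p q hD ag q≥0
          in Holds-∧⁺ D X hq (trans (sym (X-indep λ′ p q hD hq ag)) hX)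

        free-inj₁ : ∀ k {i} → place k ≡ inj₁ i → free P k ≡ true
        free-inj₁ k {i} eq = trans (ap (free P) (trans (sym (coordinate-place k)) (ap coordinate eq))) (coordinate-free i)

        free-inj₂ : ∀ k {i} → place k ≡ inj₂ i → free P k ≡ false
        free-inj₂ k {i} eq = trans (ap (free P) (trans (sym (coordinate-place k)) (ap coordinate eq))) (coordinate-rest i)

        -- Defined by the product form itself, so that this clause of the theorem is almost
        -- immediate; that it is the image of the part is shown by `B⇒A` and `A⇒B`.
        B : Env → Set
        B ρ = (∀ i → zeroC ≼ ρ (m ↑ʳ slot (inj₁ i))) ×
          Sat structure (toFormula θ) ((λ j → ρ (j ↑ˡ n)) VF.++ λ i → ρ (m ↑ʳ slot (inj₂ i)))

        Λ : Vector Carrier m → Vector Carrier r → Set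
        Λ λ′ w = Sat structure (toFormula θ) (λ′ VF.++ w)

        rest : Vector Carrier n → Vector Carrier r
        rest y i = y (slot (inj₂ i))

        Λ-B : ∀ λ′ y → Holds θ ((λ j → (λ′ ⋆ y) (j ↑ˡ n)) VF.++ λ i → (λ′ ⋆ y) (m ↑ʳ slot (inj₂ i)))
          ≡ Holds θ (λ′ VF.++ rest y)
        Λ-B λ′ y = ap (λ b → b ≡ true)
          (evalB-cong θ (VFP.++-cong (λ j → (λ′ ⋆ y) (j ↑ˡ n)) λ′ (⋆ˡ λ′ y) (λ i → ⋆ʳ λ′ y (slot (inj₂ i)))))

        B⇒ : ∀ {λ′ y} → B (λ′ ⋆ y) → (∀ i → zeroC ≼ y (slot (inj₁ i))) × Λ λ′ (rest y)
        B⇒ {λ′} {y} (y≥0 , h) = (λ i → Pos-≡ (⋆ʳ λ′ y (slot (inj₁ i))) (y≥0 i)) ,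
          toFormula-complete θ (subst (λ S → S) (Λ-B λ′ y) (toFormula-sound θ h))

        ⇒B : ∀ {λ′ y} → (∀ i → zeroC ≼ y (slot (inj₁ i))) × Λ λ′ (rest y) → B (λ′ ⋆ y)
        ⇒B {λ′} {y} (y≥0 , h) = (λ i → Pos-≡ (sym (⋆ʳ λ′ y (slot (inj₁ i)))) (y≥0 i)) ,
          toFormula-complete θ (subst (λ S → S) (sym (Λ-B λ′ y)) (toFormula-sound θ h))

        fill-rest : ∀ y k → free P k ≡ false → fill (rest y) k ≡ coords y k
        fill-rest y k e with place k in eq
        ... | inj₁ i = ⊥-elim (true≢false (free-inj₁ k eq) e)
        ... | inj₂ i = refl

        -- The point with free coordinates 0 belongs to the part by `θ`, and saturation replaces the
        -- zeros by the nonnegative coordinates of y.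
        B⇒A : ∀ {λ′ y} → B (λ′ ⋆ y) → Holds A (at P λ′ (coords y))
        B⇒A {λ′} {y} b = A-saturated λ′ (fill (rest y)) (coords y)
          (trans (sym (evalB-θ λ′ (rest y))) (toFormula-sound θ (proj₂ (B⇒ {λ′} {y} b))))
          (fill-rest y) coords≥0
          where
          coords≥0 : ∀ k → free P k ≡ true → Pos (coords y k)
          coords≥0 k e with place k in eq
          ... | inj₁ i = proj₁ (B⇒ {λ′} {y} b) i
          ... | inj₂ i = ⊥-elim (true≢false e (free-inj₂ k eq))

        A⇒B : ∀ {λ′ y} → Holds A (at P λ′ (coords y)) → B (λ′ ⋆ y)
        A⇒B {λ′} {y} h = ⇒B {λ′} {y} ((λ i → Pos-≡ (ap (λ s → y (slot s)) (place-coordinate (inj₁ i)))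
            (nonneg P λ′ (coords y) (proj₁ (Holds-∧⁻ D X h)) (coordinate (inj₁ i)) (coordinate-free i))) ,
          toFormula-complete θ (trans (evalB-θ λ′ (rest y)) (A-saturated λ′ (coords y) (fill (rest y)) h
            (λ k e → sym (fill-rest y k e)) fill≥0)))
          where
          fill≥0 : ∀ k → free P k ≡ true → Pos (fill (rest y) k)
          fill≥0 k e with place k in eq
          ... | inj₁ i = 0≼0
          ... | inj₂ i = ⊥-elim (true≢false e (free-inj₂ k eq))

        old : Fin (m ℕ.+ n) → Lin ((m ℕ.+ n) ℕ.+ n)
        old k = varᴸ (k ↑ˡ n)

        eval-old : ∀ ρ y k → eval (old k) (ρ VF.++ y) ≡ + 1 ⊛ ρ k
        eval-old ρ y k = trans (eval-var (k ↑ˡ n) _) (trans (VFP.lookup-++ˡ ρ y k) (sym (1⊛ _)))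

        -- y = fwd(x)/(N + 1) with the denominator cleared, as the language has no division.
        equation : Fin n → Lin ((m ℕ.+ n) ℕ.+ n)
        equation j = + suc N *ᴸ varᴸ ((m ℕ.+ n) ↑ʳ j) +ᴸ -[1+ 0 ] *ᴸ subᴸ (+ 1) old (fwd P (ω j))

        F : QF ((m ℕ.+ n) ℕ.+ n)
        F = subᶠ 0 old A ∧ᶠ ⋀ᶠ λ j → zeroᶠ (equation j)

        Graph : Vector Carrier m → Vector Carrier n → Vector Carrier n → Set
        Graph λ′ x y = Sat structure (toFormula F) ((λ′ VF.++ x) VF.++ y)

        eval-equation : ∀ ρ y j → eval (equation j) (ρ VF.++ y) ≡ + suc N ⊛ y j ⊕ ⊝ eval (fwd P (ω j)) ρ
        eval-equation ρ y j = trans (eval-+ (+ suc N *ᴸ varᴸ ((m ℕ.+ n) ↑ʳ j)) _ (ρ VF.++ y)) (cong₂ _⊕_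
          (trans (eval-* (+ suc N) (varᴸ ((m ℕ.+ n) ↑ʳ j)) _)
            (ap (λ e → + suc N ⊛ e) (trans (eval-var ((m ℕ.+ n) ↑ʳ j) _) (VFP.lookup-++ʳ ρ y j))))
          (trans (eval-* -[1+ 0 ] (subᴸ (+ 1) old (fwd P (ω j))) _) (trans (-1⊛ _)
            (ap ⊝_ (trans (eval-sub (+ 1) old (fwd P (ω j)) (eval-old ρ y)) (1⊛ _))))))

        Graph⇒ : ∀ {λ′ x y} → Graph λ′ x y →
          Holds A (λ′ ⋆ x) × (∀ j → + suc N ⊛ y j ≡ eval (fwd P (ω j)) (λ′ ⋆ x))
        Graph⇒ {λ′} {x} {y} g =
          let hA , hE = Holds-∧⁻ (subᶠ 0 old A) (⋀ᶠ λ j → zeroᶠ (equation j)) (toFormula-sound F g)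
          in trans (sym (evalB-sub 0 old A (eval-old (λ′ ⋆ x) y))) hA ,
             λ j → trans (linear (+ suc N ⊛ y j ∷ eval (fwd P (ω j)) (λ′ ⋆ x) ∷ [])
                 v₀ ((v₀ :+ :- v₁) :+ v₁) refl)
               (trans (ap (λ e → e ⊕ eval (fwd P (ω j)) (λ′ ⋆ x))
                 (trans (sym (eval-equation (λ′ ⋆ x) y j))
                   (Holds-zero⁻ (equation j) (Holds-⋀⁻ (λ j → zeroᶠ (equation j)) hE j)))) (⊕-identityˡ _))

        ⇒Graph : ∀ {λ′ x y} → Holds A (λ′ ⋆ x) →
          (∀ j → + suc N ⊛ y j ≡ eval (fwd P (ω j)) (λ′ ⋆ x)) → Graph λ′ x y
        ⇒Graph {λ′} {x} {y} hA eq = toFormula-complete F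
          (Holds-∧⁺ (subᶠ 0 old A) (⋀ᶠ λ j → zeroᶠ (equation j))
            (trans (evalB-sub 0 old A (eval-old (λ′ ⋆ x) y)) hA)
            (Holds-⋀⁺ (λ j → zeroᶠ (equation j)) λ j → Holds-zero⁺ (equation j)
              (trans (eval-equation (λ′ ⋆ x) y j)
                (trans (ap (λ e → e ⊕ ⊝ eval (fwd P (ω j)) (λ′ ⋆ x)) (eq j)) (⊝-inverseʳ _)))))

        -- x is the image of some p by `onto`; the graph equations and `fwd-bwd` give (N + 1)y = (N
        -- + 1)p up to the permutation, so p is y. Injectivity of the map is a consequence.
        Graph-image : ∀ {λ′ x y} → Graph λ′ x y → ∀ i → x i ≡ image (bwd P) λ′ (coords y) i
        Graph-image {λ′} {x} {y} g i =
          let hA , eq = Graph⇒ {λ′} {x} {y} g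
              p , x≡ = onto P λ′ x (proj₁ (Holds-∧⁻ D X hA))
          in trans (x≡ i) (eval-cong (bwd P i) (⋆-cong λ′ λ k → trans (ap p (sym (ω-ω⁻¹ k)))
               (⊛-injective N (trans (sym (fwd-bwd P λ′ p (ω (ω⁻¹ k))))
                 (trans (eval-cong (fwd P (ω (ω⁻¹ k))) (⋆-cong λ′ λ i → sym (x≡ i))) (sym (eq (ω⁻¹ k))))))))

        image-Graph : ∀ {λ′ x y} → Holds A (λ′ ⋆ x) → (∀ i → x i ≡ image (bwd P) λ′ (coords y) i) → Graph λ′ x y
        image-Graph {λ′} {x} {y} hA x≡ = ⇒Graph {λ′} {x} {y} hA λ j → sym
          (trans (eval-cong (fwd P (ω j)) (⋆-cong λ′ x≡))
            (trans (fwd-bwd P λ′ (coords y) (ω j)) (ap (λ k → + suc N ⊛ y k) (ω⁻¹-ω j))))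

        total : ∀ {λ′ x} → Holds A (λ′ ⋆ x) → Σ (Vector Carrier n) λ y → Graph λ′ x y
        total {λ′} {x} hA =
          let p , x≡ = onto P λ′ x (proj₁ (Holds-∧⁻ D X hA)) in
          (λ j → p (ω j)) , image-Graph {λ′} {x} hA λ i → trans (x≡ i)
            (eval-cong (bwd P i) (⋆-cong λ′ λ k → ap p (sym (ω-ω⁻¹ k))))

        Graph-B : ∀ {λ′ x y} → Graph λ′ x y → B (λ′ ⋆ y)
        Graph-B {λ′} {x} {y} g = A⇒B {λ′} {y} (trans
          (sym (evalB-cong A (⋆-cong λ′ (Graph-image {λ′} {x} {y} g)))) (proj₁ (Graph⇒ {λ′} {x} {y} g)))

        surjective : ∀ {λ′ y} → B (λ′ ⋆ y) → Σ (Vector Carrier n) λ x → Graph λ′ x y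
        surjective {λ′} {y} b = image (bwd P) λ′ (coords y) ,
          image-Graph {λ′} {_} {y} (B⇒A {λ′} {y} b) λ i → refl

        functional : ∀ {λ′ x y y′} → Graph λ′ x y → Graph λ′ x y′ → ∀ j → y j ≡ y′ j
        functional {λ′} {x} {y} {y′} g g′ j = ⊛-injective N
          (trans (proj₂ (Graph⇒ {λ′} {x} {y} g) j) (sym (proj₂ (Graph⇒ {λ′} {x} {y′} g′) j)))

        bounded-Λ : ∀ λ′ → Bounded G r (Λ λ′)
        bounded-Λ λ′ =
          let b , b≥0 , f = bounded P λ′ in
          (λ _ → b) , (λ _ → b≥0) , λ w h i →
            let hD = proj₁ (Holds-∧⁻ D X (trans (sym (evalB-θ λ′ w)) (toFormula-sound θ h)))
                -b≤ , ≤b = f (fill w) hD (coordinate (inj₂ i)) (coordinate-rest i)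
                w≡ = ap Sum.[ (λ _ → zeroC) , w ]′ (place-coordinate (inj₂ i))
            in (⊝ b , ⊝-inverseˡ b , Pos⇒≼ (Pos-≡ (trans (ap (λ e → b ⊕ e) w≡)
                 (linear (b ∷ w i ∷ []) (v₀ :+ v₁) (v₁ :+ :- :- v₀) refl)) -b≤)) ,
               Pos⇒≼ (Pos-≡ (ap (λ e → b ⊕ ⊝ e) w≡) ≤b)

        -- With x i = (N + 1) z i + residue i the value (N + 1) y j differs from (N + 1) Σ a i z i by an
        -- amount that depends on the fibre only; γ is read off any point of the fibre.
        linear-Graph : ∀ λ′ → (Σ (Vector Carrier n) λ x → Holds A (λ′ ⋆ x)) → ∀ j →
          IsLinearGraph G n (λ x → Sat structure (toFormula A) (λ′ ⋆ x))
            (λ x v → Σ (Vector Carrier n) λ y → Graph λ′ x y × (y j ≡ v))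
        linear-Graph λ′ (x° , hA°) j =
          γ , a , (λ _ → N) , residue P , (λ i → s≤s (residue≤ P i)) , λ x hx →
            (λ i → Dvd⇒Cong (subst (λ e → Dvd N (x i ⊕ ⊝ e)) (+⊛ (residue P i) oneC)
              (residual P λ′ x (proj₁ (Holds-∧⁻ D X (toFormula-sound A hx))) i))) ,
            λ { _ (y , g , refl) → z x (toFormula-sound A hx) ,
              (λ i → trans (sym (cong₂ _⊕_ (+⊛ (suc N) _) (+⊛ (residue P i) oneC)))
                (sym (x≡ x (toFormula-sound A hx) i))) , equation-γ x y (toFormula-sound A hx) g }
          where
          open ≡-Reasoning
          L : Lin (m ℕ.+ n)
          L = fwd P (ω j)
          a : Fin n → ℤ
          a i = slope L i
          z : ∀ x → Holds A (λ′ ⋆ x) → Vector Carrier n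
          z x hA i = proj₁ (residual P λ′ x (proj₁ (Holds-∧⁻ D X hA)) i)
          x≡ : ∀ x (hA : Holds A (λ′ ⋆ x)) i → x i ≡ + suc N ⊛ z x hA i ⊕ + residue P i ⊛ oneC
          x≡ x hA i = trans (linear (x i ∷ + residue P i ⊛ oneC ∷ []) v₀ ((v₀ :+ :- v₁) :+ v₁) refl)
            (ap (λ e → e ⊕ + residue P i ⊛ oneC) (proj₂ (residual P λ′ x (proj₁ (Holds-∧⁻ D X hA)) i)))
          Sz : ∀ x → Holds A (λ′ ⋆ x) → Carrier
          Sz x hA = ∑ (λ i → a i ⊛ z x hA i)
          C : Carrier
          C = const L ⊛ oneC ⊕ ∑ (λ j → coef L (j ↑ˡ n) ⊛ λ′ j) ⊕ ∑ (λ i → a i ⊛ + residue P i ⊛ oneC)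
          value-L : ∀ x hA → eval L (λ′ ⋆ x) ≡ + suc N ⊛ Sz x hA ⊕ C
          value-L x hA = begin
            const L ⊛ oneC ⊕ ∑ (λ k → coef L k ⊛ (λ′ ⋆ x) k)
              ≡⟨ ap (λ e → const L ⊛ oneC ⊕ e) (trans (∑-++ m (λ k → coef L k ⊛ (λ′ ⋆ x) k)) (cong₂ _⊕_
                   (∑-cong λ j → ap (λ e → coef L (j ↑ˡ n) ⊛ e) (⋆ˡ λ′ x j))
                   (∑-cong λ i → trans (ap (λ e → a i ⊛ e) (trans (⋆ʳ λ′ x i) (x≡ x hA i)))
                     (trans (⊛-distribˡ (a i) _ _) (ap (λ e → e ⊕ a i ⊛ + residue P i ⊛ oneC) (swap (a i) (z x hA i))))))) ⟩
            const L ⊛ oneC ⊕ (∑ (λ j → coef L (j ↑ˡ n) ⊛ λ′ j) ⊕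
              ∑ (λ i → + suc N ⊛ a i ⊛ z x hA i ⊕ a i ⊛ + residue P i ⊛ oneC))
              ≡⟨ ap (λ e → const L ⊛ oneC ⊕ (∑ (λ j → coef L (j ↑ˡ n) ⊛ λ′ j) ⊕ e))
                   (trans (∑-⊕ (λ i → + suc N ⊛ a i ⊛ z x hA i) (λ i → a i ⊛ + residue P i ⊛ oneC))
                     (ap (λ e → e ⊕ ∑ (λ i → a i ⊛ + residue P i ⊛ oneC)) (∑-⊛ (+ suc N) (λ i → a i ⊛ z x hA i)))) ⟩
            const L ⊛ oneC ⊕ (∑ (λ j → coef L (j ↑ˡ n) ⊛ λ′ j) ⊕
              (+ suc N ⊛ Sz x hA ⊕ ∑ (λ i → a i ⊛ + residue P i ⊛ oneC)))
              ≡⟨ linear (const L ⊛ oneC ∷ ∑ (λ j → coef L (j ↑ˡ n) ⊛ λ′ j) ∷ + suc N ⊛ Sz x hA ∷ ∑ (λ i → a i ⊛ + residue P i ⊛ oneC) ∷ [])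
                   (v₀ :+ (v₁ :+ (v₂ :+ v₃))) (v₂ :+ (v₀ :+ v₁ :+ v₃)) refl ⟩
            + suc N ⊛ Sz x hA ⊕ C ∎
            where
            swap : ∀ b w → b ⊛ + suc N ⊛ w ≡ + suc N ⊛ b ⊛ w
            swap b w = trans (sym (⊛-assoc b (+ suc N) w))
              (trans (ap (λ c → c ⊛ w) (ℤP.*-comm b (+ suc N))) (⊛-assoc (+ suc N) b w))
          offset : ∀ x y (hA : Holds A (λ′ ⋆ x)) → Graph λ′ x y → + suc N ⊛ (y j ⊕ ⊝ Sz x hA) ≡ C
          offset x y hA g = begin
            + suc N ⊛ (y j ⊕ ⊝ Sz x hA)
              ≡⟨ trans (⊛-distribˡ (+ suc N) _ _) (ap (λ e → + suc N ⊛ y j ⊕ e) (⊛-⊝ (+ suc N) _)) ⟩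
            + suc N ⊛ y j ⊕ ⊝ (+ suc N ⊛ Sz x hA)
              ≡⟨ ap (λ e → e ⊕ ⊝ (+ suc N ⊛ Sz x hA)) (trans (proj₂ (Graph⇒ {λ′} {x} {y} g) j) (value-L x hA)) ⟩
            (+ suc N ⊛ Sz x hA ⊕ C) ⊕ ⊝ (+ suc N ⊛ Sz x hA)
              ≡⟨ linear (+ suc N ⊛ Sz x hA ∷ C ∷ []) ((v₀ :+ v₁) :+ :- v₀) v₁ refl ⟩
            C ∎
          y° : Vector Carrier n
          y° = proj₁ (total {λ′} {x°} hA°)
          -- C is (N + 1)γ by `offset`; its divisibility is not visible from its formula, but a
          -- point of the fibre supplies the quotient.
          γ : Carrier
          γ = y° j ⊕ ⊝ Sz x° hA°
          equation-γ : ∀ x y (hA : Holds A (λ′ ⋆ x)) → Graph λ′ x y →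
            y j ⊕ ∑ (λ i → negPart G (a i) • z x hA i) ≡ ∑ (λ i → posPart G (a i) • z x hA i) ⊕ γ
          equation-γ x y hA g = begin
            y j ⊕ n⁻
              ≡⟨ linear (y j ∷ n⁻ ∷ Sz x hA ∷ []) (v₀ :+ v₁) ((v₂ :+ v₁) :+ (v₀ :+ :- v₂)) refl ⟩
            (Sz x hA ⊕ n⁻) ⊕ (y j ⊕ ⊝ Sz x hA)
              ≡⟨ cong₂ (λ e f → (e ⊕ n⁻) ⊕ f) (∑-⊛-parts a (z x hA))
                   (⊛-injective N (trans (offset x y hA g) (sym (offset x° y° hA° (proj₂ (total {λ′} {x°} hA°)))))) ⟩
            ((n⁺ ⊕ ⊝ n⁻) ⊕ n⁻) ⊕ γ
              ≡⟨ linear (n⁺ ∷ n⁻ ∷ γ ∷ []) (((v₀ :+ :- v₁) :+ v₁) :+ v₂) (v₀ :+ v₂) refl ⟩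
            n⁺ ⊕ γ ∎
            where
            n⁺ = ∑ (λ i → posPart G (a i) • z x hA i)
            n⁻ = ∑ (λ i → negPart G (a i) • z x hA i)

      goodPiece : GoodPiece G m n (toFormula A)
      goodPiece = B ,
        (λ λ′ → mk⇔
          (λ { (x , hx) → let y , g = total {λ′} {x} (toFormula-sound A hx) in y , Graph-B {λ′} {x} {y} g })
          (λ { (y , b) → let x , g = surjective {λ′} {y} b in
            x , toFormula-complete A (proj₁ (Graph⇒ {λ′} {x} {y} g)) })) ,
        l , r , l+r≡n , toFormula F , λ { λ′ (x° , hx°) →
          ( (λ x y g → toFormula-complete A (proj₁ (Graph⇒ {λ′} {x} {y} g)))
          , (λ x hx → total {λ′} {x} (toFormula-sound A hx))
          , (λ x y y′ → functional {λ′} {x} {y} {y′})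
          , (λ x y → Graph-B {λ′} {x} {y})
          , (λ x x′ y g g′ i → trans (Graph-image {λ′} {x} {y} g i) (sym (Graph-image {λ′} {x′} {y} g′ i)))
          , (λ y → surjective {λ′} {y})) ,
          linear-Graph λ′ (x° , toFormula-sound A hx°) ,
          toFormula θ , bounded-Λ λ′ , λ y → mk⇔ (B⇒ {λ′} {y}) (⇒B {λ′} {y}) }

-- Signs, residues and the assembly of the partition

module Partition (G : ZGroup) where
  open GoodPieces G public

  -- Relative to a domain `D`, so that the partitions on the two sides of a cut of `D` can be
  -- joined.
  record Partitioned (m n : ℕ) (X D : QF (m ℕ.+ n)) : Set₁ where
    field
      size   : ℕ
      part   : Fin size → QF (m ℕ.+ n)
      sound  : ∀ j ρ → Holds (part j) ρ → Holds D ρ × Holds X ρ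
      covers : ∀ ρ → Holds D ρ → Holds X ρ → Σ (Fin size) λ j → Holds (part j) ρ
      unique : ∀ j j′ ρ → Holds (part j) ρ → Holds (part j′) ρ → j ≡ j′
      good   : ∀ j → GoodPiece G m n (toFormula (part j))

  module Assemble (m n : ℕ) (X : QF (m ℕ.+ n)) where
    open Partitioned

    R : QF (m ℕ.+ n) → Set₁
    R = Partitioned m n X

    none : ∀ D → (∀ ρ → ¬ Holds D ρ) → R D
    none D empty = record
      { size = 0 ; part = λ () ; sound = λ () ; covers = λ ρ h _ → ⊥-elim (empty ρ h)
      ; unique = λ () ; good = λ () }

    one : ∀ D → GoodPiece G m n (toFormula (D ∧ᶠ X)) → R D
    one D g = record
      { size = 1 ; part = λ _ → D ∧ᶠ X ; sound = λ _ ρ → Holds-∧⁻ D X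
      ; covers = λ ρ p q → zero , Holds-∧⁺ D X p q
      ; unique = λ { zero zero _ _ _ → refl } ; good = λ _ → g }

    node : ∀ D c → R (D ∧ᶠ c) → R (D ∧ᶠ ¬ᶠ c) → R D
    node D c S T = record
      { size = size S ℕ.+ size T ; part = parts
      ; sound = split-elim _ (λ i ρ h → soundˡ i ρ (resp (partsˡ i) ρ h)) (λ i ρ h → soundʳ i ρ (resp (partsʳ i) ρ h))
      ; covers = covers′
      ; unique = split-elim _
          (λ i → split-elim _
            (λ i′ ρ h h′ → ap (_↑ˡ size T) (unique S i i′ ρ (resp (partsˡ i) ρ h) (resp (partsˡ i′) ρ h′)))
            (λ i′ ρ h h′ → ⊥-elim (disjoint i i′ ρ (resp (partsˡ i) ρ h) (resp (partsʳ i′) ρ h′))))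
          (λ i → split-elim _
            (λ i′ ρ h h′ → ⊥-elim (disjoint i′ i ρ (resp (partsˡ i′) ρ h′) (resp (partsʳ i) ρ h)))
            (λ i′ ρ h h′ → ap (size S ↑ʳ_) (unique T i i′ ρ (resp (partsʳ i) ρ h) (resp (partsʳ i′) ρ h′))))
      ; good = λ j → good′ (splitAt (size S) j) }
      where
      parts : Fin (size S ℕ.+ size T) → QF (m ℕ.+ n)
      parts = part S VF.++ part T
      partsˡ : ∀ i → parts (i ↑ˡ size T) ≡ part S i
      partsˡ = VFP.lookup-++ˡ (part S) (part T)
      partsʳ : ∀ i → parts (size S ↑ʳ i) ≡ part T i
      partsʳ = VFP.lookup-++ʳ (part S) (part T)
      resp : ∀ {φ ψ : QF (m ℕ.+ n)} → φ ≡ ψ → ∀ ρ → Holds φ ρ → Holds ψ ρ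
      resp eq ρ = subst (λ φ → Holds φ ρ) eq
      soundˡ : ∀ i ρ → Holds (part S i) ρ → Holds D ρ × Holds X ρ
      soundˡ i ρ h = let p , q = sound S i ρ h in proj₁ (Holds-∧⁻ D c p) , q
      soundʳ : ∀ i ρ → Holds (part T i) ρ → Holds D ρ × Holds X ρ
      soundʳ i ρ h = let p , q = sound T i ρ h in proj₁ (Holds-∧⁻ D (¬ᶠ c) p) , q
      disjoint : ∀ i i′ ρ → Holds (part S i) ρ → ¬ Holds (part T i′) ρ
      disjoint i i′ ρ h h′ = contradictory
        (proj₂ (Holds-∧⁻ D c (proj₁ (sound S i ρ h))))
        (Holds-¬⁻ c (proj₂ (Holds-∧⁻ D (¬ᶠ c) (proj₁ (sound T i′ ρ h′)))))
      covers′ : ∀ ρ → Holds D ρ → Holds X ρ → Σ (Fin (size S ℕ.+ size T)) λ j → Holds (parts j) ρ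
      covers′ ρ hD hX with evalB c ρ in ec
      ... | true  = let j , h = covers S ρ (Holds-∧⁺ D c hD ec) hX in
                    j ↑ˡ size T , resp (sym (partsˡ j)) ρ h
      ... | false = let j , h = covers T ρ (Holds-∧⁺ D (¬ᶠ c) hD (Holds-¬⁺ c ec)) hX in
                    size S ↑ʳ j , resp (sym (partsʳ j)) ρ h
      good′ : ∀ s → GoodPiece G m n (toFormula (Sum.[ part S , part T ]′ s))
      good′ (inj₁ i) = good S i
      good′ (inj₂ i) = good T i

    N : ℕ
    N = modulus X

    open Refine m n N R node

    -- Invariant of the splitting by signs and residues. It guarantees that `D` fills an orthant
    -- over l as soon as it contains one point of it.
    Coarse : QF (m ℕ.+ n) → Set
    Coarse D = ∀ l x y → (∀ i → Dvd N (y i ⊕ ⊝ x i)) → (∀ i → posB (x i) ≡ posB (y i)) →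
      evalB D (l ⋆ x) ≡ evalB D (l ⋆ y)

    Coarse-nand : ∀ φ ψ → Coarse φ → Coarse ψ → Coarse (nand φ ψ)
    Coarse-nand φ ψ f g l x y d s = cong₂ (λ a b → not (a ∧ b)) (f l x y d s) (g l x y d s)

    Coarse-¬ : ∀ φ → Coarse φ → Coarse (¬ᶠ φ)
    Coarse-¬ φ f = Coarse-nand φ φ f f

    Coarse-∧ : ∀ φ ψ → Coarse φ → Coarse ψ → Coarse (φ ∧ᶠ ψ)
    Coarse-∧ φ ψ f g = Coarse-¬ (nand φ ψ) (Coarse-nand φ ψ f g)

    sign : Fin n → QF (m ℕ.+ n)
    sign i = ge (varᴸ (m ↑ʳ i))

    eval-coordinate : ∀ i l x → eval (varᴸ (m ↑ʳ i)) (l ⋆ x) ≡ x i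
    eval-coordinate i l x = trans (eval-var (m ↑ʳ i) _) (⋆ʳ l x i)

    evalB-sign : ∀ i l x → evalB (sign i) (l ⋆ x) ≡ posB (x i)
    evalB-sign i l x = ap posB (eval-coordinate i l x)

    Coarse-sign : ∀ i → Coarse (sign i)
    Coarse-sign i l x y d s = trans (evalB-sign i l x) (trans (s i) (sym (evalB-sign i l y)))

    hasResidue : Fin n → ℕ → QF (m ℕ.+ n)
    hasResidue i c = dvd N (varᴸ (m ↑ʳ i) +ᴸ -[1+ 0 ] *ᴸ constᴸ (+ c))

    eval-residue : ∀ i c l x → eval (varᴸ (m ↑ʳ i) +ᴸ -[1+ 0 ] *ᴸ constᴸ (+ c)) (l ⋆ x) ≡ x i ⊕ ⊝ (+ c ⊛ oneC)
    eval-residue i c l x = trans (eval-+ (varᴸ (m ↑ʳ i)) (-[1+ 0 ] *ᴸ constᴸ (+ c)) _)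
      (cong₂ _⊕_ (eval-coordinate i l x) (trans (eval-* -[1+ 0 ] (constᴸ (+ c)) (l ⋆ x))
        (trans (-1⊛ _) (ap ⊝_ (eval-const (+ c) (l ⋆ x))))))

    Coarse-hasResidue : ∀ i c → Coarse (hasResidue i c)
    Coarse-hasResidue i c l x y d s = trans (ap (dvdB N) (eval-residue i c l x))
      (trans (dvdB-shift (subst (Dvd N)
        (linear (x i ∷ y i ∷ + c ⊛ oneC ∷ []) (v₁ :+ :- v₀) ((v₁ :+ :- v₂) :+ :- (v₀ :+ :- v₂)) refl) (d i)))
        (sym (ap (dvdB N) (eval-residue i c l y))))

    HasSign : Bool → Fin n → QF (m ℕ.+ n) → Set
    HasSign σ i D = ∀ l x → Holds D (l ⋆ x) → posB (x i) ≡ σ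

    HasResidue : ℕ → Fin n → QF (m ℕ.+ n) → Set
    HasResidue c i D = ∀ l x → Holds D (l ⋆ x) → Dvd N (x i ⊕ ⊝ (+ c ⊛ oneC))

    Implies : QF (m ℕ.+ n) → QF (m ℕ.+ n) → Set
    Implies D′ D = ∀ ρ → Holds D′ ρ → Holds D ρ

    -- Residues from `b` upwards are already excluded; one class at a time is cut off, and a domain
    -- with none left is empty and contributes no part.
    splitResidue : ∀ i b → b ℕ.≤ suc N → ∀ D → Coarse D →
      (∀ l x → Holds D (l ⋆ x) → Σ ℕ λ c → c ℕ.< b × Dvd N (x i ⊕ ⊝ (+ c ⊛ oneC))) →
      (∀ D′ c → c ℕ.≤ N → Coarse D′ → Implies D′ D → HasResidue c i D′ → R D′) → R D
    splitResidue i zero b≤ D coarse res k = none D λ ρ h →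
      let c , c<0 , _ = res (λ j → ρ (j ↑ˡ n)) (λ i → ρ (m ↑ʳ i)) (trans (evalB-cong D (rejoin ρ)) h)
      in ℕP.n≮0 c<0
      where
      rejoin : ∀ (ρ : Env) k → ((λ j → ρ (j ↑ˡ n)) ⋆ (λ i → ρ (m ↑ʳ i))) k ≡ ρ k
      rejoin ρ = split-elim _ (⋆ˡ _ _) (⋆ʳ _ _)
    splitResidue i (suc b) b≤ D coarse res k = node D (hasResidue i b)
      (k (D ∧ᶠ hasResidue i b) b (ℕP.≤-pred b≤) (Coarse-∧ D (hasResidue i b) coarse (Coarse-hasResidue i b))
        (λ ρ h → proj₁ (Holds-∧⁻ D (hasResidue i b) h))
        (λ l x h → subst (Dvd N) (eval-residue i b l x) (dvdB⇒Dvd (proj₂ (Holds-∧⁻ D (hasResidue i b) h)))))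
      (splitResidue i b (ℕP.<⇒≤ b≤) (D ∧ᶠ ¬ᶠ hasResidue i b)
        (Coarse-∧ D (¬ᶠ hasResidue i b) coarse (Coarse-¬ (hasResidue i b) (Coarse-hasResidue i b)))
        (λ l x h → let hD , hc = Holds-∧⁻ D (¬ᶠ hasResidue i b) h in smaller l x hc (res l x hD))
        (λ D′ c c≤N coarse′ imp → k D′ c c≤N coarse′ λ ρ h → proj₁ (Holds-∧⁻ D (¬ᶠ hasResidue i b) (imp ρ h))))
      where
      smaller : ∀ l x → Holds (¬ᶠ hasResidue i b) (l ⋆ x) →
        (Σ ℕ λ c → c ℕ.< suc b × Dvd N (x i ⊕ ⊝ (+ c ⊛ oneC))) →
        Σ ℕ λ c → c ℕ.< b × Dvd N (x i ⊕ ⊝ (+ c ⊛ oneC))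
      smaller l x hc (c , c<1+b , d) with c ℕP.≟ b
      ... | yes refl = ⊥-elim (contradictory
              (dvdB-true (subst (Dvd N) (sym (eval-residue i c l x)) d)) (Holds-¬⁻ (hasResidue i c) hc))
      ... | no c≢b   = c , ℕP.≤∧≢⇒< (ℕP.≤-pred c<1+b) c≢b , d

    someResidue : ∀ x → Σ ℕ λ c → c ℕ.< suc N × Dvd N (x ⊕ ⊝ (+ c ⊛ oneC))
    someResidue x = let q , c , c≤N , eq = remainder N x in
      c , s≤s c≤N , q , trans (ap (λ e → e ⊕ ⊝ (+ c ⊛ oneC)) eq)
        (linear (+ c ⊛ oneC ∷ + suc N ⊛ q ∷ []) ((v₀ :+ v₁) :+ :- v₀) v₁ refl)

    splitCoordinate : ∀ i D → Coarse D →
      (∀ D′ σ c → c ℕ.≤ N → Coarse D′ → Implies D′ D → HasSign σ i D′ → HasResidue c i D′ → R D′) → R D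
    splitCoordinate i D coarse k = node D (sign i)
      (splitResidue i (suc N) ℕP.≤-refl (D ∧ᶠ sign i) (Coarse-∧ D (sign i) coarse (Coarse-sign i))
        (λ l x _ → someResidue (x i))
        (λ D′ c c≤N coarse′ imp → k D′ true c c≤N coarse′
          (λ ρ h → proj₁ (Holds-∧⁻ D (sign i) (imp ρ h)))
          (λ l x h → trans (sym (evalB-sign i l x)) (proj₂ (Holds-∧⁻ D (sign i) (imp _ h))))))
      (splitResidue i (suc N) ℕP.≤-refl (D ∧ᶠ ¬ᶠ sign i)
        (Coarse-∧ D (¬ᶠ sign i) coarse (Coarse-¬ (sign i) (Coarse-sign i)))
        (λ l x _ → someResidue (x i))
        (λ D′ c c≤N coarse′ imp → k D′ false c c≤N coarse′
          (λ ρ h → proj₁ (Holds-∧⁻ D (¬ᶠ sign i) (imp ρ h)))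
          (λ l x h → trans (sym (evalB-sign i l x))
            (Holds-¬⁻ (sign i) (proj₂ (Holds-∧⁻ D (¬ᶠ sign i) (imp _ h)))))))

    splitCoordinates : ∀ j (e : Fin j → Fin n) D → Coarse D →
      (∀ D′ (σ : Fin j → Bool) (c : Fin j → ℕ) → (∀ i → c i ℕ.≤ N) → Coarse D′ → Implies D′ D →
        (∀ i → HasSign (σ i) (e i) D′) → (∀ i → HasResidue (c i) (e i) D′) → R D′) → R D
    splitCoordinates zero e D coarse k = k D (λ ()) (λ ()) (λ ()) coarse (λ _ h → h) (λ ()) (λ ())
    splitCoordinates (suc j) e D coarse k =
      splitCoordinate (e zero) D coarse λ D₁ σ₀ c₀ c₀≤N coarse₁ imp₁ hs₀ hr₀ →
      splitCoordinates j (λ i → e (suc i)) D₁ coarse₁ λ D₂ σ c c≤N coarse₂ imp₂ hs hr →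
      k D₂ (σ₀ VF.∷ σ) (c₀ VF.∷ c) (λ { zero → c₀≤N ; (suc i) → c≤N i }) coarse₂
        (λ ρ h → imp₁ ρ (imp₂ ρ h))
        (λ { zero l x h → hs₀ l x (imp₂ _ h) ; (suc i) → hs i })
        (λ { zero l x h → hr₀ l x (imp₂ _ h) ; (suc i) → hr i })

    module Orthant (D : QF (m ℕ.+ n)) (σ : Fin n → Bool) (c : Fin n → ℕ) (c≤N : ∀ i → c i ℕ.≤ N)
      (coarse : Coarse D) (hs : ∀ i → HasSign (σ i) i D) (hr : ∀ i → HasResidue (c i) i D) where

      private
        var′ : Fin n → Lin (m ℕ.+ n)
        var′ i = varᴸ (m ↑ʳ i)

        -- x = c + (N + 1) q, where q = p for x ≥ 0 and q = −p − 1 for x < 0.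
        flip : Bool → Carrier → Carrier
        flip true  x = x
        flip false x = ⊝ x ⊕ ⊝ oneC

        flipᴸ : Bool → ∀ {k} → Lin k → Lin k
        flipᴸ true  L = L
        flipᴸ false L = complᴸ L

        eval-flip : ∀ b {k} (L : Lin k) ρ → eval (flipᴸ b L) ρ ≡ flip b (eval L ρ)
        eval-flip true  L ρ = refl
        eval-flip false L ρ = eval-compl L ρ

        flip-flip : ∀ b x → flip b (flip b x) ≡ x
        flip-flip true  x = refl
        flip-flip false x = linear (x ∷ []) (:- (:- v₀ :+ :- :1) :+ :- :1) v₀ refl

        posB-flip : ∀ b x → posB (flip b x) ≡ b → Pos x
        posB-flip true  x e = posB⇒Pos e
        posB-flip false x e = posB⇒Pos (BoolP.not-injective (trans (sym (posB-compl x)) e))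

        flip-posB : ∀ b x → Pos x → posB (flip b x) ≡ b
        flip-posB true  x p = posB-true p
        flip-posB false x p = trans (posB-compl x) (ap not (posB-true p))

        bwd₀ fwd₀ : Fin n → Lin (m ℕ.+ n)
        bwd₀ i = constᴸ (+ c i) +ᴸ + suc N *ᴸ flipᴸ (σ i) (var′ i)

        -- For negative x one has x - c = (N + 1)(-p - 1), hence (N + 1)p = -(x - c) - (N + 1).
        fwd₀ i with σ i
        ... | true  = var′ i +ᴸ -[1+ 0 ] *ᴸ constᴸ (+ c i)
        ... | false = (-[1+ 0 ] *ᴸ (var′ i +ᴸ -[1+ 0 ] *ᴸ constᴸ (+ c i))) +ᴸ constᴸ -[1+ N ]

        image₀ : ∀ l p i → image bwd₀ l p i ≡ + c i ⊛ oneC ⊕ + suc N ⊛ flip (σ i) (p i)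
        image₀ l p i = trans (eval-+ (constᴸ (+ c i)) (+ suc N *ᴸ flipᴸ (σ i) (var′ i)) _)
          (cong₂ _⊕_ (eval-const (+ c i) (l ⋆ p)) (trans (eval-* (+ suc N) (flipᴸ (σ i) (var′ i)) _)
            (ap (λ e → + suc N ⊛ e) (trans (eval-flip (σ i) (var′ i) _) (ap (flip (σ i)) (eval-coordinate i l p))))))

        difference : ∀ l p i → eval (var′ i +ᴸ -[1+ 0 ] *ᴸ constᴸ (+ c i)) (point bwd₀ l p) ≡ + suc N ⊛ flip (σ i) (p i)
        difference l p i = trans (eval-residue i (c i) l (image bwd₀ l p))
          (trans (ap (λ e → e ⊕ ⊝ (+ c i ⊛ oneC)) (image₀ l p i))
            (linear (+ c i ⊛ oneC ∷ + suc N ⊛ flip (σ i) (p i) ∷ []) ((v₀ :+ v₁) :+ :- v₀) v₁ refl))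

        fwd-bwd₀ : ∀ l p i → eval (fwd₀ i) (point bwd₀ l p) ≡ + suc N ⊛ p i
        fwd-bwd₀ l p i with σ i | difference l p i
        ... | true  | eq = eq
        ... | false | eq = begin
          eval ((-[1+ 0 ] *ᴸ (var′ i +ᴸ -[1+ 0 ] *ᴸ constᴸ (+ c i))) +ᴸ constᴸ -[1+ N ]) ρ
            ≡⟨ eval-+ (-[1+ 0 ] *ᴸ (var′ i +ᴸ -[1+ 0 ] *ᴸ constᴸ (+ c i))) (constᴸ -[1+ N ]) ρ ⟩
          eval (-[1+ 0 ] *ᴸ (var′ i +ᴸ -[1+ 0 ] *ᴸ constᴸ (+ c i))) ρ ⊕ eval (constᴸ -[1+ N ]) ρ
            ≡⟨ cong₂ _⊕_ (trans (eval-* -[1+ 0 ] (var′ i +ᴸ -[1+ 0 ] *ᴸ constᴸ (+ c i)) ρ)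
                 (trans (-1⊛ _) (ap ⊝_ eq))) (trans (eval-const -[1+ N ] ρ) minus) ⟩
          ⊝ (+ suc N ⊛ (⊝ p i ⊕ ⊝ oneC)) ⊕ ⊝ (+ suc N ⊛ oneC)
            ≡⟨ ap (λ e → ⊝ e ⊕ ⊝ (+ suc N ⊛ oneC)) (trans (⊛-distribˡ (+ suc N) _ _)
                 (cong₂ _⊕_ (⊛-⊝ (+ suc N) (p i)) (⊛-⊝ (+ suc N) oneC))) ⟩
          ⊝ (⊝ (+ suc N ⊛ p i) ⊕ ⊝ (+ suc N ⊛ oneC)) ⊕ ⊝ (+ suc N ⊛ oneC)
            ≡⟨ linear (+ suc N ⊛ p i ∷ + suc N ⊛ oneC ∷ []) (:- (:- v₀ :+ :- v₁) :+ :- v₁) v₀ refl ⟩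
          + suc N ⊛ p i ∎
          where
          open ≡-Reasoning
          ρ = point bwd₀ l p
          minus : -[1+ N ] ⊛ oneC ≡ ⊝ (+ suc N ⊛ oneC)
          minus = trans (ap (λ a → a ⊛ oneC) (sym (ℤP.-1*i≡-i (+ suc N))))
            (trans (⊛-assoc -[1+ 0 ] (+ suc N) oneC) (-1⊛ _))

        sign-image : ∀ l p i → posB (image bwd₀ l p i) ≡ posB (flip (σ i) (p i))
        sign-image l p i = trans (ap posB (image₀ l p i)) (posB-quotient N (c i) _ (c≤N i))

        onto₀ : ∀ l x → Holds D (l ⋆ x) → Σ (Vector Carrier n) λ p → ∀ i → x i ≡ image bwd₀ l p i
        onto₀ l x h = (λ i → flip (σ i) (proj₁ (hr i l x h))) , λ i → trans
          (linear (x i ∷ + c i ⊛ oneC ∷ []) v₀ (v₁ :+ (v₀ :+ :- v₁)) refl)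
          (trans (ap (λ e → + c i ⊛ oneC ⊕ e) (trans (proj₂ (hr i l x h))
            (ap (λ e → + suc N ⊛ e) (sym (flip-flip (σ i) _))))) (sym (image₀ l _ i)))

        nonneg₀ : ∀ l p → Holds D (point bwd₀ l p) → ∀ i → Pos (p i)
        nonneg₀ l p h i = posB-flip (σ i) (p i) (trans (sym (sign-image l p i)) (hs i l _ h))

        -- Moving p within H^n keeps the signs of x and changes x by multiples of N + 1, so `Coarse`
        -- transfers membership.
        saturated₀ : ∀ l p q → Holds D (point bwd₀ l p) → (∀ i → Pos (q i)) → Holds D (point bwd₀ l q)
        saturated₀ l p q h q≥0 = trans (sym (coarse l (image bwd₀ l p) (image bwd₀ l q)
          (λ i → flip (σ i) (q i) ⊕ ⊝ flip (σ i) (p i) , (begin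
            image bwd₀ l q i ⊕ ⊝ image bwd₀ l p i
              ≡⟨ cong₂ (λ e f → e ⊕ ⊝ f) (image₀ l q i) (image₀ l p i) ⟩
            (+ c i ⊛ oneC ⊕ + suc N ⊛ flip (σ i) (q i)) ⊕ ⊝ (+ c i ⊛ oneC ⊕ + suc N ⊛ flip (σ i) (p i))
              ≡⟨ linear (+ c i ⊛ oneC ∷ + suc N ⊛ flip (σ i) (q i) ∷ + suc N ⊛ flip (σ i) (p i) ∷ [])
                   ((v₀ :+ v₁) :+ :- (v₀ :+ v₂)) (v₁ :+ :- v₂) refl ⟩
            + suc N ⊛ flip (σ i) (q i) ⊕ ⊝ (+ suc N ⊛ flip (σ i) (p i))
              ≡⟨ trans (⊛-distribˡ (+ suc N) _ _) (ap (λ e → + suc N ⊛ flip (σ i) (q i) ⊕ e) (⊛-⊝ (+ suc N) _)) ⟨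
            + suc N ⊛ (flip (σ i) (q i) ⊕ ⊝ flip (σ i) (p i)) ∎))
          λ i → trans (hs i l _ h) (sym (trans (sign-image l q i) (flip-posB (σ i) (q i) (q≥0 i)))))) h
          where open ≡-Reasoning

      orthant : Piece D
      orthant = record
        { fwd = fwd₀ ; bwd = bwd₀ ; free = λ _ → true ; fwd-bwd = fwd-bwd₀ ; onto = onto₀
        ; nonneg = λ l p h i _ → nonneg₀ l p h i
        -- All coordinates are free at the start, so the bound is vacuous.
        ; bounded = λ l → zeroC , 0≼0 , λ p h i ()
        ; saturated = λ l p q h _ q≥0 → saturated₀ l p q h λ i → q≥0 i refl
        ; residue = c ; residue≤ = c≤N ; residual = λ l x h i → hr i l x h }

    partition : R ⊤ᶠ
    partition = splitCoordinates n (λ i → i) ⊤ᶠ (λ l x y _ _ → trans (Holds-⊤ {ρ = l ⋆ x}) (sym (Holds-⊤ {ρ = l ⋆ y})))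
      λ D σ c c≤N coarse _ hs hr →
        refineAll X (modulus-divides X) (Orthant.orthant D σ c c≤N coarse hs hr) λ {D′} P _ X-indep →
          one D′ (Leaf.goodPiece m n N X D′ P X-indep)

  rectilinearization : ∀ m n (X : Formula (m ℕ.+ n)) →
    Σ ℕ (λ k → Σ (Fin k → Formula (m ℕ.+ n)) (λ P →
      IsPartition G k X P × ((j : Fin k) → GoodPiece G m n (P j))))
  rectilinearization m n X = size , (λ j → toFormula (part j)) ,
    ( (λ j ρ h → qe-sound X (proj₂ (sound j ρ (toFormula-sound (part j) h))))
    , (λ ρ h → let j , hj = covers ρ (Holds-⊤ {ρ = ρ}) (qe-complete X h) in j , toFormula-complete (part j) hj)
    , (λ j j′ ρ h h′ → unique j j′ ρ (toFormula-sound (part j) h) (toFormula-sound (part j′) h′))) ,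
    good
    where open Partitioned (Assemble.partition m n (qe X))

mainTheorem5 : (G : ZGroup) (m n : ℕ) (X : Formula (m + n)) →
    Σ ℕ (λ k → Σ (Fin k → Formula (m + n)) (λ P →
    IsPartition G k X P × ((j : Fin k) → GoodPiece G m n (P j))))
mainTheorem5 G = Partition.rectilinearization G
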